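{- Let $q\in\mathbf C$ with $|q|<1$ and $\omega=e^{2\pi i/3}$. Then $$\left(\sum_{m,n\in\mathbf Z}\omega^{m-n}q^{m^2+mn+n^2}\right)^3+\left(3\sum_{m,n\in\mathbf Z}q^{3((m+1/3)^2+(m+1/3)n+n^2)}\right)^3=\left(\sum_{m,n\in\mathbf Z}q^{m^2+mn+n^2}\right)^3$$ and $$\left(\sum_{m,n\in\mathbf Z}\omega^{m-n}q^{3m^2+3mn+n^2}\right)^3+\left(\sum_{m,n\in\mathbf Z}q^{3(3(m+1/3)^2+3(m+1/3)n+n^2)}\right)^3=\left(\sum_{m,n\in\mathbf Z}q^{3(3m^2+3mn+n^2)}\right)^3.$$
   Context: Fractional powers of $q$ (with exponents in $\tfrac13\mathbf Z$) are formed using one fixed cube root $q^{1/3}$ of $q$, i.e. $q^{k/3}=(q^{1/3})^k$ (and $0^0=1$). -}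

module Defs where

open import Algebra.Bundles.Raw using (RawRing)
import Algebra.Definitions.RawSemiring as RawSemiringDefs
open import Data.Integer.Base as ℤ using (ℤ; +_; -[1+_])
open import Data.List.Base using (List; map; foldr)
open import Data.List.Relation.Binary.Subset.Propositional using (_⊆_)
open import Data.List.Relation.Unary.Unique.Propositional using (Unique)
open import Data.Nat.Base as ℕ using (ℕ; suc; _!)
import Data.Nat.Properties as ℕ
open import Data.Product.Base using (∃-syntax; _×_; _,_)
open import Data.Rational.Base as ℚ using (ℚ; 0ℚ; 1ℚ; ½; ↥_)
import Data.Rational.Properties as ℚ
open import Data.Rational.Solver using (module +-*-Solver)
open import Level using (0ℓ)
open import Relation.Binary.PropositionalEquality
  using (_≡_; refl; sym; trans; cong; cong₂; subst)
open import Relation.Nullary using (¬_)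

------------------------------------------------------------------------
-- Real numbers: Cauchy sequences of rationals

IsCauchy : (ℕ → ℚ) → Set
IsCauchy x = ∀ {ε} → 0ℚ ℚ.< ε →
  ∃[ N ] ∀ m n → N ℕ.≤ m → N ℕ.≤ n → ℚ.∣ x m ℚ.- x n ∣ ℚ.< ε

record ℝ : Set where
  constructor mkℝ
  field
    seq    : ℕ → ℚ
    cauchy : IsCauchy seq

open ℝ public

infix 4 _≃ℝ_ _<ℝ_

_≃ℝ_ : ℝ → ℝ → Set
x ≃ℝ y = ∀ {ε} → 0ℚ ℚ.< ε →
  ∃[ N ] ∀ n → N ℕ.≤ n → ℚ.∣ seq x n ℚ.- seq y n ∣ ℚ.< ε

-- Eventual termwise inequality is not enough: the gap must be bounded away
-- from 0.
_<ℝ_ : ℝ → ℝ → Set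
x <ℝ y = ∃[ ε ] (0ℚ ℚ.< ε) ×
  (∃[ N ] ∀ n → N ℕ.≤ n → seq x n ℚ.+ ε ℚ.≤ seq y n)

private
  open +-*-Solver

  0<½* : ∀ {ε} → 0ℚ ℚ.< ε → 0ℚ ℚ.< ½ ℚ.* ε
  0<½* {ε} 0<ε = subst (ℚ._< ½ ℚ.* ε) (ℚ.*-zeroʳ ½) (ℚ.*-monoʳ-<-pos ½ 0<ε)

  halves : ∀ ε → ½ ℚ.* ε ℚ.+ ½ ℚ.* ε ≡ ε
  halves ε = trans (sym (ℚ.*-distribʳ-+ ε ½ ½)) (ℚ.*-identityˡ ε)

  const-cauchy : ∀ p → IsCauchy (λ _ → p)
  const-cauchy p {ε} 0<ε = 0 , λ _ _ _ _ →
    subst (ℚ._< ε) (sym (cong ℚ.∣_∣ (ℚ.+-inverseʳ p))) 0<ε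

  neg-cauchy : ∀ {x} → IsCauchy x → IsCauchy (λ n → ℚ.- x n)
  neg-cauchy {x} cx {ε} 0<ε with N , h ← cx 0<ε = N , λ m n N≤m N≤n →
    subst (ℚ._< ε)
      (trans (sym (ℚ.∣-p∣≡∣p∣ (x m ℚ.- x n)))
             (cong ℚ.∣_∣ (ℚ.neg-distrib-+ (x m) (ℚ.- x n))))
      (h m n N≤m N≤n)

  +-diff : ∀ a b c d → (a ℚ.+ b) ℚ.- (c ℚ.+ d) ≡ (a ℚ.- c) ℚ.+ (b ℚ.- d)
  +-diff = solve 4 (λ a b c d → (a :+ b) :- (c :+ d) := (a :- c) :+ (b :- d)) refl

  sub-add : ∀ a b → a ≡ (a ℚ.- b) ℚ.+ b
  sub-add = solve 2 (λ a b → a := (a :- b) :+ b) refl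

  +-cauchy : ∀ {x y} → IsCauchy x → IsCauchy y → IsCauchy (λ n → x n ℚ.+ y n)
  +-cauchy {x} {y} cx cy {ε} 0<ε
    with M , h ← cx (0<½* 0<ε) | N , k ← cy (0<½* 0<ε) =
    M ℕ.⊔ N , λ m n ≤m ≤n → begin-strict
      ℚ.∣ (x m ℚ.+ y m) ℚ.- (x n ℚ.+ y n) ∣
        ≡⟨ cong ℚ.∣_∣ (+-diff (x m) (y m) (x n) (y n)) ⟩
      ℚ.∣ (x m ℚ.- x n) ℚ.+ (y m ℚ.- y n) ∣
        ≤⟨ ℚ.∣p+q∣≤∣p∣+∣q∣ (x m ℚ.- x n) (y m ℚ.- y n) ⟩
      ℚ.∣ x m ℚ.- x n ∣ ℚ.+ ℚ.∣ y m ℚ.- y n ∣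
        <⟨ ℚ.+-mono-<
             (h m n (ℕ.≤-trans (ℕ.m≤m⊔n M N) ≤m) (ℕ.≤-trans (ℕ.m≤m⊔n M N) ≤n))
             (k m n (ℕ.≤-trans (ℕ.m≤n⊔m M N) ≤m) (ℕ.≤-trans (ℕ.m≤n⊔m M N) ≤n)) ⟩
      ½ ℚ.* ε ℚ.+ ½ ℚ.* ε
        ≡⟨ halves ε ⟩
      ε ∎
    where open ℚ.≤-Reasoning

  eventually-bounded : ∀ {x} → IsCauchy x →
    ∃[ B ] ℚ.Positive B × (∃[ N ] ∀ n → N ℕ.≤ n → ℚ.∣ x n ∣ ℚ.≤ B)
  eventually-bounded {x} cx with N , h ← cx (ℚ.positive⁻¹ 1ℚ) =
    1ℚ ℚ.+ ℚ.∣ x N ∣ ,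
    ℚ.positive (ℚ.+-mono-<-≤ (ℚ.positive⁻¹ 1ℚ) (ℚ.0≤∣p∣ (x N))) ,
    N , λ n N≤n → begin
      ℚ.∣ x n ∣
        ≡⟨ cong ℚ.∣_∣ (sub-add (x n) (x N)) ⟩
      ℚ.∣ (x n ℚ.- x N) ℚ.+ x N ∣
        ≤⟨ ℚ.∣p+q∣≤∣p∣+∣q∣ (x n ℚ.- x N) (x N) ⟩
      ℚ.∣ x n ℚ.- x N ∣ ℚ.+ ℚ.∣ x N ∣
        ≤⟨ ℚ.+-monoˡ-≤ ℚ.∣ x N ∣ (ℚ.<⇒≤ (h n N N≤n ℕ.≤-refl)) ⟩
      1ℚ ℚ.+ ℚ.∣ x N ∣ ∎
    where open ℚ.≤-Reasoning

  shrink : ∀ {ε} → 0ℚ ℚ.< ε → ∀ B → ℚ.Positive B →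
    ∃[ δ ] (0ℚ ℚ.< δ) × (B ℚ.* δ ≡ ½ ℚ.* ε)
  shrink {ε} 0<ε B posB = B⁻¹ ℚ.* (½ ℚ.* ε) ,
    subst (ℚ._< B⁻¹ ℚ.* (½ ℚ.* ε)) (ℚ.*-zeroʳ B⁻¹) (ℚ.*-monoʳ-<-pos B⁻¹ (0<½* 0<ε)) ,
    trans (sym (ℚ.*-assoc B B⁻¹ (½ ℚ.* ε)))
      (trans (cong (ℚ._* (½ ℚ.* ε)) (ℚ.*-inverseʳ B)) (ℚ.*-identityˡ (½ ℚ.* ε)))
    where
    instance
      _ = posB
      _ = ℚ.pos⇒nonZero B
    B⁻¹ = ℚ.1/ B
    instance
      _ = ℚ.1/pos⇒pos B

  *-small : ∀ a b B δ → ℚ.Positive B → ℚ.∣ a ∣ ℚ.≤ B → ℚ.∣ b ∣ ℚ.< δ →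
    ℚ.∣ a ℚ.* b ∣ ℚ.< B ℚ.* δ
  *-small a b B δ posB a≤B b<δ = begin-strict
    ℚ.∣ a ℚ.* b ∣           ≡⟨ ℚ.∣p*q∣≡∣p∣*∣q∣ a b ⟩
    ℚ.∣ a ∣ ℚ.* ℚ.∣ b ∣     ≤⟨ ℚ.*-monoʳ-≤-nonNeg ℚ.∣ b ∣ {{ℚ.nonNegative (ℚ.0≤∣p∣ b)}} a≤B ⟩
    B ℚ.* ℚ.∣ b ∣           <⟨ ℚ.*-monoʳ-<-pos B {{posB}} b<δ ⟩
    B ℚ.* δ ∎
    where open ℚ.≤-Reasoning

  telescope : ∀ p q r → p ℚ.- r ≡ (p ℚ.- q) ℚ.+ (q ℚ.- r)
  telescope = solve 3 (λ p q r → p :- r := (p :- q) :+ (q :- r)) refl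

  *-distribˡ-- : ∀ a b c → a ℚ.* b ℚ.- a ℚ.* c ≡ a ℚ.* (b ℚ.- c)
  *-distribˡ-- a b c = trans (cong (a ℚ.* b ℚ.+_) (ℚ.neg-distribʳ-* a c))
                             (sym (ℚ.*-distribˡ-+ a b (ℚ.- c)))

  *-diff : ∀ a b c d → a ℚ.* b ℚ.- c ℚ.* d ≡ a ℚ.* (b ℚ.- d) ℚ.+ d ℚ.* (a ℚ.- c)
  *-diff a b c d = trans (telescope (a ℚ.* b) (a ℚ.* d) (c ℚ.* d))
    (cong₂ ℚ._+_ (*-distribˡ-- a b d)
      (trans (cong₂ ℚ._-_ (ℚ.*-comm a d) (ℚ.*-comm c d)) (*-distribˡ-- d a c)))

  *-close : ∀ a b c d {A B α β ε} → ℚ.Positive A → ℚ.Positive B →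
    A ℚ.* α ≡ ½ ℚ.* ε → B ℚ.* β ≡ ½ ℚ.* ε →
    ℚ.∣ a ∣ ℚ.≤ A → ℚ.∣ b ℚ.- d ∣ ℚ.< α →
    ℚ.∣ d ∣ ℚ.≤ B → ℚ.∣ a ℚ.- c ∣ ℚ.< β →
    ℚ.∣ a ℚ.* b ℚ.- c ℚ.* d ∣ ℚ.< ε
  *-close a b c d {A} {B} {α} {β} {ε} posA posB Aα≡ Bβ≡ a≤A b-d<α d≤B a-c<β = begin-strict
    ℚ.∣ a ℚ.* b ℚ.- c ℚ.* d ∣
      ≡⟨ cong ℚ.∣_∣ (*-diff a b c d) ⟩
    ℚ.∣ a ℚ.* (b ℚ.- d) ℚ.+ d ℚ.* (a ℚ.- c) ∣
      ≤⟨ ℚ.∣p+q∣≤∣p∣+∣q∣ (a ℚ.* (b ℚ.- d)) (d ℚ.* (a ℚ.- c)) ⟩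
    ℚ.∣ a ℚ.* (b ℚ.- d) ∣ ℚ.+ ℚ.∣ d ℚ.* (a ℚ.- c) ∣
      <⟨ ℚ.+-mono-< (*-small a (b ℚ.- d) A α posA a≤A b-d<α)
                    (*-small d (a ℚ.- c) B β posB d≤B a-c<β) ⟩
    A ℚ.* α ℚ.+ B ℚ.* β
      ≡⟨ cong₂ ℚ._+_ Aα≡ Bβ≡ ⟩
    ½ ℚ.* ε ℚ.+ ½ ℚ.* ε
      ≡⟨ halves ε ⟩
    ε ∎
    where open ℚ.≤-Reasoning

  *-cauchy : ∀ {x y} → IsCauchy x → IsCauchy y → IsCauchy (λ n → x n ℚ.* y n)
  *-cauchy {x} {y} cx cy {ε} 0<ε =
    let A , posA , K , x≤A = eventually-bounded cx
        B , posB , L , y≤B = eventually-bounded cy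
        α , 0<α , Aα≡      = shrink 0<ε A posA
        β , 0<β , Bβ≡      = shrink 0<ε B posB
        M , h              = cx 0<β
        N , k              = cy 0<α
        KL = K ℕ.⊔ L
        MN = M ℕ.⊔ N
        ≤KL = ℕ.m≤m⊔n KL MN
        ≤MN = ℕ.m≤n⊔m KL MN
        K≤ = ℕ.≤-trans (ℕ.m≤m⊔n K L) ≤KL
        L≤ = ℕ.≤-trans (ℕ.m≤n⊔m K L) ≤KL
        M≤ = ℕ.≤-trans (ℕ.m≤m⊔n M N) ≤MN
        N≤ = ℕ.≤-trans (ℕ.m≤n⊔m M N) ≤MN
    in KL ℕ.⊔ MN , λ m n ≤m ≤n →
      *-close (x m) (y m) (x n) (y n) posA posB Aα≡ Bβ≡
        (x≤A m (ℕ.≤-trans K≤ ≤m)) (k m n (ℕ.≤-trans N≤ ≤m) (ℕ.≤-trans N≤ ≤n))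
        (y≤B n (ℕ.≤-trans L≤ ≤n)) (h m n (ℕ.≤-trans M≤ ≤m) (ℕ.≤-trans M≤ ≤n))

infixl 6 _+ℝ_
infixl 7 _*ℝ_
infix  8 -ℝ_

ℚ→ℝ : ℚ → ℝ
ℚ→ℝ p = mkℝ (λ _ → p) (const-cauchy p)

0ℝ 1ℝ : ℝ
0ℝ = ℚ→ℝ 0ℚ
1ℝ = ℚ→ℝ 1ℚ

_+ℝ_ _*ℝ_ : ℝ → ℝ → ℝ
x +ℝ y = mkℝ (λ n → seq x n ℚ.+ seq y n) (+-cauchy {seq x} {seq y} (cauchy x) (cauchy y))
x *ℝ y = mkℝ (λ n → seq x n ℚ.* seq y n) (*-cauchy {seq x} {seq y} (cauchy x) (cauchy y))

-ℝ_ : ℝ → ℝ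
-ℝ x = mkℝ (λ n → ℚ.- seq x n) (neg-cauchy {seq x} (cauchy x))

------------------------------------------------------------------------
-- Complex numbers

infix 5 _+i_
record ℂ : Set where
  constructor _+i_
  field
    re im : ℝ

open ℂ public

infix  4 _≃_
infixl 6 _+_ _-_
infixl 7 _*_
infix  8 -_

_≃_ : ℂ → ℂ → Set
z ≃ w = (re z ≃ℝ re w) × (im z ≃ℝ im w)

ℚ→ℂ : ℚ → ℂ
ℚ→ℂ p = ℚ→ℝ p +i 0ℝ

0ℂ 1ℂ : ℂ
0ℂ = ℚ→ℂ 0ℚ
1ℂ = ℚ→ℂ 1ℚ

_+_ _*_ : ℂ → ℂ → ℂ
z + w = (re z +ℝ re w) +i (im z +ℝ im w)
z * w = (re z *ℝ re w +ℝ -ℝ (im z *ℝ im w)) +i (re z *ℝ im w +ℝ im z *ℝ re w)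

-_ : ℂ → ℂ
- z = (-ℝ re z) +i (-ℝ im z)

_-_ : ℂ → ℂ → ℂ
z - w = z + (- w)

ℂ-rawRing : RawRing 0ℓ 0ℓ
ℂ-rawRing = record
  { Carrier = ℂ ; _≈_ = _≃_ ; _+_ = _+_ ; _*_ = _*_ ; -_ = -_ ; 0# = 0ℂ ; 1# = 1ℂ }

-- In particular z ^ 0 = 1ℂ for every z, so 0⁰ = 1.
open RawSemiringDefs (RawRing.rawSemiring ℂ-rawRing) public using (_^_)

normSq : ℂ → ℝ
normSq z = re z *ℝ re z +ℝ im z *ℝ im z

-- |z| < r, written without the square root; only meant for r > 0.
∣_∣<_ : ℂ → ℚ → Set
∣ z ∣< r = normSq z <ℝ ℚ→ℝ (r ℚ.* r)

record ℂˣ : Set where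
  field
    val inv : ℂ
    val*inv : val * inv ≃ 1ℂ

open ℂˣ public

infixr 8 _^ℤ_ _^[3×_]

_^ℤ_ : ℂˣ → ℤ → ℂ
u ^ℤ (+ n)    = val u ^ n
u ^ℤ -[1+ n ] = inv u ^ suc n

-- For r a cube root of q and e a non-negative element of ⅓ℤ, this is
-- q^e = r^(3e): the rational 3e is then an integer and equals its numerator.
_^[3×_] : ℂ → ℚ → ℂ
r ^[3× e ] = r ^ ℤ.∣ ↥ ((+ 3 ℚ./ 1) ℚ.* e) ∣

------------------------------------------------------------------------
-- Sums of unordered (equivalently, absolutely convergent) families

∑ : {I : Set} → (I → ℂ) → List I → ℂ
∑ f is = foldr _+_ 0ℂ (map f is)

-- The finite partial sums converge to s along the directed set of finite
-- subsets of I, a finite subset being listed without repetition.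
HasSum : {I : Set} → (I → ℂ) → ℂ → Set
HasSum {I} f s = ∀ {ε} → 0ℚ ℚ.< ε →
  ∃[ F₀ ] ∀ (F : List I) → Unique F → F₀ ⊆ F → ∣ ∑ f F - s ∣< ε

------------------------------------------------------------------------
-- exp, sin and π, as relations between argument and value

IsExp : ℂ → ℂ → Set
IsExp z w = HasSum (λ n → ℚ→ℂ ((+ 1 ℚ./ (n !)) {{n ℕ.!≢0}}) * z ^ n) w

-- s is the imaginary part of exp (i x).
IsSin : ℝ → ℝ → Set
IsSin x s = ∃[ c ] IsExp (0ℝ +i x) (c +i s)

-- π is the least positive zero of sin.
IsPi : ℝ → Set
IsPi π = (0ℝ <ℝ π) × IsSin π 0ℝ × (∀ x → 0ℝ <ℝ x → x <ℝ π → ¬ IsSin x 0ℝ)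

module Submission where

-- Let L be the Eisenstein lattice with its norm N, and let α and γ be the sums of q^N
-- over the classes 0 and 1 of L modulo √-3. As the class -1 also has sum γ, the sums
-- of the first identity are A = α - γ (by 1 + ω + ω² = 0) and C = α + 2 γ, so that
-- C³ - A³ = 9 γ (α² + α γ + γ²), and the identity says that
-- 3 B³ = γ (α² + α γ + γ²), B being the sum of q^(N/3) over 1 + 3 L.
-- Now B³ is a sum over (1 + 3 L)³. The 3 × 3 Fourier matrix divided by √-3 is unitary,
-- maps (1 + 3 L)³ into √-3 L³, and after division by √-3 its image consists of the
-- (u , v , w) with v ≡ w modulo √-3 and u + v + w ≡ 1 modulo 3. This set and its
-- images under (u , v , w) ↦ (ω u , v , ω² w) and the inverse partition the triples
-- with v ≡ w ≡ u - 1 modulo √-3, whose sum is γ α² + γ γ² + α γ².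
--
-- The second identity is the first one at q³, after rearranging its sums: its B is the
-- sum γ at q, which splits into the three rotations of 1 + 3 L, and its A is averaged
-- over the rotations by ω, which leaves the multiples of √-3 only.
--
-- That 1 + ω + ω² = 0 follows from exp (z + w) = exp z exp w: ω³ = exp (π i)² = 1, and
-- ω is not real by the minimality of π.

open import Defs hiding (_+_; _*_; -_; _-_; _^_; ℚ→ℂ; 0ℂ; 1ℂ)
import Defs as D
open import Algebra.Bundles using (CommutativeRing)
open import Algebra.Structures using (IsCommutativeRing)
import Algebra.Definitions.RawMonoid as RawMonoidDefs
import Algebra.Properties.Ring as RingProperties
import Algebra.Properties.Semiring.Exp as SemiringExp
import Algebra.Properties.Semiring.Mult.TCOptimised as SemiringMult
import Algebra.Solver.Ring as RingSolver
open import Algebra.Solver.Ring.AlmostCommutativeRing using (fromCommutativeRing; _-Raw-AlmostCommutative⟶_)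
open import Data.Empty using (⊥-elim)
open import Data.Integer.Base as ℤ using (ℤ; +_; -[1+_])
import Data.Integer.Properties as ℤ
open import Data.Nat.Coprimality as Coprimality using (Coprime; 1-coprimeTo)
open import Data.List.Base using (List; []; _∷_; _++_; map; foldr; filter; deduplicate; cartesianProduct; downFrom)
open import Data.List.Membership.Propositional using (_∈_; _∉_)
open import Data.List.Membership.Propositional.Properties
  using (∈-++⁺ˡ; ∈-++⁺ʳ; ∈-++⁻; ∈-map⁺; ∈-map⁻; ∈-filter⁺; ∈-filter⁻; ∈-cartesianProduct⁺; ∈-downFrom⁺; ∈-downFrom⁻; ∈-deduplicate⁺; ∈-deduplicate⁻)
open import Data.List.Membership.Propositional.Properties.WithK using (unique∧set⇒bag)
open import Data.List.Relation.Binary.BagAndSetEquality using (∼bag⇒↭)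
open import Data.List.Relation.Binary.Permutation.Propositional as Perm using (_↭_)
open import Data.List.Relation.Binary.Subset.Propositional using (_⊆_)
open import Data.List.Relation.Unary.All as All using (All; []; _∷_)
open import Data.List.Relation.Unary.AllPairs as AllPairs using ([]; _∷_)
import Data.List.Relation.Unary.AllPairs.Properties as AllPairs
open import Data.List.Relation.Unary.Any using (here; there)
open import Data.List.Relation.Unary.Unique.Propositional using (Unique)
import Data.List.Relation.Unary.Unique.Propositional.Properties as Unique
import Data.List.Membership.DecPropositional as DecMembership
import Data.List.Relation.Unary.Unique.DecPropositional.Properties as DecUnique
open import Data.Fin.Base using (Fin; zero; suc; toℕ; fromℕ<)
import Data.Fin.Properties as Fin
import Data.Integer.DivMod as ℤ
import Data.Maybe.Base as Maybe
open import Data.Nat.Divisibility using (_∣_; divides; _∣?_)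
open import Data.Vec.Base as Vec using (Vec; []; _∷_; lookup)
import Data.Vec.Properties as Vec
open import Data.Nat.Base as ℕ using (ℕ; zero; suc; _!; z≤n; s≤s)
import Data.Nat.Properties as ℕ
open import Data.Product.Base using (∃-syntax; _×_; _,_; proj₁; proj₂)
open import Data.Product.Properties using (≡-dec)
open import Data.Rational.Base as ℚ using (ℚ; 0ℚ; 1ℚ; ½; mkℚ; *≤*)
import Data.Rational.Properties as ℚ
open import Data.Sum.Base using (_⊎_; inj₁; inj₂; [_,_]′)
open import Data.Unit.Base using (⊤; tt)
open import Function.Base using (_∘_; id)
open import Function.Bundles using (mk⇔)
open import Level as Level using (0ℓ)
open import Relation.Binary.Definitions using (DecidableEquality)
import Relation.Binary.Reasoning.Setoid as SetoidReasoning
open import Relation.Binary.Structures using (IsEquivalence)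
open import Relation.Binary.PropositionalEquality as ≡
  using (_≡_; _≢_; refl; sym; trans; cong; cong₂; subst; subst₂)
open import Relation.Nullary using (¬_; Dec; yes; no; contradiction)
open import Relation.Nullary.Decidable using (dec⇒maybe; ¬?; from-yes; from-no)

-- Dividing the Fourier matrix by 3 multiplies the total norm of a triple by 1/3; this is what turns
-- the exponents N/3 in B³ into the integral exponents of α and γ. The triples on both sides are
-- matched through 0/1 indicators: a sum over a sublattice or a coset becomes a sum over all of L or
-- L³ weighted by an indicator. The indicators depend only on residues modulo 3, so each partition
-- is a check of finitely many cases, 729 of them for L³. Real numbers are Cauchy sequences, whose
-- equality is undecidable. Sums therefore have to be constructed: each family is bounded, from one
-- approximation index on, by a summable rational weight, and this uniformity makes the diagonal of
-- its approximations a Cauchy sequence. Likewise the nonreality of ω is a mere negation and does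
-- not permit division by ω - ω²; the missing lower bound comes from a case distinction on a
-- rational approximation of |ω - ω²|².

module IntegerSolver {c ℓ} (R : CommutativeRing c ℓ) where
  open CommutativeRing R renaming (refl to ≈-refl; sym to ≈-sym; trans to ≈-trans)
  open RingProperties ring using (-‿involutive; -‿+-comm; -‿distribˡ-*; -‿distribʳ-*; -0#≈0#)
  open SemiringMult semiring using (1+×; ×-homo-+; ×1-homo-*) renaming (_×_ to _·_)
  open import Relation.Binary.Reasoning.Setoid setoid

  ⟦_⟧ : ℤ → Carrier
  ⟦ + n ⟧      = n · 1#
  ⟦ -[1+ n ] ⟧ = - (suc n · 1#)

  ⟦⟧-neg : ∀ i → ⟦ ℤ.- i ⟧ ≈ - ⟦ i ⟧
  ⟦⟧-neg (+ zero)   = ≈-sym -0#≈0#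
  ⟦⟧-neg (+ suc n)  = ≈-refl
  ⟦⟧-neg -[1+ n ]   = ≈-sym (-‿involutive _)

  ⟦⟧-⊖ : ∀ m n → ⟦ m ℤ.⊖ n ⟧ ≈ m · 1# + - (n · 1#)
  ⟦⟧-⊖ m       zero    = ≈-sym (≈-trans (+-congˡ -0#≈0#) (+-identityʳ _))
  ⟦⟧-⊖ zero    (suc n) = ≈-sym (+-identityˡ _)
  ⟦⟧-⊖ (suc m) (suc n) = begin
    ⟦ suc m ℤ.⊖ suc n ⟧                  ≡⟨ cong ⟦_⟧ (ℤ.[1+m]⊖[1+n]≡m⊖n m n) ⟩
    ⟦ m ℤ.⊖ n ⟧                          ≈⟨ ⟦⟧-⊖ m n ⟩
    m · 1# + - (n · 1#)                  ≈⟨ +-congˡ (≈-trans (+-congʳ (-‿inverseʳ 1#)) (+-identityˡ _)) ⟨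
    m · 1# + ((1# + - 1#) + - (n · 1#))  ≈⟨ +-congˡ (+-assoc _ _ _) ⟩
    m · 1# + (1# + (- 1# + - (n · 1#)))  ≈⟨ +-assoc _ _ _ ⟨
    (m · 1# + 1#) + (- 1# + - (n · 1#))  ≈⟨ +-cong (+-comm _ _) (-‿+-comm _ _) ⟩
    (1# + m · 1#) + - (1# + n · 1#)      ≈⟨ +-cong (1+× m 1#) (-‿cong (1+× n 1#)) ⟨
    suc m · 1# + - (suc n · 1#)          ∎

  ⟦⟧-+ : ∀ i j → ⟦ i ℤ.+ j ⟧ ≈ ⟦ i ⟧ + ⟦ j ⟧
  ⟦⟧-+ (+ m)    (+ n)    = ×-homo-+ 1# m n
  ⟦⟧-+ (+ m)    -[1+ n ] = ⟦⟧-⊖ m (suc n)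
  ⟦⟧-+ -[1+ m ] (+ n)    = ≈-trans (⟦⟧-⊖ n (suc m)) (+-comm _ _)
  ⟦⟧-+ -[1+ m ] -[1+ n ] = begin
    - (suc (suc (m ℕ.+ n)) · 1#)      ≡⟨ cong (λ k → - (suc k · 1#)) (ℕ.+-suc m n) ⟨
    - ((suc m ℕ.+ suc n) · 1#)        ≈⟨ -‿cong (×-homo-+ 1# (suc m) (suc n)) ⟩
    - (suc m · 1# + suc n · 1#)       ≈⟨ -‿+-comm _ _ ⟨
    - (suc m · 1#) + - (suc n · 1#)   ∎

  ⟦⟧-pos-* : ∀ m j → ⟦ + m ℤ.* j ⟧ ≈ m · 1# * ⟦ j ⟧
  ⟦⟧-pos-* m (+ n) = begin
    ⟦ + m ℤ.* + n ⟧          ≡⟨ cong ⟦_⟧ (ℤ.pos-* m n) ⟨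
    (m ℕ.* n) · 1#           ≈⟨ ×1-homo-* m n ⟩
    (m · 1#) * (n · 1#)      ∎
  ⟦⟧-pos-* m -[1+ n ] = begin
    ⟦ + m ℤ.* -[1+ n ] ⟧             ≡⟨ cong ⟦_⟧ (ℤ.neg-distribʳ-* (+ m) (+ suc n)) ⟨
    ⟦ ℤ.- (+ m ℤ.* + suc n) ⟧        ≈⟨ ⟦⟧-neg (+ m ℤ.* + suc n) ⟩
    - ⟦ + m ℤ.* + suc n ⟧            ≈⟨ -‿cong (⟦⟧-pos-* m (+ suc n)) ⟩
    - (m · 1# * (suc n · 1#))        ≈⟨ -‿distribʳ-* _ _ ⟩
    m · 1# * - (suc n · 1#)          ∎

  ⟦⟧-* : ∀ i j → ⟦ i ℤ.* j ⟧ ≈ ⟦ i ⟧ * ⟦ j ⟧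
  ⟦⟧-* (+ m)    j = ⟦⟧-pos-* m j
  ⟦⟧-* -[1+ m ] j = begin
    ⟦ -[1+ m ] ℤ.* j ⟧               ≡⟨ cong ⟦_⟧ (ℤ.neg-distribˡ-* (+ suc m) j) ⟨
    ⟦ ℤ.- (+ suc m ℤ.* j) ⟧          ≈⟨ ⟦⟧-neg (+ suc m ℤ.* j) ⟩
    - ⟦ + suc m ℤ.* j ⟧              ≈⟨ -‿cong (⟦⟧-pos-* (suc m) j) ⟩
    - (suc m · 1# * ⟦ j ⟧)           ≈⟨ -‿distribˡ-* _ _ ⟩
    - (suc m · 1#) * ⟦ j ⟧           ∎

  morphism : CommutativeRing.rawRing ℤ.+-*-commutativeRing -Raw-AlmostCommutative⟶ fromCommutativeRing R
  morphism = record
    { ⟦_⟧ = ⟦_⟧ ; +-homo = ⟦⟧-+ ; *-homo = ⟦⟧-* ; -‿homo = ⟦⟧-neg ; 0-homo = ≈-refl ; 1-homo = ≈-refl }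

  open RingSolver (CommutativeRing.rawRing ℤ.+-*-commutativeRing) (fromCommutativeRing R) morphism
    (λ i j → Maybe.map (λ eq → reflexive (cong ⟦_⟧ eq)) (dec⇒maybe (i ℤ.≟ j)))
    using (Polynomial; solve; _:=_; _:+_; _:*_; _:-_; :-_; con) public

-- Identities are solved over a variable ring and then instantiated: at ℚ itself
-- the solver would have to unfold rational arithmetic.
module Identities {c ℓ} (R : CommutativeRing c ℓ) where
  open IntegerSolver R
  open CommutativeRing R renaming (refl to ≈-refl; sym to ≈-sym; trans to ≈-trans)

  2# 3# : Carrier
  2# = 1# + 1#
  3# = 2# + 1#

  form : Carrier → Carrier → Carrier
  form m n = m * m + m * n + n * n

  formᵖ : ∀ {k} → Polynomial k → Polynomial k → Polynomial k
  formᵖ m n = m :* m :+ m :* n :+ n :* n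

  *-assoc-re : ∀ a b c d e f →
    (a * c + - (b * d)) * e + - ((a * d + b * c) * f) ≈ a * (c * e + - (d * f)) + - (b * (c * f + d * e))
  *-assoc-re = solve 6 (λ a b c d e f →
    (a :* c :+ :- (b :* d)) :* e :+ :- ((a :* d :+ b :* c) :* f) :=
    a :* (c :* e :+ :- (d :* f)) :+ :- (b :* (c :* f :+ d :* e))) ≈-refl

  *-assoc-im : ∀ a b c d e f →
    (a * c + - (b * d)) * f + (a * d + b * c) * e ≈ a * (c * f + d * e) + b * (c * e + - (d * f))
  *-assoc-im = solve 6 (λ a b c d e f →
    (a :* c :+ :- (b :* d)) :* f :+ (a :* d :+ b :* c) :* e :=
    a :* (c :* f :+ d :* e) :+ b :* (c :* e :+ :- (d :* f))) ≈-refl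

  *-comm-re : ∀ a b c d → a * c + - (b * d) ≈ c * a + - (d * b)
  *-comm-re = solve 4 (λ a b c d → a :* c :+ :- (b :* d) := c :* a :+ :- (d :* b)) ≈-refl

  *-comm-im : ∀ a b c d → a * d + b * c ≈ c * b + d * a
  *-comm-im = solve 4 (λ a b c d → a :* d :+ b :* c := c :* b :+ d :* a) ≈-refl

  *-identityˡ-re : ∀ a b → 1# * a + - (0# * b) ≈ a
  *-identityˡ-re = solve 2 (λ a b → con (+ 1) :* a :+ :- (con (+ 0) :* b) := a) ≈-refl

  *-identityˡ-im : ∀ a b → 1# * b + 0# * a ≈ b
  *-identityˡ-im = solve 2 (λ a b → con (+ 1) :* b :+ con (+ 0) :* a := b) ≈-refl

  distribˡ-re : ∀ a b c d e f →
    a * (c + e) + - (b * (d + f)) ≈ (a * c + - (b * d)) + (a * e + - (b * f))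
  distribˡ-re = solve 6 (λ a b c d e f →
    a :* (c :+ e) :+ :- (b :* (d :+ f)) := (a :* c :+ :- (b :* d)) :+ (a :* e :+ :- (b :* f))) ≈-refl

  distribˡ-im : ∀ a b c d e f → a * (d + f) + b * (c + e) ≈ (a * d + b * c) + (a * f + b * e)
  distribˡ-im = solve 6 (λ a b c d e f →
    a :* (d :+ f) :+ b :* (c :+ e) := (a :* d :+ b :* c) :+ (a :* f :+ b :* e)) ≈-refl

  interchange : ∀ a b c d → (a + b) + (c + d) ≈ (a + c) + (b + d)
  interchange = solve 4 (λ a b c d → (a :+ b) :+ (c :+ d) := (a :+ c) :+ (b :+ d)) ≈-refl

  expand : ∀ a b c d → (a * c + b * d) + (a * d + b * c) ≈ (a + b) * (c + d)
  expand = solve 4 (λ a b c d → (a :* c :+ b :* d) :+ (a :* d :+ b :* c) := (a :+ b) :* (c :+ d)) ≈-refl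

  neg-+ : ∀ a b → - (a + b) ≈ - a + - b
  neg-+ = solve 2 (λ a b → :- (a :+ b) := :- a :+ :- b) ≈-refl

  neg-0 : - 0# ≈ 0#
  neg-0 = RingProperties.-0#≈0# ring

  neg-*-neg : ∀ a b → - a * - b ≈ a * b
  neg-*-neg = solve 2 (λ a b → :- a :* :- b := a :* b) ≈-refl

  conj-im : ∀ a b c d → - (a * d + b * c) ≈ a * - d + - b * c
  conj-im = solve 4 (λ a b c d → :- (a :* d :+ b :* c) := a :* :- d :+ :- b :* c) ≈-refl

  cancel : ∀ a b → (a + b) - a ≈ b
  cancel = solve 2 (λ a b → (a :+ b) :- a := b) ≈-refl

  quintuple : ∀ a → (a + 2# * a) + 2# * a ≈ (2# + 3#) * a
  quintuple = solve 1 (λ a → (a :+ con (+ 2) :* a) :+ con (+ 2) :* a := (con (+ 2) :+ con (+ 3)) :* a) ≈-refl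

  path : ∀ a b c d → (- (b - a) + (b - c)) + (c - d) ≈ a - d
  path = solve 4 (λ a b c d → (:- (b :- a) :+ (b :- c)) :+ (c :- d) := a :- d) ≈-refl

  *-swap : ∀ a b c → a * (b * c) ≈ b * (a * c)
  *-swap = solve 3 (λ a b c → a :* (b :* c) := b :* (a :* c)) ≈-refl

  *-rotate : ∀ a b c → a * b * c ≈ b * (a * c)
  *-rotate = solve 3 (λ a b c → a :* b :* c := b :* (a :* c)) ≈-refl

  bernoulli-step : ∀ t p n →
    t * p * (1# + (1# + n) * (1# - t)) + p * ((1# + n) * ((1# - t) * (1# - t))) ≈ p * (1# + n * (1# - t))
  bernoulli-step = solve 3 (λ t p n →
    t :* p :* (con (+ 1) :+ (con (+ 1) :+ n) :* (con (+ 1) :- t)) :+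
    p :* ((con (+ 1) :+ n) :* ((con (+ 1) :- t) :* (con (+ 1) :- t))) :=
    p :* (con (+ 1) :+ n :* (con (+ 1) :- t))) ≈-refl

  archimedean-step : ∀ k e d → k * (e * d) + e ≈ e * (1# + k * d)
  archimedean-step = solve 3 (λ k e d → k :* (e :* d) :+ e := e :* (con (+ 1) :+ k :* d)) ≈-refl

  telescope-step : ∀ t p s → (1# - t) * (p + s) + t * p ≈ (1# - t) * s + p
  telescope-step = solve 3 (λ t p s →
    (con (+ 1) :- t) :* (p :+ s) :+ t :* p := (con (+ 1) :- t) :* s :+ p) ≈-refl

  brahmagupta : ∀ a b c d →
    (a * c + - (b * d)) * (a * c + - (b * d)) + (a * d + b * c) * (a * d + b * c) ≈ (a * a + b * b) * (c * c + d * d)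
  brahmagupta = solve 4 (λ a b c d →
    (a :* c :+ :- (b :* d)) :* (a :* c :+ :- (b :* d)) :+ (a :* d :+ b :* c) :* (a :* d :+ b :* c) :=
    (a :* a :+ b :* b) :* (c :* c :+ d :* d)) ≈-refl

  modulus : ∀ a b → a * a + - (b * - b) ≈ a * a + b * b
  modulus = solve 2 (λ a b → a :* a :+ :- (b :* :- b) := a :* a :+ b :* b) ≈-refl

  square-sum : ∀ a b → (a * a + b * b) + (a * b + a * b) ≈ (a + b) * (a + b)
  square-sum = solve 2 (λ a b → (a :* a :+ b :* b) :+ (a :* b :+ a :* b) := (a :+ b) :* (a :+ b)) ≈-refl

  +-difference-cancel : ∀ a b → (a + b) - b ≈ a
  +-difference-cancel = solve 2 (λ a b → (a :+ b) :- b := a) ≈-refl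

  half-way : ∀ a h → h + h ≈ 1# → a + h * (1# - a) ≈ 1# - h * (1# - a)
  half-way a h 2h≈1 = ≈-trans
    (solve 2 (λ a h → a :+ h :* (con (+ 1) :- a) :=
       (a :+ (h :+ h) :* (con (+ 1) :- a)) :- h :* (con (+ 1) :- a)) ≈-refl a h)
    (+-congʳ (≈-trans (+-congˡ (≈-trans (*-congʳ 2h≈1) (*-identityˡ _)))
      (solve 1 (λ a → a :+ (con (+ 1) :- a) := con (+ 1)) ≈-refl a)))

  third : ∀ a t → 3# * t ≈ 1# → t * (3# * a) ≈ a
  third a t 3t≈1 = ≈-trans (solve 2 (λ t a → t :* (con (+ 3) :* a) := con (+ 3) :* t :* a) ≈-refl t a)
    (≈-trans (*-congʳ 3t≈1) (*-identityˡ a))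

  third′ : ∀ a t → 3# * t ≈ 1# → t * ((1# - a) + 2#) ≈ 1# - t * a
  third′ a t 3t≈1 = ≈-trans
    (solve 2 (λ t a → t :* ((con (+ 1) :- a) :+ con (+ 2)) := con (+ 3) :* t :- t :* a) ≈-refl t a)
    (+-congʳ 3t≈1)

  cubic : ∀ a → 3# * a + (a - 1#) * (a - 1#) * (a + 2#) ≈ a * (a * (a * 1#)) + 2#
  cubic = solve 1 (λ a → con (+ 3) :* a :+ (a :- con (+ 1)) :* (a :- con (+ 1)) :* (a :+ con (+ 2)) :=
    a :* (a :* (a :* con (+ 1))) :+ con (+ 2)) ≈-refl

  average-gap : ∀ a h → h + h ≈ 1# → h * (1# + a) + h * (1# - a) ≈ 1#
  average-gap a h 2h≈1 = ≈-trans
    (solve 2 (λ a h → h :* (con (+ 1) :+ a) :+ h :* (con (+ 1) :- a) := h :+ h) ≈-refl a h) 2h≈1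

  average-square : ∀ a h → h + h ≈ 1# → a + (h * (1# - a)) * (h * (1# - a)) ≈ (h * (1# + a)) * (h * (1# + a))
  average-square a h 2h≈1 = ≈-trans
    (+-congʳ (≈-sym (≈-trans (*-congʳ (≈-trans (*-cong 2h≈1 2h≈1) (*-identityˡ 1#))) (*-identityˡ a))))
    (solve 2 (λ a h → (h :+ h) :* (h :+ h) :* a :+ (h :* (con (+ 1) :- a)) :* (h :* (con (+ 1) :- a)) :=
       (h :* (con (+ 1) :+ a)) :* (h :* (con (+ 1) :+ a))) ≈-refl a h)

  norm-double : ∀ m n → 2# * form m n ≈ (m * m + n * n) + (m + n) * (m + n)
  norm-double = solve 2 (λ m n → con (+ 2) :* formᵖ m n := (m :* m :+ n :* n) :+ (m :+ n) :* (m :+ n)) ≈-refl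

  *-regroup : ∀ a x b y → a * x * (b * y) ≈ a * b * x * y
  *-regroup = solve 4 (λ a x b y → a :* x :* (b :* y) := a :* b :* x :* y) ≈-refl

  *-rotate′ : ∀ a b c → a * (b * c) ≈ a * c * b
  *-rotate′ = solve 3 (λ a b c → a :* (b :* c) := a :* c :* b) ≈-refl

  *-swap′ : ∀ a b c → a * (b * c) ≈ b * a * c
  *-swap′ = solve 3 (λ a b c → a :* (b :* c) := b :* a :* c) ≈-refl

  real-* : ∀ a b → a * b + - (0# * 0#) ≈ a * b
  real-* = solve 2 (λ a b → a :* b :+ :- (con (+ 0) :* con (+ 0)) := a :* b) ≈-refl

  sub-0 : ∀ a → a - 0# ≈ a
  sub-0 = solve 1 (λ a → a :- con (+ 0) := a) ≈-refl

  double-neg : ∀ a → 2# * a ≈ a - - a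
  double-neg = solve 1 (λ a → con (+ 2) :* a := a :- (:- a)) ≈-refl

  *-interchange : ∀ a b → a * b * (a * b) ≈ a * a * (b * b)
  *-interchange = solve 2 (λ a b → a :* b :* (a :* b) := a :* a :* (b :* b)) ≈-refl

  root-factor : ∀ w → (w - w * w) * ((1# + w) + w * w) ≈ w * (1# - (w * w) * w)
  root-factor = solve 1 (λ w →
    (w :- w :* w) :* ((con (+ 1) :+ w) :+ w :* w) := w :* (con (+ 1) :- (w :* w) :* w)) ≈-refl

  root-square : ∀ w → (w - w * w) * (w - w * w) + 3# ≈
    ((1# + w) + w * w) + (1# - (w * w) * w) * (2# - w)
  root-square = solve 1 (λ w → (w :- w :* w) :* (w :- w :* w) :+ con (+ 3) :=
    ((con (+ 1) :+ w) :+ w :* w) :+ (con (+ 1) :- (w :* w) :* w) :* (con (+ 2) :- w)) ≈-refl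

  -- In the application `a` and `b` are the two parts of a number with a² + b² at most 5/2, and the
  -- right side is the real part of its square plus 3. The left side exhibits this as ½ plus
  -- nonnegative terms.
  half-bound : ∀ a b h → h + h ≈ 1# →
    h + ((a * a + a * a) + (((1# + h) + 1#) - (a * a + b * b))) ≈ (a * a + - (b * b)) + 3#
  half-bound a b h 2h≈1 = ≈-trans
    (solve 3 (λ a b h →
      h :+ ((a :* a :+ a :* a) :+ (((con (+ 1) :+ h) :+ con (+ 1)) :- (a :* a :+ b :* b))) :=
      (a :* a :+ :- (b :* b)) :+ (con (+ 2) :+ (h :+ h))) ≈-refl a b h)
    (+-congˡ (+-congˡ 2h≈1))

  remainder-difference : ∀ r s a b → r + 3# * a ≈ s + 3# * b →
    r - s ≈ 3# * (b - a)
  remainder-difference r s a b eq = ≈-trans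
    (solve 3 (λ r s a → r :- s := (r :+ con (+ 3) :* a) :- (s :+ con (+ 3) :* a)) ≈-refl r s a)
    (≈-trans (+-congʳ eq)
      (solve 3 (λ s a b → (s :+ con (+ 3) :* b) :- (s :+ con (+ 3) :* a) := con (+ 3) :* (b :- a)) ≈-refl s a b))

  carry-+ : ∀ r s a b t c → r + s ≈ t + 3# * c →
    (r + 3# * a) + (s + 3# * b) ≈ t + 3# * (c + (a + b))
  carry-+ r s a b t c eq = ≈-trans
    (solve 4 (λ r s a b → (r :+ con (+ 3) :* a) :+ (s :+ con (+ 3) :* b) := (r :+ s) :+ con (+ 3) :* (a :+ b)) ≈-refl r s a b)
    (≈-trans (+-congʳ eq)
      (solve 4 (λ t c a b → (t :+ con (+ 3) :* c) :+ con (+ 3) :* (a :+ b) := t :+ con (+ 3) :* (c :+ (a :+ b))) ≈-refl t c a b))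

  carry-neg : ∀ r a t c → - r ≈ t + 3# * c →
    - (r + 3# * a) ≈ t + 3# * (c - a)
  carry-neg r a t c eq = ≈-trans
    (solve 2 (λ r a → :- (r :+ con (+ 3) :* a) := :- r :- con (+ 3) :* a) ≈-refl r a)
    (≈-trans (+-congʳ eq)
      (solve 3 (λ t c a → (t :+ con (+ 3) :* c) :- con (+ 3) :* a := t :+ con (+ 3) :* (c :- a)) ≈-refl t c a))

  rotation-inverse₁ : ∀ m n → - n - (- m - n) ≈ m
  rotation-inverse₁ = solve 2 (λ m n → :- n :- (:- m :- n) := m) ≈-refl

  rotation-inverse₂ : ∀ m n → - (- m - n) - m ≈ n
  rotation-inverse₂ = solve 2 (λ m n → :- (:- m :- n) :- m := n) ≈-refl

  coset-form : ∀ m → (1# + 3# * m) + - 1# ≈ 3# * m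
  coset-form = solve 1 (λ m → (con (+ 1) :+ con (+ 3) :* m) :+ :- con (+ 1) := con (+ 3) :* m) ≈-refl

  coset-point : ∀ m → 1# + (m + - 1#) ≈ m
  coset-point = solve 1 (λ m → con (+ 1) :+ (m :+ :- con (+ 1)) := m) ≈-refl

  √-3-form : ∀ m n → (m + 2# * n) + - (- (2# * m) - n) ≈ 3# * (m + n)
  √-3-form = solve 2 (λ m n → (m :+ con (+ 2) :* n) :+ :- (:- (con (+ 2) :* m) :- n) := con (+ 3) :* (m :+ n)) ≈-refl

  √-3-point₁ : ∀ m n → 2# * (m + n) - (m + 2# * n) ≈ m
  √-3-point₁ = solve 2 (λ m n → con (+ 2) :* (m :+ n) :- (m :+ con (+ 2) :* n) := m) ≈-refl

  √-3-point₂ : ∀ m n → (m + 2# * n) - (m + n) ≈ n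
  √-3-point₂ = solve 2 (λ m n → (m :+ con (+ 2) :* n) :- (m :+ n) := n) ≈-refl

  √-3-image₁ : ∀ a k → (2# * k - a) + 2# * (a - k) ≈ a
  √-3-image₁ = solve 2 (λ a k → (con (+ 2) :* k :- a) :+ con (+ 2) :* (a :- k) := a) ≈-refl

  √-3-image₂ : ∀ a k → - (2# * (2# * k - a)) - (a - k) ≈ a - 3# * k
  √-3-image₂ = solve 2 (λ a k → :- (con (+ 2) :* (con (+ 2) :* k :- a)) :- (a :- k) := a :- con (+ 3) :* k) ≈-refl

  √-3-image₃ : ∀ a b → a - (a + - b) ≈ b
  √-3-image₃ = solve 2 (λ a b → a :- (a :+ :- b) := b) ≈-refl

  shear-form : ∀ m n → ((3# * m + 1# + n) + - n) + - 1# ≈ 3# * m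
  shear-form = solve 2 (λ m n → ((con (+ 3) :* m :+ con (+ 1) :+ n) :+ :- n) :+ :- con (+ 1) := con (+ 3) :* m) ≈-refl

  shear-point : ∀ a b → ((a + - b) + - 1#) + 1# + b ≈ a
  shear-point = solve 2 (λ a b → ((a :+ :- b) :+ :- con (+ 1)) :+ con (+ 1) :+ b := a) ≈-refl

  -- `fourier₁` to `fourier₆` are the coordinates of one equation: the conjugate Fourier matrix
  -- undoes the Fourier matrix divided by 3, and removing the offset 1 from 1 + 3 x, 1 + 3 y, 1 + 3
  -- z leaves multiples of 3.
  fourier₁ : ∀ x₁ x₂ y₁ y₂ z₁ z₂ →
    (1# + x₁ + y₁ + z₁) + (x₁ + (- y₁ - y₂) + z₂) + (x₁ + y₂ + (- z₁ - z₂)) + - 1# ≈ 3# * x₁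
  fourier₁ = solve 6 (λ x₁ x₂ y₁ y₂ z₁ z₂ →
    (con (+ 1) :+ x₁ :+ y₁ :+ z₁) :+ (x₁ :+ (:- y₁ :- y₂) :+ z₂) :+ (x₁ :+ y₂ :+ (:- z₁ :- z₂)) :+ :- con (+ 1) := con (+ 3) :* x₁) ≈-refl

  fourier₂ : ∀ x₁ x₂ y₁ y₂ z₁ z₂ →
    (x₂ + y₂ + z₂) + (x₂ + y₁ + (- z₁ - z₂)) + (x₂ + (- y₁ - y₂) + z₁) ≈ 3# * x₂
  fourier₂ = solve 6 (λ x₁ x₂ y₁ y₂ z₁ z₂ →
    (x₂ :+ y₂ :+ z₂) :+ (x₂ :+ y₁ :+ (:- z₁ :- z₂)) :+ (x₂ :+ (:- y₁ :- y₂) :+ z₁) := con (+ 3) :* x₂) ≈-refl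

  fourier₃ : ∀ x₁ x₂ y₁ y₂ z₁ z₂ →
    (1# + x₁ + y₁ + z₁) + (x₂ + y₁ + (- z₁ - z₂)) + (- (x₁ + y₂ + (- z₁ - z₂)) + - (x₂ + (- y₁ - y₂) + z₁)) + - 1# ≈ 3# * y₁
  fourier₃ = solve 6 (λ x₁ x₂ y₁ y₂ z₁ z₂ →
    (con (+ 1) :+ x₁ :+ y₁ :+ z₁) :+ (x₂ :+ y₁ :+ (:- z₁ :- z₂)) :+ (:- (x₁ :+ y₂ :+ (:- z₁ :- z₂)) :+ :- (x₂ :+ (:- y₁ :- y₂) :+ z₁)) :+ :- con (+ 1) := con (+ 3) :* y₁) ≈-refl

  fourier₄ : ∀ x₁ x₂ y₁ y₂ z₁ z₂ →
    (x₂ + y₂ + z₂) + (- (x₁ + (- y₁ - y₂) + z₂) + - (x₂ + y₁ + (- z₁ - z₂))) + (x₁ + y₂ + (- z₁ - z₂)) ≈ 3# * y₂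
  fourier₄ = solve 6 (λ x₁ x₂ y₁ y₂ z₁ z₂ →
    (x₂ :+ y₂ :+ z₂) :+ (:- (x₁ :+ (:- y₁ :- y₂) :+ z₂) :+ :- (x₂ :+ y₁ :+ (:- z₁ :- z₂))) :+ (x₁ :+ y₂ :+ (:- z₁ :- z₂)) := con (+ 3) :* y₂) ≈-refl

  fourier₅ : ∀ x₁ x₂ y₁ y₂ z₁ z₂ →
    (1# + x₁ + y₁ + z₁) + (- (x₁ + (- y₁ - y₂) + z₂) + - (x₂ + y₁ + (- z₁ - z₂))) + (x₂ + (- y₁ - y₂) + z₁) + - 1# ≈ 3# * z₁
  fourier₅ = solve 6 (λ x₁ x₂ y₁ y₂ z₁ z₂ →
    (con (+ 1) :+ x₁ :+ y₁ :+ z₁) :+ (:- (x₁ :+ (:- y₁ :- y₂) :+ z₂) :+ :- (x₂ :+ y₁ :+ (:- z₁ :- z₂))) :+ (x₂ :+ (:- y₁ :- y₂) :+ z₁) :+ :- con (+ 1) := con (+ 3) :* z₁) ≈-refl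

  fourier₆ : ∀ x₁ x₂ y₁ y₂ z₁ z₂ →
    (x₂ + y₂ + z₂) + (x₁ + (- y₁ - y₂) + z₂) + (- (x₁ + y₂ + (- z₁ - z₂)) + - (x₂ + (- y₁ - y₂) + z₁)) ≈ 3# * z₂
  fourier₆ = solve 6 (λ x₁ x₂ y₁ y₂ z₁ z₂ →
    (x₂ :+ y₂ :+ z₂) :+ (x₁ :+ (:- y₁ :- y₂) :+ z₂) :+ (:- (x₁ :+ y₂ :+ (:- z₁ :- z₂)) :+ :- (x₂ :+ (:- y₁ :- y₂) :+ z₁)) := con (+ 3) :* z₂) ≈-refl

  -- The opposite composition, again one equation in six coordinates. The summand 3 in the first
  -- coordinate compensates the three offsets that the inverse forms subtract.
  inverse₁ : ∀ a b c d e f →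
    3# + (a + c + e + - 1#) + (a + d + (- e + - f) + - 1#) + (a + (- c + - d) + f + - 1#) ≈ 3# * a
  inverse₁ = solve 6 (λ a b c d e f →
    con (+ 3) :+ (a :+ c :+ e :+ :- con (+ 1)) :+ (a :+ d :+ (:- e :+ :- f) :+ :- con (+ 1)) :+ (a :+ (:- c :+ :- d) :+ f :+ :- con (+ 1)) := con (+ 3) :* a) ≈-refl

  inverse₂ : ∀ a b c d e f →
    (b + d + f) + (b + (- c + - d) + e) + (b + c + (- e + - f)) ≈ 3# * b
  inverse₂ = solve 6 (λ a b c d e f →
    (b :+ d :+ f) :+ (b :+ (:- c :+ :- d) :+ e) :+ (b :+ c :+ (:- e :+ :- f)) := con (+ 3) :* b) ≈-refl

  inverse₃ : ∀ a b c d e f →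
    (a + c + e + - 1#) + (- (a + d + (- e + - f) + - 1#) - (b + (- c + - d) + e)) + (b + c + (- e + - f)) ≈ 3# * c
  inverse₃ = solve 6 (λ a b c d e f →
    (a :+ c :+ e :+ :- con (+ 1)) :+ (:- (a :+ d :+ (:- e :+ :- f) :+ :- con (+ 1)) :- (b :+ (:- c :+ :- d) :+ e)) :+ (b :+ c :+ (:- e :+ :- f)) := con (+ 3) :* c) ≈-refl

  inverse₄ : ∀ a b c d e f →
    (b + d + f) + (a + d + (- e + - f) + - 1#) + (- (a + (- c + - d) + f + - 1#) - (b + c + (- e + - f))) ≈ 3# * d
  inverse₄ = solve 6 (λ a b c d e f →
    (b :+ d :+ f) :+ (a :+ d :+ (:- e :+ :- f) :+ :- con (+ 1)) :+ (:- (a :+ (:- c :+ :- d) :+ f :+ :- con (+ 1)) :- (b :+ c :+ (:- e :+ :- f))) := con (+ 3) :* d) ≈-refl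

  inverse₅ : ∀ a b c d e f →
    (a + c + e + - 1#) + (b + (- c + - d) + e) + (- (a + (- c + - d) + f + - 1#) - (b + c + (- e + - f))) ≈ 3# * e
  inverse₅ = solve 6 (λ a b c d e f →
    (a :+ c :+ e :+ :- con (+ 1)) :+ (b :+ (:- c :+ :- d) :+ e) :+ (:- (a :+ (:- c :+ :- d) :+ f :+ :- con (+ 1)) :- (b :+ c :+ (:- e :+ :- f))) := con (+ 3) :* e) ≈-refl

  inverse₆ : ∀ a b c d e f →
    (b + d + f) + (- (a + d + (- e + - f) + - 1#) - (b + (- c + - d) + e)) + (a + (- c + - d) + f + - 1#) ≈ 3# * f
  inverse₆ = solve 6 (λ a b c d e f →
    (b :+ d :+ f) :+ (:- (a :+ d :+ (:- e :+ :- f) :+ :- con (+ 1)) :- (b :+ (:- c :+ :- d) :+ e)) :+ (a :+ (:- c :+ :- d) :+ f :+ :- con (+ 1)) := con (+ 3) :* f) ≈-refl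

  triple-1+++ : ∀ a b c → 3# * (1# + a + b + c) ≈ 3# + 3# * a + 3# * b + 3# * c
  triple-1+++ = solve 3 (λ a b c → con (+ 3) :* (con (+ 1) :+ a :+ b :+ c) := con (+ 3) :+ con (+ 3) :* a :+ con (+ 3) :* b :+ con (+ 3) :* c) ≈-refl

  triple-++ : ∀ a b c → 3# * (a + b + c) ≈ 3# * a + 3# * b + 3# * c
  triple-++ = solve 3 (λ a b c → con (+ 3) :* (a :+ b :+ c) := con (+ 3) :* a :+ con (+ 3) :* b :+ con (+ 3) :* c) ≈-refl

  triple-+-+ : ∀ a b c d → 3# * (a + (- b - c) + d) ≈ 3# * a + (- (3# * b) - 3# * c) + 3# * d
  triple-+-+ = solve 4 (λ a b c d → con (+ 3) :* (a :+ (:- b :- c) :+ d) := con (+ 3) :* a :+ (:- (con (+ 3) :* b) :- con (+ 3) :* c) :+ con (+ 3) :* d) ≈-refl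

  triple-++- : ∀ a b c d → 3# * (a + b + (- c - d)) ≈ 3# * a + 3# * b + (- (3# * c) - 3# * d)
  triple-++- = solve 4 (λ a b c d → con (+ 3) :* (a :+ b :+ (:- c :- d)) := con (+ 3) :* a :+ con (+ 3) :* b :+ (:- (con (+ 3) :* c) :- con (+ 3) :* d)) ≈-refl

  norm-ω : ∀ m n → form (- m - n) m ≈ form m n
  norm-ω = solve 2 (λ m n → formᵖ (:- m :- n) m := formᵖ m n) ≈-refl

  norm-ω² : ∀ m n → form n (- m - n) ≈ form m n
  norm-ω² = solve 2 (λ m n → formᵖ n (:- m :- n) := formᵖ m n) ≈-refl

  norm-√-3 : ∀ m n → form (m + 2# * n) (- (2# * m) - n) ≈ 3# * form m n
  norm-√-3 = solve 2 (λ m n → formᵖ (m :+ con (+ 2) :* n) (:- (con (+ 2) :* m) :- n) := con (+ 3) :* formᵖ m n) ≈-refl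

  -- Parseval's identity for the Fourier matrix divided by 3: the cross terms cancel since 1 + ω +
  -- ω² = 0.
  norm-fourier : ∀ a b c d e f →
    3# * (form (1# + a + c + e) (b + d + f)
      + (form (a + (- c - d) + f) (b + c + (- e - f))
      + form (a + d + (- e - f)) (b + (- c - d) + e))) ≈
    form (1# + 3# * a) (3# * b) + (form (1# + 3# * c) (3# * d) + form (1# + 3# * e) (3# * f))
  norm-fourier = solve 6 (λ a b c d e f →
    con (+ 3) :* (formᵖ (con (+ 1) :+ a :+ c :+ e) (b :+ d :+ f)
      :+ (formᵖ (a :+ (:- c :- d) :+ f) (b :+ c :+ (:- e :- f))
      :+ formᵖ (a :+ d :+ (:- e :- f)) (b :+ (:- c :- d) :+ e))) :=
    formᵖ (con (+ 1) :+ con (+ 3) :* a) (con (+ 3) :* b) :+ (formᵖ (con (+ 1) :+ con (+ 3) :* c) (con (+ 3) :* d) :+ formᵖ (con (+ 1) :+ con (+ 3) :* e) (con (+ 3) :* f))) ≈-refl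

  middle : ∀ a b c → b + (a + c) ≈ (a + b) + c
  middle = solve 3 (λ a b c → b :+ (a :+ c) := (a :+ b) :+ c) ≈-refl

  norm-neg : ∀ m n → form (- m) (- n) ≈ form m n
  norm-neg = solve 2 (λ m n → formᵖ (:- m) (:- n) := formᵖ m n) ≈-refl

  *-regroup₆ : ∀ a x b y c z → (a * x) * ((b * y) * (c * z)) ≈ (a * (b * c)) * (x * (y * z))
  *-regroup₆ = solve 6 (λ a x b y c z →
    (a :* x) :* ((b :* y) :* (c :* z)) := (a :* (b :* c)) :* (x :* (y :* z))) ≈-refl

  factor₃ : ∀ a b c z → (a * z + b * z) + c * z ≈ ((a + b) + c) * z
  factor₃ = solve 4 (λ a b c z → (a :* z :+ b :* z) :+ c :* z := ((a :+ b) :+ c) :* z) ≈-refl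

  reassociate : ∀ k i a z → (k * (i * a)) * z ≈ k * (i * (a * z))
  reassociate = solve 4 (λ k i a z → (k :* (i :* a)) :* z := k :* (i :* (a :* z))) ≈-refl

  mod-3 : ∀ m n → m + 2# * n ≈ (m - n) + 3# * n
  mod-3 = solve 2 (λ m n → m :+ con (+ 2) :* n := (m :- n) :+ con (+ 3) :* n) ≈-refl

  root-sum : ∀ w a g → ((1# * a + w * g) + (w * w) * g) + g ≈ a + ((1# + w) + w * w) * g
  root-sum = solve 3 (λ w a g → ((con (+ 1) :* a :+ w :* g) :+ (w :* w) :* g) :+ g :=
    a :+ ((con (+ 1) :+ w) :+ w :* w) :* g) ≈-refl

  permute-201 : ∀ x y z → (z + x) + y ≈ (x + y) + z
  permute-201 = solve 3 (λ x y z → (z :+ x) :+ y := (x :+ y) :+ z) ≈-refl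

  permute-102 : ∀ x y z → (y + x) + z ≈ (x + y) + z
  permute-102 = solve 3 (λ x y z → (y :+ x) :+ z := (x :+ y) :+ z) ≈-refl

  permute-210 : ∀ x y z → (z + y) + x ≈ (x + y) + z
  permute-210 = solve 3 (λ x y z → (z :+ y) :+ x := (x :+ y) :+ z) ≈-refl

  permute-120 : ∀ x y z → (y + z) + x ≈ (x + y) + z
  permute-120 = solve 3 (λ x y z → (y :+ z) :+ x := (x :+ y) :+ z) ≈-refl

  permute-021 : ∀ x y z → (x + z) + y ≈ (x + y) + z
  permute-021 = solve 3 (λ x y z → (x :+ z) :+ y := (x :+ y) :+ z) ≈-refl

  -- With A = a - g and C = a + 2 g this is C³ - A³ = 9 g (a² + a g + g²).
  cubic-identity : ∀ A B C a g → A + g ≈ a → C ≈ (a + g) + g →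
    (B * (B * B) + B * (B * B)) + B * (B * B) ≈ (g * (a * a) + g * (g * g)) + a * (g * g) →
    A * (A * (A * 1#)) + (3# * B) * ((3# * B) * ((3# * B) * 1#)) ≈
    C * (C * (C * 1#))
  cubic-identity A B C a g A+g≈a C≈ key = ≈-trans
    (solve 2 (λ A B → A :* (A :* (A :* con (+ 1))) :+ (con (+ 3) :* B) :* ((con (+ 3) :* B) :* ((con (+ 3) :* B) :* con (+ 1))) :=
      A :* (A :* A) :+ con (+ 9) :* ((B :* (B :* B) :+ B :* (B :* B)) :+ B :* (B :* B))) ≈-refl A B)
    (≈-trans (+-congˡ (*-congˡ (≈-trans key (≈-sym (+-cong (+-congʳ (*-congˡ (*-cong A+g≈a A+g≈a))) (*-congʳ A+g≈a))))))
      (≈-trans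
        (solve 2 (λ A g → A :* (A :* A) :+ con (+ 9) :* ((g :* ((A :+ g) :* (A :+ g)) :+ g :* (g :* g)) :+ (A :+ g) :* (g :* g)) :=
          ((A :+ g) :+ g :+ g) :* (((A :+ g) :+ g :+ g) :* (((A :+ g) :+ g :+ g) :* con (+ 1)))) ≈-refl A g)
        (*-cong C′ (*-cong C′ (*-congʳ C′)))))
    where
    C′ : (A + g) + g + g ≈ C
    C′ = ≈-trans (+-congʳ (+-congʳ A+g≈a)) (≈-sym C≈)

  open SemiringExp semiring using (_^_; ^-congˡ; ^-homo-*; ^-assocʳ)

  cube-root-powers : ∀ {q r} → r ^ 3 ≈ q → ∀ a b c {a′ b′ c′} → 3 ℕ.* (a ℕ.+ (b ℕ.+ c)) ≡ a′ ℕ.+ (b′ ℕ.+ c′) →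
    q ^ a * (q ^ b * q ^ c) ≈ r ^ a′ * (r ^ b′ * r ^ c′)
  cube-root-powers {q} {r} r³≈q a b c {a′} {b′} {c′} eq = begin
    q ^ a * (q ^ b * q ^ c)          ≈⟨ ≈-trans (^-homo-* q a (b ℕ.+ c)) (*-congˡ (^-homo-* q b c)) ⟨
    q ^ (a ℕ.+ (b ℕ.+ c))            ≈⟨ ^-congˡ (a ℕ.+ (b ℕ.+ c)) r³≈q ⟨
    (r ^ 3) ^ (a ℕ.+ (b ℕ.+ c))      ≈⟨ ^-assocʳ r 3 (a ℕ.+ (b ℕ.+ c)) ⟩
    r ^ (3 ℕ.* (a ℕ.+ (b ℕ.+ c)))    ≡⟨ cong (λ n → r ^ n) eq ⟩
    r ^ (a′ ℕ.+ (b′ ℕ.+ c′))         ≈⟨ ≈-trans (^-homo-* r a′ (b′ ℕ.+ c′)) (*-congˡ (^-homo-* r b′ c′)) ⟩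
    r ^ a′ * (r ^ b′ * r ^ c′)       ∎
    where open SetoidReasoning setoid

  scale-norm : ∀ k x y → k * (k * ((x * x + x * y) + y * y)) ≈ ((k * x) * (k * x) + (k * x) * (k * y)) + (k * y) * (k * y)
  scale-norm = solve 3 (λ k x y → k :* (k :* ((x :* x :+ x :* y) :+ y :* y)) :=
    ((k :* x) :* (k :* x) :+ (k :* x) :* (k :* y)) :+ (k :* y) :* (k :* y)) ≈-refl

  scale-shear : ∀ k x y → k * (k * ((k * (x * x) + k * (x * y)) + y * y)) ≈
    k * (((k * x) * (k * x) + k * ((k * x) * y)) + k * (y * y))
  scale-shear = solve 3 (λ k x y → k :* (k :* ((k :* (x :* x) :+ k :* (x :* y)) :+ y :* y)) :=
    k :* (((k :* x) :* (k :* x) :+ k :* ((k :* x) :* y)) :+ k :* (y :* y))) ≈-refl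

  norm-shear : ∀ m n →
    (1# + 3# * m) * (1# + 3# * m) + 3# * ((1# + 3# * m) * n) + 3# * (n * n) ≈ form (3# * m + 1# + n) n
  norm-shear = solve 2 (λ m n →
    (con (+ 1) :+ con (+ 3) :* m) :* (con (+ 1) :+ con (+ 3) :* m) :+ con (+ 3) :* ((con (+ 1) :+ con (+ 3) :* m) :* n)
      :+ con (+ 3) :* (n :* n) :=
    formᵖ (con (+ 3) :* m :+ con (+ 1) :+ n) n) ≈-refl

  norm-unshear : ∀ m n → 3# * (m * m) + 3# * (m * n) + n * n ≈ form m (m + n)
  norm-unshear = solve 2 (λ m n → con (+ 3) :* (m :* m) :+ con (+ 3) :* (m :* n) :+ n :* n := formᵖ m (m :+ n)) ≈-refl

  +-difference′ : ∀ a b → a + (b - a) ≈ b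
  +-difference′ = solve 2 (λ a b → a :+ (b :- a) := b) ≈-refl

  +-difference″ : ∀ a b → (a + b) - a ≈ b
  +-difference″ = solve 2 (λ a b → (a :+ b) :- a := b) ≈-refl

  mod-3′ : ∀ m n → m - n ≈ (- m - (m + n)) + 3# * m
  mod-3′ = solve 2 (λ m n → m :- n := (:- m :- (m :+ n)) :+ con (+ 3) :* m) ≈-refl

  triple : ∀ a → (a + a) + a ≈ 3# * a
  triple = solve 1 (λ a → (a :+ a) :+ a := con (+ 3) :* a) ≈-refl

  double : ∀ a → a + a ≈ 2# * a
  double = solve 1 (λ a → a :+ a := con (+ 2) :* a) ≈-refl

  neg-sq : ∀ a → - a * - a ≈ a * a
  neg-sq = solve 1 (λ a → :- a :* :- a := a :* a) ≈-refl

  difference-trans : ∀ a b c → (a - b) + (b - c) ≈ a - c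
  difference-trans = solve 3 (λ a b c → (a :- b) :+ (b :- c) := a :- c) ≈-refl

  difference-+ : ∀ a b → (a - b) + b ≈ a
  difference-+ = solve 2 (λ a b → (a :- b) :+ b := a) ≈-refl

  +-difference : ∀ a b c d → (a - c) + (b - d) ≈ (a + b) - (c + d)
  +-difference = solve 4 (λ a b c d → (a :- c) :+ (b :- d) := (a :+ b) :- (c :+ d)) ≈-refl

  *-difference : ∀ a a′ b b′ → a * (b - b′) + b′ * (a - a′) ≈ a * b - a′ * b′
  *-difference = solve 4 (λ a a′ b b′ → a :* (b :- b′) :+ b′ :* (a :- a′) := a :* b :- a′ :* b′) ≈-refl

  neg-difference : ∀ a b → - (a - b) ≈ b - a
  neg-difference = solve 2 (λ a b → :- (a :- b) := b :- a) ≈-refl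

  neg-neg-difference : ∀ a b → - (a - b) ≈ (- a) - (- b)
  neg-neg-difference = solve 2 (λ a b → :- (a :- b) := (:- a) :- (:- b)) ≈-refl

  *-gap : ∀ a b → a * b + b * (b - a) ≈ b * b
  *-gap = solve 2 (λ a b → a :* b :+ b :* (b :- a) := b :* b) ≈-refl

-- Rational arithmetic made opaque: unification would otherwise compare rational
-- terms by unfolding them to numerators and denominators.
module Q where
  open import Data.Rational.Base public using (_≤_; _<_)
  open import Data.Rational.Properties public
    using (_<?_; ≤-refl; ≤-trans; ≤-reflexive; ≤-total; <⇒≤; <-irrefl;
           ≤-<-trans; <-≤-trans; ≮⇒≥; module ≤-Reasoning)

  infixl 6 _+_ _-_
  infixl 7 _*_
  infix  8 -_

  opaque
    _+_ _*_ : ℚ → ℚ → ℚ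
    _+_ = ℚ._+_
    _*_ = ℚ._*_

    -_ ∣_∣ : ℚ → ℚ
    -_  = ℚ.-_
    ∣_∣ = ℚ.∣_∣

  _-_ : ℚ → ℚ → ℚ
  p - q = p + (- q)

  opaque
    unfolding _+_

    isCommutativeRing : IsCommutativeRing _≡_ _+_ _*_ -_ 0ℚ 1ℚ
    isCommutativeRing = ℚ.+-*-isCommutativeRing

    +-mono-≤ : ∀ {p q r s} → p ≤ q → r ≤ s → p + r ≤ q + s
    +-mono-≤ = ℚ.+-mono-≤

    +-mono-<-≤ : ∀ {p q r s} → p < q → r ≤ s → p + r < q + s
    +-mono-<-≤ = ℚ.+-mono-<-≤

    *-monoˡ : ∀ {r p q} → 0ℚ ≤ r → p ≤ q → r * p ≤ r * q
    *-monoˡ {r} 0≤r = ℚ.*-monoˡ-≤-nonNeg r {{ℚ.nonNegative 0≤r}}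

    *-pos : ∀ {p q} → 0ℚ < p → 0ℚ < q → 0ℚ < p * q
    *-pos {p} {q} 0<p 0<q =
      subst (ℚ._< p ℚ.* q) (ℚ.*-zeroʳ p) (ℚ.*-monoʳ-<-pos p {{ℚ.positive 0<p}} 0<q)

    0≤∣p∣ : ∀ p → 0ℚ ≤ ∣ p ∣
    0≤∣p∣ = ℚ.0≤∣p∣

    0≤p⇒∣p∣≡p : ∀ {p} → 0ℚ ≤ p → ∣ p ∣ ≡ p
    0≤p⇒∣p∣≡p = ℚ.0≤p⇒∣p∣≡p

    ∣-p∣≡∣p∣ : ∀ p → ∣ - p ∣ ≡ ∣ p ∣
    ∣-p∣≡∣p∣ = ℚ.∣-p∣≡∣p∣

    ∣p∣≡p∨∣p∣≡-p : ∀ p → (∣ p ∣ ≡ p) ⊎ (∣ p ∣ ≡ - p)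
    ∣p∣≡p∨∣p∣≡-p = ℚ.∣p∣≡p∨∣p∣≡-p

    ∣p+q∣≤∣p∣+∣q∣ : ∀ p q → ∣ p + q ∣ ≤ ∣ p ∣ + ∣ q ∣
    ∣p+q∣≤∣p∣+∣q∣ = ℚ.∣p+q∣≤∣p∣+∣q∣

    ∣p*q∣≡∣p∣*∣q∣ : ∀ p q → ∣ p * q ∣ ≡ ∣ p ∣ * ∣ q ∣
    ∣p*q∣≡∣p∣*∣q∣ = ℚ.∣p*q∣≡∣p∣*∣q∣

    inverse : ∀ {p} → 0ℚ < p → ∃[ r ] (0ℚ < r) × (p * r ≡ 1ℚ)
    inverse {p} 0<p = ℚ.1/ p , ℚ.positive⁻¹ (ℚ.1/ p) {{ℚ.1/pos⇒pos p}} , ℚ.*-inverseʳ p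
      where
      instance
        p-pos : ℚ.Positive p
        p-pos = ℚ.positive 0<p
        p-nonZero : ℚ.NonZero p
        p-nonZero = ℚ.pos⇒nonZero p

    ½+½≡1 : ½ + ½ ≡ 1ℚ
    ½+½≡1 = refl

    coprime-1 : ∀ n → Coprime n 1
    coprime-1 n = Coprimality.sym (1-coprimeTo n)

    nat : ℕ → ℚ
    nat n = + n ℚ./ 1

    nat-0 : nat 0 ≡ 0ℚ
    nat-0 = refl

    nat-suc : ∀ n → nat (suc n) ≡ 1ℚ + nat n
    nat-suc n = begin
      + suc n ℚ./ 1                      ≡⟨ cong (λ k → + suc k ℚ./ 1) (ℕ.*-identityʳ n) ⟨
      + suc (n ℕ.* 1) ℚ./ 1              ≡⟨ cong (ℚ._/ 1) (cong (λ i → + 1 ℤ.+ i) (ℤ.pos-* n 1)) ⟩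
      (+ 1 ℤ.* + 1 ℤ.+ + n ℤ.* + 1) ℚ./ 1 ≡⟨⟩
      1ℚ ℚ.+ mkℚ (+ n) 0 (coprime-1 n)   ≡⟨ cong (1ℚ ℚ.+_) (ℚ.↥p/↧p≡p (mkℚ (+ n) 0 (coprime-1 n))) ⟨
      1ℚ ℚ.+ nat n                       ∎
      where
      open ≡.≡-Reasoning

  0<1 : 0ℚ < 1ℚ
  0<1 = ℚ.positive⁻¹ 1ℚ

  0<½ : 0ℚ < ½
  0<½ = ℚ.positive⁻¹ ½

  +-*-commutativeRing : CommutativeRing 0ℓ 0ℓ
  +-*-commutativeRing = record { isCommutativeRing = isCommutativeRing }

  open CommutativeRing +-*-commutativeRing public
    using (+-assoc; +-comm; +-identityˡ; +-identityʳ; *-assoc; *-comm; *-identityˡ; *-identityʳ;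
           zeroˡ; zeroʳ; semiring; commutativeSemiring)
    renaming (-‿inverseʳ to +-inverseʳ; distribˡ to *-distribˡ-+; distribʳ to *-distribʳ-+)

  +-monoˡ-≤ : ∀ {p q} r → p ≤ q → p + r ≤ q + r
  +-monoˡ-≤ r p≤q = +-mono-≤ p≤q (≤-refl {r})

  +-monoʳ-≤ : ∀ {p q} r → p ≤ q → r + p ≤ r + q
  +-monoʳ-≤ r p≤q = +-mono-≤ (≤-refl {r}) p≤q

module ℚ-id = Identities Q.+-*-commutativeRing
module ℤ-id = Identities ℤ.+-*-commutativeRing

-- Rational inequalities

+-nonneg : ∀ {p q} → 0ℚ Q.≤ p → 0ℚ Q.≤ q → 0ℚ Q.≤ p Q.+ q
+-nonneg {p} {q} 0≤p 0≤q = subst (Q._≤ p Q.+ q) (Q.+-identityˡ 0ℚ) (Q.+-mono-≤ 0≤p 0≤q)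

+-pos : ∀ {p q} → 0ℚ Q.< p → 0ℚ Q.≤ q → 0ℚ Q.< p Q.+ q
+-pos {p} {q} 0<p 0≤q = subst (Q._< p Q.+ q) (Q.+-identityˡ 0ℚ) (Q.+-mono-<-≤ 0<p 0≤q)

*-monoʳ : ∀ {r p q} → 0ℚ Q.≤ r → p Q.≤ q → p Q.* r Q.≤ q Q.* r
*-monoʳ {r} {p} {q} 0≤r p≤q = subst₂ Q._≤_ (Q.*-comm r p) (Q.*-comm r q) (Q.*-monoˡ 0≤r p≤q)

*-mono : ∀ {p q r s} → 0ℚ Q.≤ p → 0ℚ Q.≤ s → p Q.≤ q → r Q.≤ s → p Q.* r Q.≤ q Q.* s
*-mono {p} {q} {r} {s} 0≤p 0≤s p≤q r≤s =
  Q.≤-trans (Q.*-monoˡ 0≤p r≤s) (*-monoʳ 0≤s p≤q)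

*-nonneg : ∀ {p q} → 0ℚ Q.≤ p → 0ℚ Q.≤ q → 0ℚ Q.≤ p Q.* q
*-nonneg {p} {q} 0≤p 0≤q = subst (Q._≤ p Q.* q) (Q.zeroʳ p) (Q.*-monoˡ 0≤p 0≤q)

≤-gap : ∀ {p q} d → 0ℚ Q.≤ d → p Q.+ d ≡ q → p Q.≤ q
≤-gap {p} d 0≤d eq = subst₂ Q._≤_ (Q.+-identityʳ p) eq (Q.+-monoʳ-≤ p 0≤d)

0≤-diff : ∀ {p q} → p Q.≤ q → 0ℚ Q.≤ q Q.- p
0≤-diff {p} {q} p≤q = subst (Q._≤ q Q.- p) (Q.+-inverseʳ p) (Q.+-monoˡ-≤ (Q.- p) p≤q)

<-gap : ∀ {p q d} → 0ℚ Q.< d → p Q.+ d ≡ q → p Q.< q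
<-gap {p} {q} {d} 0<d eq = subst₂ Q._<_ (Q.+-identityˡ p) (trans (Q.+-comm d p) eq)
  (Q.+-mono-<-≤ 0<d (Q.≤-refl {p}))

0<-diff : ∀ {p q} → p Q.< q → 0ℚ Q.< q Q.- p
0<-diff {p} {q} p<q = subst (Q._< q Q.- p) (Q.+-inverseʳ p) (Q.+-mono-<-≤ p<q (Q.≤-refl {Q.- p}))

0≤sq : ∀ p → 0ℚ Q.≤ p Q.* p
0≤sq p = subst (0ℚ Q.≤_) (lemma p) (*-nonneg (Q.0≤∣p∣ p) (Q.0≤∣p∣ p))
  where
  lemma : ∀ p → Q.∣ p ∣ Q.* Q.∣ p ∣ ≡ p Q.* p
  lemma p with Q.∣p∣≡p∨∣p∣≡-p p
  ... | inj₁ eq rewrite eq = refl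
  ... | inj₂ eq rewrite eq = ℚ-id.neg-sq p

∣∣-sq : ∀ p → Q.∣ p ∣ Q.* Q.∣ p ∣ ≡ p Q.* p
∣∣-sq p = trans (sym (Q.∣p*q∣≡∣p∣*∣q∣ p p)) (Q.0≤p⇒∣p∣≡p (0≤sq p))

sq-cancel-≤ : ∀ {p q} → 0ℚ Q.≤ p → 0ℚ Q.≤ q → p Q.* p Q.≤ q Q.* q → p Q.≤ q
sq-cancel-≤ {p} {q} 0≤p 0≤q p²≤q² with q Q.<? p
... | no  q≮p = Q.≮⇒≥ q≮p
... | yes q<p = ⊥-elim (Q.<-irrefl refl (Q.<-≤-trans q²<p² p²≤q²))
  where
  q²<p² : q Q.* q Q.< p Q.* p
  q²<p² = Q.≤-<-trans (Q.*-monoˡ 0≤q (Q.<⇒≤ q<p)) (<-gap (Q.*-pos (Q.≤-<-trans 0≤q q<p) (0<-diff q<p)) lemma)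
    where
    lemma : q Q.* p Q.+ p Q.* (p Q.- q) ≡ p Q.* p
    lemma = ℚ-id.*-gap q p

p≤∣p∣ : ∀ p → p Q.≤ Q.∣ p ∣
p≤∣p∣ p with Q.≤-total 0ℚ p
... | inj₁ 0≤p = Q.≤-reflexive (sym (Q.0≤p⇒∣p∣≡p 0≤p))
... | inj₂ p≤0 = Q.≤-trans p≤0 (Q.0≤∣p∣ p)

0<1+∣_∣ : ∀ c → 0ℚ Q.< 1ℚ Q.+ Q.∣ c ∣
0<1+∣ c ∣ = +-pos Q.0<1 (Q.0≤∣p∣ c)

*-cancelˡ-≤ : ∀ {r p q} → 0ℚ Q.< r → r Q.* p Q.≤ r Q.* q → p Q.≤ q
*-cancelˡ-≤ {r} {p} {q} 0<r rp≤rq = go (Q.inverse 0<r)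
  where
  undo : ∀ {s} → r Q.* s ≡ 1ℚ → ∀ p → s Q.* (r Q.* p) ≡ p
  undo {s} rs≡1 p = trans (sym (Q.*-assoc s r p))
    (trans (cong (Q._* p) (trans (Q.*-comm s r) rs≡1)) (Q.*-identityˡ p))
  go : ∃[ s ] (0ℚ Q.< s) × (r Q.* s ≡ 1ℚ) → p Q.≤ q
  go (s , 0<s , rs≡1) = subst₂ Q._≤_ (undo rs≡1 p) (undo rs≡1 q) (Q.*-monoˡ (Q.<⇒≤ 0<s) rp≤rq)

+-cancelʳ-≤ : ∀ {p q r} → p Q.+ r Q.≤ q Q.+ r → p Q.≤ q
+-cancelʳ-≤ {p} {q} {r} h = subst₂ Q._≤_ (ℚ-id.+-difference-cancel p r) (ℚ-id.+-difference-cancel q r)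
  (Q.+-monoˡ-≤ (Q.- r) h)

∣-∣≤⇒≤ : ∀ {p q r} → Q.∣ p Q.- q ∣ Q.≤ r → p Q.≤ q Q.+ r
∣-∣≤⇒≤ {p} {q} {r} h = Q.≤-trans
  (Q.≤-reflexive (trans (sym (ℚ-id.difference-+ p q)) (Q.+-comm (p Q.- q) q)))
  (Q.+-monoʳ-≤ q (Q.≤-trans (p≤∣p∣ (p Q.- q)) h))

-- The witness is ε / (1 + |c|), so that `c` may also be zero or negative.
shrink : ∀ c {ε} → 0ℚ Q.< ε → ∃[ δ ] (0ℚ Q.< δ) × (c Q.* δ Q.≤ ε)
shrink c {ε} 0<ε with r , 0<r , Br≡1 ← Q.inverse 0<1+∣ c ∣ = r Q.* ε , Q.*-pos 0<r 0<ε , (begin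
    c Q.* (r Q.* ε)                     ≤⟨ *-monoʳ (Q.<⇒≤ (Q.*-pos 0<r 0<ε))
                                             (Q.≤-trans (p≤∣p∣ c) (≤-gap 1ℚ (Q.<⇒≤ Q.0<1) (Q.+-comm Q.∣ c ∣ 1ℚ))) ⟩
    (1ℚ Q.+ Q.∣ c ∣) Q.* (r Q.* ε)      ≡⟨ Q.*-assoc (1ℚ Q.+ Q.∣ c ∣) r ε ⟨
    (1ℚ Q.+ Q.∣ c ∣) Q.* r Q.* ε        ≡⟨ cong (Q._* ε) Br≡1 ⟩
    1ℚ Q.* ε                            ≡⟨ Q.*-identityˡ ε ⟩
    ε                                   ∎)
  where open Q.≤-Reasoning

recip : ℕ → ℚ
recip k = mkℚ (+ 1) k (1-coprimeTo (suc k))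

recip-pos : ∀ k → 0ℚ Q.< recip k
recip-pos k = ℚ.positive⁻¹ (recip k)

recip-antitone : ∀ {j k} → j ℕ.≤ k → recip k Q.≤ recip j
recip-antitone j≤k = *≤* (ℤ.*-monoˡ-≤-nonNeg (+ 1) (ℤ.+≤+ (s≤s j≤k)))

archimedean : ∀ {ε} → 0ℚ Q.< ε → ∃[ k ] recip k Q.≤ ε
archimedean {mkℚ (+ zero)  k _} (ℚ.*<* (ℤ.+<+ ()))
-- Here `ε` is (n + 1) / (k + 1), so its own denominator serves.
archimedean {mkℚ (+ suc n) k _} 0<ε =
  k , *≤* (ℤ.*-monoʳ-≤-nonNeg (+ suc k) (ℤ.+≤+ {1} {suc n} (s≤s z≤n)))
archimedean {mkℚ -[1+ n ]  k _} (ℚ.*<* ())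

nat-nonneg : ∀ n → 0ℚ Q.≤ Q.nat n
nat-nonneg zero    = Q.≤-reflexive (sym Q.nat-0)
nat-nonneg (suc n) = subst (0ℚ Q.≤_) (sym (Q.nat-suc n)) (+-nonneg (Q.<⇒≤ Q.0<1) (nat-nonneg n))

opaque
  unfolding Q._+_ Q.nat

  nat*recip : ∀ k → Q.nat (suc k) Q.* recip k ≡ 1ℚ
  nat*recip k = trans (cong (ℚ._* recip k) (ℚ.↥p/↧p≡p (mkℚ (+ suc k) 0 (Q.coprime-1 (suc k))))) (ℚ.*-inverseˡ (recip k))

∣∣-triangle : ∀ a b c d → Q.∣ a Q.- d ∣ Q.≤ (Q.∣ b Q.- a ∣ Q.+ Q.∣ b Q.- c ∣) Q.+ Q.∣ c Q.- d ∣
∣∣-triangle a b c d = begin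
  Q.∣ a Q.- d ∣
    ≡⟨ cong Q.∣_∣ (ℚ-id.path a b c d) ⟨
  Q.∣ (Q.- (b Q.- a) Q.+ (b Q.- c)) Q.+ (c Q.- d) ∣
    ≤⟨ Q.∣p+q∣≤∣p∣+∣q∣ (Q.- (b Q.- a) Q.+ (b Q.- c)) (c Q.- d) ⟩
  Q.∣ Q.- (b Q.- a) Q.+ (b Q.- c) ∣ Q.+ Q.∣ c Q.- d ∣
    ≤⟨ Q.+-monoˡ-≤ Q.∣ c Q.- d ∣ (Q.∣p+q∣≤∣p∣+∣q∣ (Q.- (b Q.- a)) (b Q.- c)) ⟩
  (Q.∣ Q.- (b Q.- a) ∣ Q.+ Q.∣ b Q.- c ∣) Q.+ Q.∣ c Q.- d ∣
    ≡⟨ cong (λ p → (p Q.+ Q.∣ b Q.- c ∣) Q.+ Q.∣ c Q.- d ∣) (Q.∣-p∣≡∣p∣ (b Q.- a)) ⟩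
  (Q.∣ b Q.- a ∣ Q.+ Q.∣ b Q.- c ∣) Q.+ Q.∣ c Q.- d ∣ ∎
  where open Q.≤-Reasoning

-- Sums over lists

module ListSum {c ℓ} (R : CommutativeRing c ℓ) where
  open CommutativeRing R renaming (refl to ≈-refl; sym to ≈-sym; trans to ≈-trans)
  open import Relation.Binary.Reasoning.Setoid setoid

  Sum : {I : Set} → (I → Carrier) → List I → Carrier
  Sum f F = foldr _+_ 0# (map f F)

  Sum-cong : {I : Set} {f g : I → Carrier} → (∀ i → f i ≈ g i) → ∀ F → Sum f F ≈ Sum g F
  Sum-cong f≈g []      = ≈-refl
  Sum-cong f≈g (i ∷ F) = +-cong (f≈g i) (Sum-cong f≈g F)

  Sum-++ : {I : Set} (f : I → Carrier) → ∀ F G → Sum f (F ++ G) ≈ Sum f F + Sum f G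
  Sum-++ f []      G = ≈-sym (+-identityˡ _)
  Sum-++ f (i ∷ F) G = ≈-trans (+-congˡ (Sum-++ f F G)) (≈-sym (+-assoc _ _ _))

  Sum-map : {I J : Set} (f : I → Carrier) (g : J → I) → ∀ F → Sum f (map g F) ≡ Sum (f ∘ g) F
  Sum-map f g []      = refl
  Sum-map f g (i ∷ F) = cong (λ s → f (g i) + s) (Sum-map f g F)

  Sum-+ : {I : Set} (f g : I → Carrier) → ∀ F → Sum (λ i → f i + g i) F ≈ Sum f F + Sum g F
  Sum-+ f g []      = ≈-sym (+-identityˡ _)
  Sum-+ f g (i ∷ F) = ≈-trans (+-congˡ (Sum-+ f g F)) (Identities.interchange R _ _ _ _)

  Sum-*ˡ : {I : Set} (c : Carrier) (f : I → Carrier) → ∀ F → c * Sum f F ≈ Sum (λ i → c * f i) F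
  Sum-*ˡ c f []      = zeroʳ c
  Sum-*ˡ c f (i ∷ F) = ≈-trans (distribˡ c _ _) (+-congˡ (Sum-*ˡ c f F))

  Sum-product : {I J : Set} (f : I → Carrier) (g : J → Carrier) → ∀ F G →
    Sum f F * Sum g G ≈ Sum (λ (i , j) → f i * g j) (cartesianProduct F G)
  Sum-product f g []      G = zeroˡ _
  Sum-product f g (i ∷ F) G = begin
    (f i + Sum f F) * Sum g G                    ≈⟨ distribʳ _ _ _ ⟩
    f i * Sum g G + Sum f F * Sum g G            ≈⟨ +-cong (Sum-*ˡ (f i) g G) (Sum-product f g F G) ⟩
    Sum (λ j → f i * g j) G + Sum f⊗g (cartesianProduct F G)
      ≡⟨ cong (λ s → s + Sum f⊗g (cartesianProduct F G)) (Sum-map f⊗g (i ,_) G) ⟨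
    Sum f⊗g (map (i ,_) G) + Sum f⊗g (cartesianProduct F G)
      ≈⟨ Sum-++ f⊗g (map (i ,_) G) _ ⟨
    Sum f⊗g (cartesianProduct (i ∷ F) G)         ∎
    where f⊗g = λ (i , j) → f i * g j

  Sum-↭ : {I : Set} (f : I → Carrier) → ∀ {F G} → F ↭ G → Sum f F ≈ Sum f G
  Sum-↭ f Perm.refl         = ≈-refl
  Sum-↭ f (Perm.prep i p)   = +-congˡ (Sum-↭ f p)
  Sum-↭ f (Perm.swap i j p) = ≈-trans (≈-sym (+-assoc _ _ _))
    (≈-trans (+-cong (+-comm _ _) (Sum-↭ f p)) (+-assoc _ _ _))
  Sum-↭ f (Perm.trans p q)  = ≈-trans (Sum-↭ f p) (Sum-↭ f q)

  Sum-filter : {I : Set} {P : I → Set} (P? : ∀ i → Dec (P i)) (f : I → Carrier) →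
    (∀ i → ¬ P i → f i ≈ 0#) → ∀ F → Sum f (filter P? F) ≈ Sum f F
  Sum-filter P? f ¬P⇒0 []      = ≈-refl
  Sum-filter P? f ¬P⇒0 (i ∷ F) with P? i
  ... | yes Pi = +-congˡ (Sum-filter P? f ¬P⇒0 F)
  ... | no ¬Pi = ≈-trans (Sum-filter P? f ¬P⇒0 F)
    (≈-sym (≈-trans (+-congʳ (¬P⇒0 i ¬Pi)) (+-identityˡ _)))

-- Finite subsets as lists without repetition

unique-↭ : {I : Set} {F G : List I} → Unique F → Unique G → F ⊆ G → G ⊆ F → F ↭ G
unique-↭ uF uG F⊆G G⊆F = ∼bag⇒↭ (unique∧set⇒bag uF uG (mk⇔ F⊆G G⊆F))

module Finite {I : Set} (_≟_ : DecidableEquality I) where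
  open DecMembership _≟_ using (_∈?_)

  nub : List I → List I
  nub = deduplicate _≟_

  nub-unique : ∀ F → Unique (nub F)
  nub-unique = DecUnique.deduplicate-! _≟_

  nub⁺ : ∀ {F} → F ⊆ nub F
  nub⁺ = ∈-deduplicate⁺ _≟_

  nub⁻ : ∀ F → nub F ⊆ F
  nub⁻ = ∈-deduplicate⁻ _≟_

  infixl 6 _∖_
  _∖_ : List I → List I → List I
  F ∖ G = filter (λ i → ¬? (i ∈? G)) F

  ∖-unique : ∀ {F} G → Unique F → Unique (F ∖ G)
  ∖-unique G = Unique.filter⁺ (λ i → ¬? (i ∈? G))

  ∖⁻ : ∀ F G {i} → i ∈ F ∖ G → i ∈ F × i ∉ G
  ∖⁻ F G = ∈-filter⁻ (λ i → ¬? (i ∈? G)) {xs = F}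

  ∖⁺ : ∀ F G {i} → i ∈ F → (i ∈ G) ⊎ (i ∈ F ∖ G)
  ∖⁺ F G {i} i∈F with i ∈? G
  ... | yes i∈G = inj₁ i∈G
  ... | no  i∉G = inj₂ (∈-filter⁺ (λ i → ¬? (i ∈? G)) i∈F i∉G)

  ∖-↭ : ∀ {F G} → Unique F → Unique G → G ⊆ F → F ↭ G ++ (F ∖ G)
  ∖-↭ {F} {G} uF uG G⊆F = unique-↭ uF
    (Unique.++⁺ uG (∖-unique G uF) λ (∈G , ∈F∖G) → proj₂ (∖⁻ F G ∈F∖G) ∈G)
    to from
    where
    to : F ⊆ G ++ (F ∖ G)
    to i∈F = [ ∈-++⁺ˡ , ∈-++⁺ʳ G ]′ (∖⁺ F G i∈F)
    from : G ++ (F ∖ G) ⊆ F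
    from i∈ with ∈-++⁻ G i∈
    ... | inj₁ i∈G = G⊆F i∈G
    ... | inj₂ i∈F∖G = proj₁ (∖⁻ F G i∈F∖G)

-- Finite sums of nonnegative rationals

module ℚSum = ListSum Q.+-*-commutativeRing

sumℚ : {I : Set} → (I → ℚ) → List I → ℚ
sumℚ = ℚSum.Sum

sumℚ-nonneg : {I : Set} {w : I → ℚ} → (∀ i → 0ℚ Q.≤ w i) → ∀ F → 0ℚ Q.≤ sumℚ w F
sumℚ-nonneg 0≤w []      = Q.≤-refl
sumℚ-nonneg 0≤w (i ∷ F) = +-nonneg (0≤w i) (sumℚ-nonneg 0≤w F)

sumℚ-mono : {I : Set} {v w : I → ℚ} → (∀ i → v i Q.≤ w i) → ∀ F → sumℚ v F Q.≤ sumℚ w F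
sumℚ-mono v≤w []      = Q.≤-refl
sumℚ-mono v≤w (i ∷ F) = Q.+-mono-≤ (v≤w i) (sumℚ-mono v≤w F)

sumℚ-filter : {I : Set} {P : I → Set} (P? : ∀ i → Dec (P i)) {w : I → ℚ} →
  (∀ i → 0ℚ Q.≤ w i) → ∀ F → sumℚ w (filter P? F) Q.≤ sumℚ w F
sumℚ-filter P? 0≤w []      = Q.≤-refl
sumℚ-filter P? {w} 0≤w (i ∷ F) with P? i
... | yes _ = Q.+-monoʳ-≤ (w i) (sumℚ-filter P? 0≤w F)
... | no  _ = Q.≤-trans (sumℚ-filter P? 0≤w F) (≤-gap (w i) (0≤w i) (Q.+-comm (sumℚ w F) (w i)))

sumℚ-nub : {I : Set} (_≟_ : DecidableEquality I) {w : I → ℚ} →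
  (∀ i → 0ℚ Q.≤ w i) → ∀ F → sumℚ w (deduplicate _≟_ F) Q.≤ sumℚ w F
sumℚ-nub _≟_ 0≤w []      = Q.≤-refl
sumℚ-nub _≟_ {w} 0≤w (i ∷ F) = Q.+-monoʳ-≤ (w i)
  (Q.≤-trans (sumℚ-filter (λ j → ¬? (i ≟ j)) 0≤w (deduplicate _≟_ F)) (sumℚ-nub _≟_ 0≤w F))

-- `G` may repeat entries. Removing the repetitions can only lower its sum, and afterwards `F`
-- splits off as a sublist up to permutation.
sumℚ-⊆ : {I : Set} → DecidableEquality I → {w : I → ℚ} → (∀ i → 0ℚ Q.≤ w i) →
  ∀ {F G} → Unique F → F ⊆ G → sumℚ w F Q.≤ sumℚ w G
sumℚ-⊆ _≟_ {w} 0≤w {F} {G} uF F⊆G = Q.≤-trans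
  (≤-gap (sumℚ w (nub G ∖ F)) (sumℚ-nonneg 0≤w (nub G ∖ F))
    (trans (sym (ℚSum.Sum-++ w F (nub G ∖ F)))
           (sym (ℚSum.Sum-↭ w (∖-↭ (nub-unique G) uF (λ i∈F → nub⁺ (F⊆G i∈F)))))))
  (sumℚ-nub _≟_ 0≤w G)
  where open Finite _≟_

-- The binomial theorem for divided powers

diagonal : ℕ → List (ℕ × ℕ)
diagonal zero    = (0 , 0) ∷ []
diagonal (suc n) = (0 , suc n) ∷ map (λ (i , j) → suc i , j) (diagonal n)

diagonal-sum : ∀ n {i j} → (i , j) ∈ diagonal n → i ℕ.+ j ≡ n
diagonal-sum zero    (here refl) = refl
diagonal-sum (suc n) (here refl) = refl
diagonal-sum (suc n) (there k∈)  = shifted (∈-map⁻ (λ (i , j) → suc i , j) k∈)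
  where
  shifted : ∀ {i j} → ∃[ k ] k ∈ diagonal n × ((i , j) ≡ (suc (proj₁ k) , proj₂ k)) → i ℕ.+ j ≡ suc n
  shifted (k , k∈ , refl) = cong suc (diagonal-sum n k∈)

diagonal⁺ : ∀ i j → (i , j) ∈ diagonal (i ℕ.+ j)
diagonal⁺ zero    zero    = here refl
diagonal⁺ zero    (suc j) = here refl
diagonal⁺ (suc i) j       = there (∈-map⁺ (λ (i , j) → suc i , j) (diagonal⁺ i j))

diagonal-unique : ∀ n → Unique (diagonal n)
diagonal-unique zero    = [] ∷ []
diagonal-unique (suc n) =
  All.tabulate (λ k∈ → fresh (∈-map⁻ (λ (i , j) → suc i , j) k∈)) ∷
  Unique.map⁺ (λ { refl → refl }) (diagonal-unique n)
  where
  fresh : ∀ {l} → ∃[ k ] k ∈ diagonal n × (l ≡ (suc (proj₁ k) , proj₂ k)) → (0 , suc n) ≢ l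
  fresh (k , _ , refl) ()

-- The triangles i + j < n are cofinal among the finite subsets of ℕ × ℕ, like the rectangles. Over
-- them the product of two exponential series adds up to a partial sum of a third.
triangle : ℕ → List (ℕ × ℕ)
triangle zero    = []
triangle (suc n) = diagonal n ++ triangle n

triangle-sum : ∀ n {i j} → (i , j) ∈ triangle n → i ℕ.+ j ℕ.< n
triangle-sum (suc n) k∈ =
  [ (λ ∈d → s≤s (ℕ.≤-reflexive (diagonal-sum n ∈d))) , (λ ∈t → ℕ.m≤n⇒m≤1+n (triangle-sum n ∈t)) ]′
    (∈-++⁻ (diagonal n) k∈)

triangle⁺ : ∀ n {i j} → i ℕ.+ j ℕ.< n → (i , j) ∈ triangle n
triangle⁺ (suc n) {i} {j} (s≤s i+j≤n) = go (ℕ.m≤n⇒m<n∨m≡n i+j≤n)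
  where
  go : (i ℕ.+ j ℕ.< n) ⊎ (i ℕ.+ j ≡ n) → (i , j) ∈ diagonal n ++ triangle n
  go (inj₁ i+j<n) = ∈-++⁺ʳ (diagonal n) (triangle⁺ n i+j<n)
  go (inj₂ refl)  = ∈-++⁺ˡ (diagonal⁺ i j)

triangle-unique : ∀ n → Unique (triangle n)
triangle-unique zero    = []
triangle-unique (suc n) = Unique.++⁺ (diagonal-unique n) (triangle-unique n)
  λ (∈d , ∈t) → ℕ.<-irrefl (diagonal-sum n ∈d) (triangle-sum n ∈t)

module DividedPowers {c ℓ} (R : CommutativeRing c ℓ) where
  open CommutativeRing R renaming (refl to ≈-refl; sym to ≈-sym; trans to ≈-trans)
  open ListSum R
  open IntegerSolver R
  open SetoidReasoning setoid

  Sum-cong-∈ : {I : Set} {f g : I → Carrier} → ∀ F → (∀ {i} → i ∈ F → f i ≈ g i) → Sum f F ≈ Sum g F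
  Sum-cong-∈ []      f≈g = ≈-refl
  Sum-cong-∈ (i ∷ F) f≈g = +-cong (f≈g (here refl)) (Sum-cong-∈ F (λ i∈ → f≈g (there i∈)))

  -- `diagonal` is built from the end with first index 0; the recurrence for the second factor has
  -- to peel off the other end.
  Sum-diagonal : (h : ℕ × ℕ → Carrier) → ∀ n →
    Sum h (diagonal (suc n)) ≈ Sum (λ (i , j) → h (i , suc j)) (diagonal n) + h (suc n , 0)
  Sum-diagonal h zero    = begin
    h (0 , 1) + (h (1 , 0) + 0#)   ≈⟨ +-congˡ (+-comm _ _) ⟩
    h (0 , 1) + (0# + h (1 , 0))   ≈⟨ +-assoc _ _ _ ⟨
    (h (0 , 1) + 0#) + h (1 , 0)   ∎
  Sum-diagonal h (suc n) = begin
    h (0 , suc (suc n)) + Sum h (map shift (diagonal (suc n)))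
      ≡⟨ cong (λ s → h (0 , suc (suc n)) + s) (Sum-map h shift (diagonal (suc n))) ⟩
    h (0 , suc (suc n)) + Sum (h ∘ shift) (diagonal (suc n))
      ≈⟨ +-congˡ (Sum-diagonal (h ∘ shift) n) ⟩
    h (0 , suc (suc n)) + (Sum (λ (i , j) → h (suc i , suc j)) (diagonal n) + h (suc (suc n) , 0))
      ≈⟨ +-assoc _ _ _ ⟨
    (h (0 , suc (suc n)) + Sum (λ (i , j) → h (suc i , suc j)) (diagonal n)) + h (suc (suc n) , 0)
      ≡⟨ cong (λ s → (h (0 , suc (suc n)) + s) + h (suc (suc n) , 0))
           (Sum-map (λ (i , j) → h (i , suc j)) shift (diagonal n)) ⟨
    Sum (λ (i , j) → h (i , suc j)) (diagonal (suc n)) + h (suc (suc n) , 0) ∎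
    where
    shift : ℕ × ℕ → ℕ × ℕ
    shift (i , j) = suc i , j

  module _ (N : ℕ → Carrier) (N-0 : N 0 ≈ 0#) (N-+ : ∀ m n → N (m ℕ.+ n) ≈ N m + N n)
    (N⁻¹ : ℕ → Carrier) (N-inverse : ∀ n → N⁻¹ n * N (suc n) ≈ 1#) where

    -- With `N` invertible at positive arguments, this determines `E n` as z^n / n!. The recurrence
    -- takes the place of factorials and binomial coefficients in the addition theorem.
    record IsDividedPowers (z : Carrier) (E : ℕ → Carrier) : Set (c Level.⊔ ℓ) where
      field
        E-0   : E 0 ≈ 1#
        E-suc : ∀ n → N (suc n) * E (suc n) ≈ z * E n

    open IsDividedPowers

    N-cancel : ∀ n {x y} → N (suc n) * x ≈ N (suc n) * y → x ≈ y
    N-cancel n {x} {y} eq = begin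
      x                            ≈⟨ *-identityˡ x ⟨
      1# * x                       ≈⟨ *-congʳ (N-inverse n) ⟨
      N⁻¹ n * N (suc n) * x        ≈⟨ *-assoc _ _ _ ⟩
      N⁻¹ n * (N (suc n) * x)      ≈⟨ *-congˡ eq ⟩
      N⁻¹ n * (N (suc n) * y)      ≈⟨ *-assoc _ _ _ ⟨
      N⁻¹ n * N (suc n) * y        ≈⟨ *-congʳ (N-inverse n) ⟩
      1# * y                       ≈⟨ *-identityˡ y ⟩
      y                            ∎

    module _ {z w} {E F G : ℕ → Carrier} (dE : IsDividedPowers z E) (dF : IsDividedPowers w F)
      (dG : IsDividedPowers (z + w) G) where

      E⊗F : ℕ × ℕ → Carrier
      E⊗F (i , j) = E i * F j

      -- The Leibniz rule: on the diagonal N (n + 1) = N i + N j, and each summand is absorbed by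
      -- one factor through `E-suc`. The end terms with i = 0 or j = 0 vanish, so the two parts are
      -- z and w times the previous diagonal.
      diagonal-recurrence : ∀ n → N (suc n) * Sum E⊗F (diagonal (suc n)) ≈ (z + w) * Sum E⊗F (diagonal n)
      diagonal-recurrence n = begin
        N (suc n) * Sum E⊗F (diagonal (suc n))
          ≈⟨ Sum-*ˡ (N (suc n)) E⊗F (diagonal (suc n)) ⟩
        Sum (λ k → N (suc n) * E⊗F k) (diagonal (suc n))
          ≈⟨ Sum-cong-∈ (diagonal (suc n)) split ⟩
        Sum (λ (i , j) → (N i * E i) * F j + E i * (N j * F j)) (diagonal (suc n))
          ≈⟨ Sum-+ (λ (i , j) → (N i * E i) * F j) (λ (i , j) → E i * (N j * F j)) (diagonal (suc n)) ⟩
        Sum (λ (i , j) → (N i * E i) * F j) (diagonal (suc n)) + Sum (λ (i , j) → E i * (N j * F j)) (diagonal (suc n))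
          ≈⟨ +-cong first second ⟩
        z * Sum E⊗F (diagonal n) + w * Sum E⊗F (diagonal n)
          ≈⟨ distribʳ _ z w ⟨
        (z + w) * Sum E⊗F (diagonal n) ∎
        where
        split : ∀ {k} → k ∈ diagonal (suc n) →
          N (suc n) * E⊗F k ≈ (N (proj₁ k) * E (proj₁ k)) * F (proj₂ k) + E (proj₁ k) * (N (proj₂ k) * F (proj₂ k))
        split {i , j} k∈ = begin
          N (suc n) * (E i * F j)                  ≡⟨ cong (λ m → N m * (E i * F j)) (diagonal-sum (suc n) k∈) ⟨
          N (i ℕ.+ j) * (E i * F j)                ≈⟨ *-congʳ (N-+ i j) ⟩
          (N i + N j) * (E i * F j)                ≈⟨ solve 4 (λ a b e f →
            (a :+ b) :* (e :* f) := (a :* e) :* f :+ e :* (b :* f)) ≈-refl (N i) (N j) (E i) (F j) ⟩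
          (N i * E i) * F j + E i * (N j * F j)    ∎
        vanish : (N 0 * E 0) * F (suc n) ≈ 0#
        vanish = ≈-trans (*-congʳ (≈-trans (*-congʳ N-0) (zeroˡ (E 0)))) (zeroˡ (F (suc n)))
        first : Sum (λ (i , j) → (N i * E i) * F j) (diagonal (suc n)) ≈ z * Sum E⊗F (diagonal n)
        first = begin
          (N 0 * E 0) * F (suc n) + Sum (λ (i , j) → (N i * E i) * F j) (map (λ (i , j) → suc i , j) (diagonal n))
            ≈⟨ ≈-trans (+-congʳ vanish) (+-identityˡ _) ⟩
          Sum (λ (i , j) → (N i * E i) * F j) (map (λ (i , j) → suc i , j) (diagonal n))
            ≡⟨ Sum-map (λ (i , j) → (N i * E i) * F j) (λ (i , j) → suc i , j) (diagonal n) ⟩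
          Sum (λ (i , j) → (N (suc i) * E (suc i)) * F j) (diagonal n)
            ≈⟨ Sum-cong (λ (i , j) → ≈-trans (*-congʳ (E-suc dE i)) (*-assoc z (E i) (F j))) (diagonal n) ⟩
          Sum (λ (i , j) → z * (E i * F j)) (diagonal n)
            ≈⟨ Sum-*ˡ z E⊗F (diagonal n) ⟨
          z * Sum E⊗F (diagonal n) ∎
        second : Sum (λ (i , j) → E i * (N j * F j)) (diagonal (suc n)) ≈ w * Sum E⊗F (diagonal n)
        second = begin
          Sum (λ (i , j) → E i * (N j * F j)) (diagonal (suc n))
            ≈⟨ Sum-diagonal (λ (i , j) → E i * (N j * F j)) n ⟩
          Sum (λ (i , j) → E i * (N (suc j) * F (suc j))) (diagonal n) + E (suc n) * (N 0 * F 0)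
            ≈⟨ +-congˡ (≈-trans (*-congˡ (≈-trans (*-congʳ N-0) (zeroˡ (F 0)))) (zeroʳ (E (suc n)))) ⟩
          Sum (λ (i , j) → E i * (N (suc j) * F (suc j))) (diagonal n) + 0#
            ≈⟨ +-identityʳ _ ⟩
          Sum (λ (i , j) → E i * (N (suc j) * F (suc j))) (diagonal n)
            ≈⟨ Sum-cong (λ (i , j) → ≈-trans (*-congˡ (E-suc dF j))
                 (solve 3 (λ e w f → e :* (w :* f) := w :* (e :* f)) ≈-refl (E i) w (F j))) (diagonal n) ⟩
          Sum (λ (i , j) → w * (E i * F j)) (diagonal n)
            ≈⟨ Sum-*ˡ w E⊗F (diagonal n) ⟨
          w * Sum E⊗F (diagonal n) ∎

      binomial : ∀ n → Sum E⊗F (diagonal n) ≈ G n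
      binomial zero    = ≈-trans (+-identityʳ _) (≈-trans (*-cong (E-0 dE) (E-0 dF))
        (≈-trans (*-identityˡ 1#) (≈-sym (E-0 dG))))
      binomial (suc n) = N-cancel n (≈-trans (diagonal-recurrence n)
        (≈-trans (*-congˡ (binomial n)) (≈-sym (E-suc dG n))))

      Sum-triangle : ∀ n → Sum E⊗F (triangle n) ≈ Sum G (downFrom n)
      Sum-triangle zero    = ≈-refl
      Sum-triangle (suc n) = ≈-trans (Sum-++ E⊗F (diagonal n) (triangle n)) (+-cong (binomial n) (Sum-triangle n))

-- A decidable subset of I, with its 0/1 indicator, identified with J.
record Embedding (J I : Set) : Set where
  field
    to        : J → I
    from      : I → J
    indicator : I → ℕ
    from-to   : ∀ j → from (to j) ≡ j
    ind-to    : ∀ j → indicator (to j) ≡ 1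
    image     : ∀ i → (indicator i ≡ 0) ⊎ ((indicator i ≡ 1) × (to (from i) ≡ i))

-- The norm form

norm : ℤ × ℤ → ℤ
norm (m , n) = m ℤ.* m ℤ.+ m ℤ.* n ℤ.+ n ℤ.* n

i*i≡∣i∣*∣i∣ : ∀ i → i ℤ.* i ≡ + (ℤ.∣ i ∣ ℕ.* ℤ.∣ i ∣)
i*i≡∣i∣*∣i∣ (+ n)    = sym (ℤ.pos-* n n)
i*i≡∣i∣*∣i∣ -[1+ n ] = refl

norm-double : ∀ m n → + 2 ℤ.* norm (m , n) ≡
  + (ℤ.∣ m ∣ ℕ.* ℤ.∣ m ∣ ℕ.+ ℤ.∣ n ∣ ℕ.* ℤ.∣ n ∣ ℕ.+ ℤ.∣ m ℤ.+ n ∣ ℕ.* ℤ.∣ m ℤ.+ n ∣)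
norm-double m n = trans (ℤ-id.norm-double m n)
  (cong₂ ℤ._+_ (cong₂ ℤ._+_ (i*i≡∣i∣*∣i∣ m) (i*i≡∣i∣*∣i∣ n)) (i*i≡∣i∣*∣i∣ (m ℤ.+ n)))

norm-nonneg : ∀ λ′ → + 0 ℤ.≤ norm λ′
norm-nonneg (m , n) = ℤ.*-cancelˡ-≤-pos (+ 0) (norm (m , n)) (+ 2)
  (subst (+ 0 ℤ.≤_) (sym (norm-double m n)) (ℤ.+≤+ z≤n))

-- 2 N(m , n) = m² + n² + (m + n)², and k is at most k² for natural k. A bound linear in the
-- coordinates suffices for comparing q^N with a product of geometric weights.
size≤norm : ∀ m n → ℤ.∣ m ∣ ℕ.+ ℤ.∣ n ∣ ℕ.≤ ℤ.∣ norm (m , n) ∣ ℕ.+ ℤ.∣ norm (m , n) ∣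
size≤norm m n = begin
  ℤ.∣ m ∣ ℕ.+ ℤ.∣ n ∣                           ≤⟨ ℕ.+-mono-≤ (k≤k² ℤ.∣ m ∣) (k≤k² ℤ.∣ n ∣) ⟩
  ℤ.∣ m ∣ ℕ.* ℤ.∣ m ∣ ℕ.+ ℤ.∣ n ∣ ℕ.* ℤ.∣ n ∣   ≤⟨ ℕ.m≤m+n _ _ ⟩
  ℤ.∣ m ∣ ℕ.* ℤ.∣ m ∣ ℕ.+ ℤ.∣ n ∣ ℕ.* ℤ.∣ n ∣ ℕ.+ ℤ.∣ m ℤ.+ n ∣ ℕ.* ℤ.∣ m ℤ.+ n ∣
                                                ≡⟨ cong ℤ.∣_∣ (norm-double m n) ⟨
  ℤ.∣ + 2 ℤ.* norm (m , n) ∣                    ≡⟨ ℤ.abs-* (+ 2) (norm (m , n)) ⟩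
  2 ℕ.* ℤ.∣ norm (m , n) ∣                      ≡⟨ cong (ℤ.∣ norm (m , n) ∣ ℕ.+_) (ℕ.+-identityʳ _) ⟩
  ℤ.∣ norm (m , n) ∣ ℕ.+ ℤ.∣ norm (m , n) ∣     ∎
  where
  open ℕ.≤-Reasoning
  k≤k² : ∀ k → k ℕ.≤ k ℕ.* k
  k≤k² zero    = z≤n
  k≤k² (suc k) = ℕ.m≤m*n (suc k) (suc k)

-- Complex arithmetic is made opaque as well: two complex terms would otherwise be
-- compared by comparing Cauchy moduli.
module C where
  infixl 6 _+_ _-_
  infixl 7 _*_
  infix  8 -_

  opaque
    _+_ _*_ : ℂ → ℂ → ℂ
    _+_ = D._+_
    _*_ = D._*_

    -_ conj : ℂ → ℂ
    -_     = D.-_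
    conj z = re z +i (-ℝ im z)

    reₙ imₙ : ℂ → ℕ → ℚ
    reₙ z n = seq (re z) n
    imₙ z n = seq (im z) n

    ℚ→ℂ : ℚ → ℂ
    ℚ→ℂ = D.ℚ→ℂ

  _-_ : ℂ → ℂ → ℂ
  z - w = z + (- w)

  0ℂ 1ℂ : ℂ
  0ℂ = ℚ→ℂ 0ℚ
  1ℂ = ℚ→ℂ 1ℚ

  opaque
    unfolding _+_ Q._+_

    re-+ : ∀ z w n → reₙ (z + w) n ≡ reₙ z n Q.+ reₙ w n
    re-+ z w n = refl

    im-+ : ∀ z w n → imₙ (z + w) n ≡ imₙ z n Q.+ imₙ w n
    im-+ z w n = refl

    re-neg : ∀ z n → reₙ (- z) n ≡ Q.- reₙ z n
    re-neg z n = refl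

    im-neg : ∀ z n → imₙ (- z) n ≡ Q.- imₙ z n
    im-neg z n = refl

    re-conj : ∀ z n → reₙ (conj z) n ≡ reₙ z n
    re-conj z n = refl

    im-conj : ∀ z n → imₙ (conj z) n ≡ Q.- imₙ z n
    im-conj z n = refl

    re-* : ∀ z w n → reₙ (z * w) n ≡ reₙ z n Q.* reₙ w n Q.+ Q.- (imₙ z n Q.* imₙ w n)
    re-* z w n = refl

    im-* : ∀ z w n → imₙ (z * w) n ≡ reₙ z n Q.* imₙ w n Q.+ imₙ z n Q.* reₙ w n
    im-* z w n = refl

    re-ℚ : ∀ p n → reₙ (ℚ→ℂ p) n ≡ p
    re-ℚ p n = refl

    im-ℚ : ∀ p n → imₙ (ℚ→ℂ p) n ≡ 0ℚ
    im-ℚ p n = refl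

  Cauchy : (ℕ → ℚ) → Set
  Cauchy x = ∀ {ε} → 0ℚ Q.< ε → ∃[ N ] ∀ m n → N ℕ.≤ m → N ℕ.≤ n → Q.∣ x m Q.- x n ∣ Q.< ε

  opaque
    unfolding _+_ Q._+_

    re-cauchy : ∀ z → Cauchy (reₙ z)
    re-cauchy z = cauchy (re z)

    im-cauchy : ∀ z → Cauchy (imₙ z)
    im-cauchy z = cauchy (im z)

    fromSeq : ∀ {x y} → Cauchy x → Cauchy y → ℂ
    fromSeq {x} {y} cx cy = mkℝ x cx +i mkℝ y cy

    re-fromSeq : ∀ {x y} (cx : Cauchy x) (cy : Cauchy y) n → reₙ (fromSeq cx cy) n ≡ x n
    re-fromSeq cx cy n = refl

    im-fromSeq : ∀ {x y} (cx : Cauchy x) (cy : Cauchy y) n → imₙ (fromSeq cx cy) n ≡ y n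
    im-fromSeq cx cy n = refl

-- Complex numbers by their approximations: bounds, equality and convergence

module Analysis where
  open C

  re-sub : ∀ z w n → reₙ (z - w) n ≡ reₙ z n Q.- reₙ w n
  re-sub z w n = trans (re-+ z (- w) n) (cong (λ p → reₙ z n Q.+ p) (re-neg w n))

  im-sub : ∀ z w n → imₙ (z - w) n ≡ imₙ z n Q.- imₙ w n
  im-sub z w n = trans (im-+ z (- w) n) (cong (λ p → imₙ z n Q.+ p) (im-neg w n))

  infix 4 _≐_ _≺_ _≈_

  -- Equality of the approximating sequences term by term: the ring laws already
  -- hold for this relation, and unlike ≃ it transports uniform bounds.
  record _≐_ (z w : ℂ) : Set where
    constructor mk≐
    field
      re≡ : ∀ n → reₙ z n ≡ reₙ w n
      im≡ : ∀ n → imₙ z n ≡ imₙ w n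

  open _≐_

  -- The ℓ¹-norm is used because, unlike the modulus, it is rational-valued on
  -- Gaussian rationals; it is still submultiplicative.
  opaque
    ‖_‖ : ℂ → ℕ → ℚ
    ‖ z ‖ n = Q.∣ reₙ z n ∣ Q.+ Q.∣ imₙ z n ∣

    ‖‖-def : ∀ z n → ‖ z ‖ n ≡ Q.∣ reₙ z n ∣ Q.+ Q.∣ imₙ z n ∣
    ‖‖-def z n = refl

  record _≺_ (z : ℂ) (r : ℚ) : Set where
    constructor mk≺
    field
      start : ℕ
      bound : ∀ n → start ℕ.≤ n → ‖ z ‖ n Q.≤ r

  record _≈_ (z w : ℂ) : Set where
    constructor mk≈
    field
      close : ∀ {ε} → 0ℚ Q.< ε → (z - w) ≺ ε

  open _≈_

  ≐-refl : ∀ {z} → z ≐ z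
  ≐-refl = mk≐ (λ _ → refl) (λ _ → refl)

  ≐-sym : ∀ {z w} → z ≐ w → w ≐ z
  ≐-sym p = mk≐ (λ n → sym (re≡ p n)) (λ n → sym (im≡ p n))

  ≐-trans : ∀ {u v w} → u ≐ v → v ≐ w → u ≐ w
  ≐-trans p q = mk≐ (λ n → trans (re≡ p n) (re≡ q n)) (λ n → trans (im≡ p n) (im≡ q n))

  +-cong≐ : ∀ {z z′ w w′} → z ≐ z′ → w ≐ w′ → z + w ≐ z′ + w′
  +-cong≐ {z} {z′} {w} {w′} p q = mk≐
    (λ n → trans (re-+ z w n) (trans (cong₂ Q._+_ (re≡ p n) (re≡ q n)) (sym (re-+ z′ w′ n))))
    (λ n → trans (im-+ z w n) (trans (cong₂ Q._+_ (im≡ p n) (im≡ q n)) (sym (im-+ z′ w′ n))))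

  -‿cong≐ : ∀ {z z′} → z ≐ z′ → - z ≐ - z′
  -‿cong≐ {z} {z′} p = mk≐
    (λ n → trans (re-neg z n) (trans (cong Q.-_ (re≡ p n)) (sym (re-neg z′ n))))
    (λ n → trans (im-neg z n) (trans (cong Q.-_ (im≡ p n)) (sym (im-neg z′ n))))

  *-cong≐ : ∀ {z z′ w w′} → z ≐ z′ → w ≐ w′ → z * w ≐ z′ * w′
  *-cong≐ {z} {z′} {w} {w′} p q = mk≐
    (λ n → trans (re-* z w n) (trans
      (cong₂ Q._+_ (cong₂ Q._*_ (re≡ p n) (re≡ q n)) (cong Q.-_ (cong₂ Q._*_ (im≡ p n) (im≡ q n))))
      (sym (re-* z′ w′ n))))
    (λ n → trans (im-* z w n) (trans
      (cong₂ Q._+_ (cong₂ Q._*_ (re≡ p n) (im≡ q n)) (cong₂ Q._*_ (im≡ p n) (re≡ q n)))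
      (sym (im-* z′ w′ n))))

  +-assoc≐ : ∀ u v w → (u + v) + w ≐ u + (v + w)
  +-assoc≐ u v w = mk≐ assoc-re assoc-im
    where
    assoc-re : ∀ n → reₙ ((u + v) + w) n ≡ reₙ (u + (v + w)) n
    assoc-re n rewrite re-+ (u + v) w n | re-+ u v n | re-+ u (v + w) n | re-+ v w n = Q.+-assoc _ _ _
    assoc-im : ∀ n → imₙ ((u + v) + w) n ≡ imₙ (u + (v + w)) n
    assoc-im n rewrite im-+ (u + v) w n | im-+ u v n | im-+ u (v + w) n | im-+ v w n = Q.+-assoc _ _ _

  +-comm≐ : ∀ z w → z + w ≐ w + z
  +-comm≐ z w = mk≐
    (λ n → trans (re-+ z w n) (trans (Q.+-comm (reₙ z n) (reₙ w n)) (sym (re-+ w z n))))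
    (λ n → trans (im-+ z w n) (trans (Q.+-comm (imₙ z n) (imₙ w n)) (sym (im-+ w z n))))

  +-identityˡ≐ : ∀ z → 0ℂ + z ≐ z
  +-identityˡ≐ z = mk≐
    (λ n → trans (re-+ 0ℂ z n) (trans (cong (Q._+ reₙ z n) (re-ℚ 0ℚ n)) (Q.+-identityˡ _)))
    (λ n → trans (im-+ 0ℂ z n) (trans (cong (Q._+ imₙ z n) (im-ℚ 0ℚ n)) (Q.+-identityˡ _)))

  -‿inverseʳ≐ : ∀ z → z + - z ≐ 0ℂ
  -‿inverseʳ≐ z = mk≐
    (λ n → trans (re-sub z z n) (trans (Q.+-inverseʳ (reₙ z n)) (sym (re-ℚ 0ℚ n))))
    (λ n → trans (im-sub z z n) (trans (Q.+-inverseʳ (imₙ z n)) (sym (im-ℚ 0ℚ n))))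

  *-assoc≐ : ∀ u v w → (u * v) * w ≐ u * (v * w)
  *-assoc≐ u v w = mk≐ assoc-re assoc-im
    where
    assoc-re : ∀ n → reₙ ((u * v) * w) n ≡ reₙ (u * (v * w)) n
    assoc-re n rewrite re-* (u * v) w n | re-* u v n | im-* u v n | re-* u (v * w) n | re-* v w n | im-* v w n =
      ℚ-id.*-assoc-re (reₙ u n) (imₙ u n) (reₙ v n) (imₙ v n) (reₙ w n) (imₙ w n)
    assoc-im : ∀ n → imₙ ((u * v) * w) n ≡ imₙ (u * (v * w)) n
    assoc-im n rewrite im-* (u * v) w n | re-* u v n | im-* u v n | im-* u (v * w) n | re-* v w n | im-* v w n =
      ℚ-id.*-assoc-im (reₙ u n) (imₙ u n) (reₙ v n) (imₙ v n) (reₙ w n) (imₙ w n)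

  *-comm≐ : ∀ z w → z * w ≐ w * z
  *-comm≐ z w = mk≐
    (λ n → trans (re-* z w n) (trans
      (ℚ-id.*-comm-re (reₙ z n) (imₙ z n) (reₙ w n) (imₙ w n)) (sym (re-* w z n))))
    (λ n → trans (im-* z w n) (trans
      (ℚ-id.*-comm-im (reₙ z n) (imₙ z n) (reₙ w n) (imₙ w n)) (sym (im-* w z n))))

  *-identityˡ≐ : ∀ z → 1ℂ * z ≐ z
  *-identityˡ≐ z = mk≐ identity-re identity-im
    where
    identity-re : ∀ n → reₙ (1ℂ * z) n ≡ reₙ z n
    identity-re n rewrite re-* 1ℂ z n | re-ℚ 1ℚ n | im-ℚ 1ℚ n = ℚ-id.*-identityˡ-re (reₙ z n) (imₙ z n)
    identity-im : ∀ n → imₙ (1ℂ * z) n ≡ imₙ z n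
    identity-im n rewrite im-* 1ℂ z n | re-ℚ 1ℚ n | im-ℚ 1ℚ n = ℚ-id.*-identityˡ-im (reₙ z n) (imₙ z n)

  distribˡ≐ : ∀ u v w → u * (v + w) ≐ u * v + u * w
  distribˡ≐ u v w = mk≐ distrib-re distrib-im
    where
    distrib-re : ∀ n → reₙ (u * (v + w)) n ≡ reₙ (u * v + u * w) n
    distrib-re n rewrite re-* u (v + w) n | re-+ v w n | im-+ v w n | re-+ (u * v) (u * w) n | re-* u v n | re-* u w n =
      ℚ-id.distribˡ-re (reₙ u n) (imₙ u n) (reₙ v n) (imₙ v n) (reₙ w n) (imₙ w n)
    distrib-im : ∀ n → imₙ (u * (v + w)) n ≡ imₙ (u * v + u * w) n
    distrib-im n rewrite im-* u (v + w) n | re-+ v w n | im-+ v w n | im-+ (u * v) (u * w) n | im-* u v n | im-* u w n =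
      ℚ-id.distribˡ-im (reₙ u n) (imₙ u n) (reₙ v n) (imₙ v n) (reₙ w n) (imₙ w n)

  -- The laws are proved once, for `_≐_`, and hold for every coarser congruence. The module is used
  -- for `_≐_` itself, where identities must preserve bounds at each index, and for `_≈_`.
  module RingLaws (_~_ : ℂ → ℂ → Set) (~-isEquivalence : IsEquivalence _~_)
    (embed : ∀ {z w} → z ≐ w → z ~ w)
    (+-cong : ∀ {z z′ w w′} → z ~ z′ → w ~ w′ → (z + w) ~ (z′ + w′))
    (-‿cong : ∀ {z z′} → z ~ z′ → (- z) ~ (- z′))
    (*-cong : ∀ {z z′ w w′} → z ~ z′ → w ~ w′ → (z * w) ~ (z′ * w′)) where

    private
      flip : ∀ {u v w} → u ≐ v → u ≐ w → v ~ w
      flip p q = embed (≐-trans (≐-sym p) q)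

    commutativeRing : CommutativeRing 0ℓ 0ℓ
    commutativeRing = record
      { Carrier = ℂ ; _≈_ = _~_ ; _+_ = _+_ ; _*_ = _*_ ; -_ = -_ ; 0# = 0ℂ ; 1# = 1ℂ
      ; isCommutativeRing = record
        { isRing = record
          { +-isAbelianGroup = record
            { isGroup = record
              { isMonoid = record
                { isSemigroup = record
                  { isMagma = record { isEquivalence = ~-isEquivalence ; ∙-cong = +-cong }
                  ; assoc = λ u v w → embed (+-assoc≐ u v w) }
                ; identity = (λ z → embed (+-identityˡ≐ z)) , (λ z → flip (+-comm≐ 0ℂ z) (+-identityˡ≐ z)) }
              ; inverse = (λ z → flip (+-comm≐ z (- z)) (-‿inverseʳ≐ z)) , (λ z → embed (-‿inverseʳ≐ z))
              ; ⁻¹-cong = -‿cong }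
            ; comm = λ z w → embed (+-comm≐ z w) }
          ; *-cong = *-cong
          ; *-assoc = λ u v w → embed (*-assoc≐ u v w)
          ; *-identity = (λ z → embed (*-identityˡ≐ z)) , (λ z → flip (*-comm≐ 1ℂ z) (*-identityˡ≐ z))
          ; distrib = (λ u v w → embed (distribˡ≐ u v w))
                    , (λ u v w → flip (*-comm≐ u (v + w))
                        (≐-trans (distribˡ≐ u v w) (+-cong≐ (*-comm≐ u v) (*-comm≐ u w)))) }
        ; *-comm = λ z w → embed (*-comm≐ z w) } }

  ℂ≐-ring : CommutativeRing 0ℓ 0ℓ
  ℂ≐-ring = RingLaws.commutativeRing _≐_
    (record { refl = ≐-refl ; sym = ≐-sym ; trans = ≐-trans }) id +-cong≐ -‿cong≐ *-cong≐

  ∣+∣≤ : ∀ {p} a b → p ≡ a Q.+ b → Q.∣ p ∣ Q.≤ Q.∣ a ∣ Q.+ Q.∣ b ∣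
  ∣+∣≤ a b refl = Q.∣p+q∣≤∣p∣+∣q∣ a b

  ‖‖-nonneg : ∀ z n → 0ℚ Q.≤ ‖ z ‖ n
  ‖‖-nonneg z n = subst (0ℚ Q.≤_) (sym (‖‖-def z n)) (+-nonneg (Q.0≤∣p∣ (reₙ z n)) (Q.0≤∣p∣ (imₙ z n)))

  ‖‖-cong : ∀ {z w} → z ≐ w → ∀ n → ‖ z ‖ n ≡ ‖ w ‖ n
  ‖‖-cong {z} {w} p n = trans (‖‖-def z n)
    (trans (cong₂ (λ x y → Q.∣ x ∣ Q.+ Q.∣ y ∣) (re≡ p n) (im≡ p n)) (sym (‖‖-def w n)))

  ‖0‖ : ∀ n → ‖ 0ℂ ‖ n ≡ 0ℚ
  ‖0‖ n = trans (‖‖-def 0ℂ n) (trans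
    (cong₂ (λ x y → Q.∣ x ∣ Q.+ Q.∣ y ∣) (re-ℚ 0ℚ n) (im-ℚ 0ℚ n))
    (trans (cong₂ Q._+_ (Q.0≤p⇒∣p∣≡p Q.≤-refl) (Q.0≤p⇒∣p∣≡p Q.≤-refl)) (Q.+-identityˡ 0ℚ)))

  ‖+‖ : ∀ z w n → ‖ z + w ‖ n Q.≤ ‖ z ‖ n Q.+ ‖ w ‖ n
  ‖+‖ z w n = begin
    ‖ z + w ‖ n
      ≡⟨ ‖‖-def (z + w) n ⟩
    Q.∣ reₙ (z + w) n ∣ Q.+ Q.∣ imₙ (z + w) n ∣
      ≤⟨ Q.+-mono-≤ (∣+∣≤ (reₙ z n) (reₙ w n) (re-+ z w n)) (∣+∣≤ (imₙ z n) (imₙ w n) (im-+ z w n)) ⟩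
    (Q.∣ reₙ z n ∣ Q.+ Q.∣ reₙ w n ∣) Q.+ (Q.∣ imₙ z n ∣ Q.+ Q.∣ imₙ w n ∣)
      ≡⟨ ℚ-id.interchange Q.∣ reₙ z n ∣ Q.∣ reₙ w n ∣ Q.∣ imₙ z n ∣ Q.∣ imₙ w n ∣ ⟩
    (Q.∣ reₙ z n ∣ Q.+ Q.∣ imₙ z n ∣) Q.+ (Q.∣ reₙ w n ∣ Q.+ Q.∣ imₙ w n ∣)
      ≡⟨ cong₂ Q._+_ (‖‖-def z n) (‖‖-def w n) ⟨
    ‖ z ‖ n Q.+ ‖ w ‖ n ∎
    where open Q.≤-Reasoning

  ‖-‖ : ∀ z n → ‖ - z ‖ n ≡ ‖ z ‖ n
  ‖-‖ z n = trans (‖‖-def (- z) n) (trans (cong₂ Q._+_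
    (trans (cong Q.∣_∣ (re-neg z n)) (Q.∣-p∣≡∣p∣ (reₙ z n)))
    (trans (cong Q.∣_∣ (im-neg z n)) (Q.∣-p∣≡∣p∣ (imₙ z n)))) (sym (‖‖-def z n)))

  ‖*‖ : ∀ z w n → ‖ z * w ‖ n Q.≤ ‖ z ‖ n Q.* ‖ w ‖ n
  ‖*‖ z w n = begin
    ‖ z * w ‖ n
      ≡⟨ ‖‖-def (z * w) n ⟩
    Q.∣ reₙ (z * w) n ∣ Q.+ Q.∣ imₙ (z * w) n ∣
      ≤⟨ Q.+-mono-≤ (∣+∣≤ (a Q.* c) (Q.- (b Q.* d)) (re-* z w n)) (∣+∣≤ (a Q.* d) (b Q.* c) (im-* z w n)) ⟩
    (Q.∣ a Q.* c ∣ Q.+ Q.∣ Q.- (b Q.* d) ∣) Q.+ (Q.∣ a Q.* d ∣ Q.+ Q.∣ b Q.* c ∣)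
      ≡⟨ cong₂ Q._+_ (cong₂ Q._+_ (∣*∣ a c) (trans (Q.∣-p∣≡∣p∣ (b Q.* d)) (∣*∣ b d)))
                     (cong₂ Q._+_ (∣*∣ a d) (∣*∣ b c)) ⟩
    (Q.∣ a ∣ Q.* Q.∣ c ∣ Q.+ Q.∣ b ∣ Q.* Q.∣ d ∣) Q.+ (Q.∣ a ∣ Q.* Q.∣ d ∣ Q.+ Q.∣ b ∣ Q.* Q.∣ c ∣)
      ≡⟨ ℚ-id.expand Q.∣ a ∣ Q.∣ b ∣ Q.∣ c ∣ Q.∣ d ∣ ⟩
    (Q.∣ a ∣ Q.+ Q.∣ b ∣) Q.* (Q.∣ c ∣ Q.+ Q.∣ d ∣)
      ≡⟨ cong₂ Q._*_ (‖‖-def z n) (‖‖-def w n) ⟨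
    ‖ z ‖ n Q.* ‖ w ‖ n ∎
    where
    open Q.≤-Reasoning
    a = reₙ z n
    b = imₙ z n
    c = reₙ w n
    d = imₙ w n
    ∣*∣ = Q.∣p*q∣≡∣p∣*∣q∣

  ≺-resp : ∀ {z w r} → z ≐ w → z ≺ r → w ≺ r
  ≺-resp {r = r} z≐w (mk≺ N h) = mk≺ N λ n N≤n → subst (Q._≤ r) (‖‖-cong z≐w n) (h n N≤n)

  ≺-mono : ∀ {z r s} → r Q.≤ s → z ≺ r → z ≺ s
  ≺-mono r≤s (mk≺ N h) = mk≺ N λ n N≤n → Q.≤-trans (h n N≤n) r≤s

  ≺-+ : ∀ {z w r s} → z ≺ r → w ≺ s → z + w ≺ r Q.+ s
  ≺-+ {z} {w} (mk≺ M h) (mk≺ N k) = mk≺ (M ℕ.⊔ N) λ n ≤n →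
    Q.≤-trans (‖+‖ z w n) (Q.+-mono-≤ (h n (ℕ.m⊔n≤o⇒m≤o M N ≤n)) (k n (ℕ.m⊔n≤o⇒n≤o M N ≤n)))

  ≺-neg : ∀ {z r} → z ≺ r → - z ≺ r
  ≺-neg {z} {r} (mk≺ N h) = mk≺ N λ n N≤n → subst (Q._≤ r) (sym (‖-‖ z n)) (h n N≤n)

  ≺-nonneg : ∀ {z r} → z ≺ r → 0ℚ Q.≤ r
  ≺-nonneg {z} (mk≺ N h) = Q.≤-trans (‖‖-nonneg z N) (h N ℕ.≤-refl)

  ≺-* : ∀ {z w r s} → z ≺ r → w ≺ s → z * w ≺ r Q.* s
  ≺-* {z} {w} z≺r@(mk≺ M h) w≺s@(mk≺ N k) = mk≺ (M ℕ.⊔ N) λ n ≤n →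
    Q.≤-trans (‖*‖ z w n) (*-mono (‖‖-nonneg z n) (≺-nonneg w≺s)
      (h n (ℕ.m⊔n≤o⇒m≤o M N ≤n)) (k n (ℕ.m⊔n≤o⇒n≤o M N ≤n)))

  cauchy⇒bounded : ∀ (x : ℕ → ℚ) {N} →
    (∀ m n → N ℕ.≤ m → N ℕ.≤ n → Q.∣ x m Q.- x n ∣ Q.< 1ℚ) →
    ∀ n → N ℕ.≤ n → Q.∣ x n ∣ Q.≤ 1ℚ Q.+ Q.∣ x N ∣
  cauchy⇒bounded x {N} h n N≤n = Q.≤-trans
    (∣+∣≤ (x n Q.- x N) (x N) (sym (ℚ-id.difference-+ (x n) (x N))))
    (Q.+-monoˡ-≤ Q.∣ x N ∣ (Q.<⇒≤ (h n N N≤n ℕ.≤-refl)))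

  opaque
    ≺-bound : ∀ z → ∃[ B ] z ≺ B
    ≺-bound z = combine (re-cauchy z Q.0<1) (im-cauchy z Q.0<1)
      where
      combine : (∃[ M ] ∀ m n → M ℕ.≤ m → M ℕ.≤ n → Q.∣ reₙ z m Q.- reₙ z n ∣ Q.< 1ℚ) →
                (∃[ N ] ∀ m n → N ℕ.≤ m → N ℕ.≤ n → Q.∣ imₙ z m Q.- imₙ z n ∣ Q.< 1ℚ) → ∃[ B ] z ≺ B
      combine (M , h) (N , k) = A Q.+ B , mk≺ (M ℕ.⊔ N) bnd
        where
        A B : ℚ
        A = 1ℚ Q.+ Q.∣ reₙ z M ∣
        B = 1ℚ Q.+ Q.∣ imₙ z N ∣
        bnd : ∀ n → M ℕ.⊔ N ℕ.≤ n → ‖ z ‖ n Q.≤ A Q.+ B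
        bnd n ≤n = Q.≤-trans (Q.≤-reflexive (‖‖-def z n)) (Q.+-mono-≤
          (cauchy⇒bounded (reₙ z) h n (ℕ.m⊔n≤o⇒m≤o M N ≤n)) (cauchy⇒bounded (imₙ z) k n (ℕ.m⊔n≤o⇒n≤o M N ≤n)))

  0<½* : ∀ {ε} → 0ℚ Q.< ε → 0ℚ Q.< ½ Q.* ε
  0<½* = Q.*-pos Q.0<½

  ½+½ : ∀ ε → ½ Q.* ε Q.+ ½ Q.* ε ≡ ε
  ½+½ ε = trans (sym (Q.*-distribʳ-+ ε ½ ½)) (trans (cong (Q._* ε) Q.½+½≡1) (Q.*-identityˡ ε))

  ½*< : ∀ {ε} → 0ℚ Q.< ε → ½ Q.* ε Q.< ε
  ½*< {ε} 0<ε = <-gap (0<½* 0<ε) (½+½ ε)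

  difference-self : ∀ {z w} → z ≐ w → z - w ≐ 0ℂ
  difference-self {z} {w} z≐w = ≐-trans (+-cong≐ z≐w ≐-refl) (-‿inverseʳ≐ w)

  module ≐-id = Identities ℂ≐-ring

  ≐⇒≈ : ∀ {z w} → z ≐ w → z ≈ w
  ≐⇒≈ z≐w = mk≈ λ {ε} 0<ε → mk≺ 0 λ n _ →
    subst (Q._≤ ε) (sym (trans (‖‖-cong (difference-self z≐w) n) (‖0‖ n))) (Q.<⇒≤ 0<ε)

  ≈-intro : ∀ c {z w} → (∀ {ε} → 0ℚ Q.< ε → (z - w) ≺ c Q.* ε) → z ≈ w
  ≈-intro c h = mk≈ λ 0<ε → let δ , 0<δ , cδ≤ε = shrink c 0<ε in ≺-mono cδ≤ε (h 0<δ)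

  2ℚ : ℚ
  2ℚ = 1ℚ Q.+ 1ℚ

  ≈-sym : ∀ {z w} → z ≈ w → w ≈ z
  ≈-sym {z} {w} p = mk≈ λ 0<ε → ≺-resp (≐-id.neg-difference z w) (≺-neg (close p 0<ε))

  ≈-trans : ∀ {u v w} → u ≈ v → v ≈ w → u ≈ w
  ≈-trans {u} {v} {w} p q = ≈-intro 2ℚ λ {ε} 0<ε →
    ≺-resp (≐-id.difference-trans u v w) (subst ((u - v) + (v - w) ≺_) (ℚ-id.double ε) (≺-+ (close p 0<ε) (close q 0<ε)))

  +-cong≈ : ∀ {z z′ w w′} → z ≈ z′ → w ≈ w′ → z + w ≈ z′ + w′
  +-cong≈ {z} {z′} {w} {w′} p q = ≈-intro 2ℚ λ {ε} 0<ε →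
    ≺-resp (≐-id.+-difference z w z′ w′) (subst ((z - z′) + (w - w′) ≺_) (ℚ-id.double ε) (≺-+ (close p 0<ε) (close q 0<ε)))

  -‿cong≈ : ∀ {z z′} → z ≈ z′ → - z ≈ - z′
  -‿cong≈ {z} {z′} p = mk≈ λ 0<ε → ≺-resp (≐-id.neg-neg-difference z z′) (≺-neg (close p 0<ε))

  *-cong≈ : ∀ {z z′ w w′} → z ≈ z′ → w ≈ w′ → z * w ≈ z′ * w′
  *-cong≈ {z} {z′} {w} {w′} p q = combine (≺-bound z) (≺-bound w′)
    where
    combine : ∃[ A ] z ≺ A → ∃[ B ] w′ ≺ B → z * w ≈ z′ * w′
    combine (A , z≺A) (B , w′≺B) = ≈-intro (A Q.+ B) λ {ε} 0<ε →
      ≺-resp (≐-id.*-difference z z′ w w′)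
        (subst (z * (w - w′) + w′ * (z - z′) ≺_) (sym (Q.*-distribʳ-+ ε A B))
          (≺-+ (≺-* z≺A (close q 0<ε)) (≺-* w′≺B (close p 0<ε))))

  ℂ-ring : CommutativeRing 0ℓ 0ℓ
  ℂ-ring = RingLaws.commutativeRing _≈_
    (record { refl = ≐⇒≈ ≐-refl ; sym = ≈-sym ; trans = ≈-trans }) ≐⇒≈ +-cong≈ -‿cong≈ *-cong≈

  module ≈-id = Identities ℂ-ring

  ∣re∣≤‖‖ : ∀ z n → Q.∣ reₙ z n ∣ Q.≤ ‖ z ‖ n
  ∣re∣≤‖‖ z n = ≤-gap Q.∣ imₙ z n ∣ (Q.0≤∣p∣ (imₙ z n)) (sym (‖‖-def z n))

  ∣im∣≤‖‖ : ∀ z n → Q.∣ imₙ z n ∣ Q.≤ ‖ z ‖ n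
  ∣im∣≤‖‖ z n = ≤-gap Q.∣ reₙ z n ∣ (Q.0≤∣p∣ (reₙ z n))
    (trans (Q.+-comm Q.∣ imₙ z n ∣ Q.∣ reₙ z n ∣) (sym (‖‖-def z n)))

  opaque
    unfolding C._+_ Q._+_

    ≃⇒≈ : ∀ {z w} → z ≃ w → z ≈ w
    ≃⇒≈ {z} {w} (p , q) = mk≈ λ {ε} 0<ε →
      let M , h = p (0<½* 0<ε)
          N , k = q (0<½* 0<ε)
      in mk≺ (M ℕ.⊔ N) λ n ≤n → subst₂ Q._≤_ (sym (‖‖-def (z - w) n)) (½+½ ε) (Q.+-mono-≤
           (Q.<⇒≤ (h n (ℕ.m⊔n≤o⇒m≤o M N ≤n))) (Q.<⇒≤ (k n (ℕ.m⊔n≤o⇒n≤o M N ≤n))))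

    ≈⇒≃ : ∀ {z w} → z ≈ w → z ≃ w
    ≈⇒≃ {z} {w} p =
        (λ 0<ε → let mk≺ N h = close p (0<½* 0<ε) in
          N , λ n N≤n → Q.≤-<-trans (Q.≤-trans (∣re∣≤‖‖ (z - w) n) (h n N≤n)) (½*< 0<ε))
      , (λ 0<ε → let mk≺ N h = close p (0<½* 0<ε) in
          N , λ n N≤n → Q.≤-<-trans (Q.≤-trans (∣im∣≤‖‖ (z - w) n) (h n N≤n)) (½*< 0<ε))

  -- Complex conjugation

  conj-+ : ∀ z w → conj (z + w) ≐ conj z + conj w
  conj-+ z w = mk≐ re≗ im≗
    where
    re≗ : ∀ n → reₙ (conj (z + w)) n ≡ reₙ (conj z + conj w) n
    re≗ n rewrite re-+ (conj z) (conj w) n | re-conj (z + w) n | re-conj z n | re-conj w n = re-+ z w n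
    im≗ : ∀ n → imₙ (conj (z + w)) n ≡ imₙ (conj z + conj w) n
    im≗ n rewrite im-+ (conj z) (conj w) n | im-conj (z + w) n | im-conj z n | im-conj w n | im-+ z w n =
      ℚ-id.neg-+ (imₙ z n) (imₙ w n)

  conj-neg : ∀ z → conj (- z) ≐ - conj z
  conj-neg z = mk≐ re≗ im≗
    where
    re≗ : ∀ n → reₙ (conj (- z)) n ≡ reₙ (- conj z) n
    re≗ n rewrite re-neg (conj z) n | re-conj (- z) n | re-conj z n = re-neg z n
    im≗ : ∀ n → imₙ (conj (- z)) n ≡ imₙ (- conj z) n
    im≗ n rewrite im-neg (conj z) n | im-conj (- z) n | im-conj z n = cong Q.-_ (im-neg z n)

  conj-- : ∀ z w → conj (z - w) ≐ conj z - conj w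
  conj-- z w = ≐-trans (conj-+ z (- w)) (+-cong≐ ≐-refl (conj-neg w))

  conj-* : ∀ z w → conj (z * w) ≐ conj z * conj w
  conj-* z w = mk≐ re≗ im≗
    where
    re≗ : ∀ n → reₙ (conj (z * w)) n ≡ reₙ (conj z * conj w) n
    re≗ n rewrite re-conj (z * w) n | re-* (conj z) (conj w) n | re-conj z n | re-conj w n
      | im-conj z n | im-conj w n | re-* z w n =
      cong (λ p → reₙ z n Q.* reₙ w n Q.+ Q.- p) (sym (ℚ-id.neg-*-neg (imₙ z n) (imₙ w n)))
    im≗ : ∀ n → imₙ (conj (z * w)) n ≡ imₙ (conj z * conj w) n
    im≗ n rewrite im-conj (z * w) n | im-* (conj z) (conj w) n | re-conj z n | re-conj w n
      | im-conj z n | im-conj w n | im-* z w n =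
      ℚ-id.conj-im (reₙ z n) (imₙ z n) (reₙ w n) (imₙ w n)

  conj-ℚ : ∀ p → conj (ℚ→ℂ p) ≐ ℚ→ℂ p
  conj-ℚ p = mk≐ (re-conj (ℚ→ℂ p)) λ n → trans (im-conj (ℚ→ℂ p) n)
    (trans (cong Q.-_ (im-ℚ p n)) (trans ℚ-id.neg-0 (sym (im-ℚ p n))))

  ‖conj‖ : ∀ z n → ‖ conj z ‖ n ≡ ‖ z ‖ n
  ‖conj‖ z n = trans (‖‖-def (conj z) n) (trans (cong₂ (λ x y → Q.∣ x ∣ Q.+ y) (re-conj z n)
    (trans (cong Q.∣_∣ (im-conj z n)) (Q.∣-p∣≡∣p∣ (imₙ z n)))) (sym (‖‖-def z n)))

  ≺-conj : ∀ {z r} → z ≺ r → conj z ≺ r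
  ≺-conj {z} {r} (mk≺ N h) = mk≺ N λ n N≤n → subst (Q._≤ r) (sym (‖conj‖ z n)) (h n N≤n)

  open CommutativeRing ℂ-ring using (*-assoc; *-comm; *-cong; *-congʳ; *-congˡ; *-identityʳ; *-identityˡ; +-cong; +-congʳ; +-congˡ; +-identityʳ; -‿cong; -‿inverseʳ; setoid; zeroʳ; zeroˡ)
    renaming (refl to ≈-refl)

  open import Algebra.Properties.Semiring.Exp (CommutativeRing.semiring ℂ-ring) public using (_^_; ^-congˡ; ^-assocʳ)
  open import Algebra.Properties.Semiring.Exp Q.semiring public using () renaming (_^_ to _^ℚ_; ^-homo-* to ^ℚ-homo-*)
  open import Algebra.Properties.CommutativeSemiring.Exp Q.commutativeSemiring public using () renaming (^-distrib-* to ^ℚ-distrib-*)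

  module ℂSum = ListSum ℂ-ring
  module ≐Sum = ListSum ℂ≐-ring

  open ℂSum using (Sum)

  ≺-triangle : ∀ {u v w r s} → (u - v) ≺ r → (v - w) ≺ s → (u - w) ≺ r Q.+ s
  ≺-triangle {u} {v} {w} p q = ≺-resp (≐-id.difference-trans u v w) (≺-+ p q)

  ≺-swap : ∀ {z w r} → (z - w) ≺ r → (w - z) ≺ r
  ≺-swap {z} {w} p = ≺-resp (≐-id.neg-difference z w) (≺-neg p)

  ‖‖-triangle : ∀ u v w n → ‖ u - w ‖ n Q.≤ ‖ u - v ‖ n Q.+ ‖ v - w ‖ n
  ‖‖-triangle u v w n = Q.≤-trans
    (Q.≤-reflexive (sym (‖‖-cong (≐-id.difference-trans u v w) n))) (‖+‖ (u - v) (v - w) n)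

  ‖‖-swap : ∀ z w n → ‖ z - w ‖ n ≡ ‖ w - z ‖ n
  ‖‖-swap z w n = trans (sym (‖-‖ (z - w) n)) (‖‖-cong (≐-id.neg-difference z w) n)

  3ℚ : ℚ
  3ℚ = (1ℚ Q.+ 1ℚ) Q.+ 1ℚ

  -- Unordered convergence

  -- `HasSum` with the ℓ¹ bound `_≺_` in place of the strict bound on the modulus;
  -- `hasSum⇒converges` and `converges⇒hasSum` show the two to be equivalent.
  record Converges {I : Set} (f : I → ℂ) (s : ℂ) : Set where
    constructor mkConverges
    field
      eventually : ∀ {ε} → 0ℚ Q.< ε → ∃[ F₀ ] ∀ F → Unique F → F₀ ⊆ F → (Sum f F - s) ≺ ε

  open Converges

  converges-intro : ∀ c {I : Set} {f : I → ℂ} {s} →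
    (∀ {ε} → 0ℚ Q.< ε → ∃[ F₀ ] ∀ F → Unique F → F₀ ⊆ F → (Sum f F - s) ≺ c Q.* ε) → Converges f s
  converges-intro c {I} {f} {s} h = mkConverges λ 0<ε → go (shrink c 0<ε)
    where
    go : ∀ {ε} → ∃[ δ ] (0ℚ Q.< δ) × (c Q.* δ Q.≤ ε) →
      ∃[ F₀ ] ∀ F → Unique F → F₀ ⊆ F → (Sum f F - s) ≺ ε
    go (δ , 0<δ , cδ≤ε) = proj₁ (h 0<δ) , λ F uF F₀⊆F → ≺-mono cδ≤ε (proj₂ (h 0<δ) F uF F₀⊆F)

  -- Two limits agree as soon as arbitrarily large finite sets on the two sides have equal sums. The
  -- index sets may differ, which is what the comparison of a double series with a single one
  -- requires.
  converges-compare : {I J : Set} {f : I → ℂ} {g : J → ℂ} {s t : ℂ} →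
    Converges f s → Converges g t →
    (∀ F₀ G₀ → ∃[ F ] ∃[ G ] Unique F × Unique G × (F₀ ⊆ F) × (G₀ ⊆ G) × (Sum f F ≈ Sum g G)) →
    s ≈ t
  converges-compare {I} {J} {f} {g} {s} {t} cf cg common = ≈-intro 3ℚ λ 0<ε → go 0<ε (eventually cf 0<ε) (eventually cg 0<ε)
    where
    go : ∀ {ε} → 0ℚ Q.< ε →
      ∃[ F₀ ] (∀ F → Unique F → F₀ ⊆ F → (Sum f F - s) ≺ ε) →
      ∃[ G₀ ] (∀ G → Unique G → G₀ ⊆ G → (Sum g G - t) ≺ ε) → (s - t) ≺ 3ℚ Q.* ε
    go {ε} 0<ε (F₀ , hf) (G₀ , hg) with common F₀ G₀
    ... | F , G , uF , uG , F₀⊆F , G₀⊆G , eq = subst ((s - t) ≺_) (ℚ-id.triple ε)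
      (≺-triangle (≺-triangle (≺-swap (hf F uF F₀⊆F)) (_≈_.close eq 0<ε)) (hg G uG G₀⊆G))

  converges-unique : {I : Set} → DecidableEquality I → {f : I → ℂ} {s t : ℂ} →
    Converges f s → Converges f t → s ≈ t
  converges-unique _≟_ cs ct = converges-compare cs ct λ F₀ G₀ →
    nub (F₀ ++ G₀) , nub (F₀ ++ G₀) , nub-unique (F₀ ++ G₀) , nub-unique (F₀ ++ G₀) ,
    (λ ∈F₀ → nub⁺ (∈-++⁺ˡ ∈F₀)) , (λ ∈G₀ → nub⁺ (∈-++⁺ʳ F₀ ∈G₀)) , ≈-refl
    where open Finite _≟_

  converges-cong : {I : Set} {f g : I → ℂ} {s t : ℂ} →
    (∀ i → f i ≈ g i) → s ≈ t → Converges f s → Converges g t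
  converges-cong {I} {f} {g} {s} {t} f≈g s≈t cf = converges-intro 3ℚ λ 0<ε → go 0<ε (eventually cf 0<ε)
    where
    go : ∀ {ε} → 0ℚ Q.< ε → ∃[ F₀ ] (∀ F → Unique F → F₀ ⊆ F → (Sum f F - s) ≺ ε) →
      ∃[ F₀ ] (∀ F → Unique F → F₀ ⊆ F → (Sum g F - t) ≺ 3ℚ Q.* ε)
    go {ε} 0<ε (F₀ , h) = F₀ , λ F uF F₀⊆F → subst ((Sum g F - t) ≺_) (ℚ-id.triple ε)
      (≺-triangle (≺-triangle (≺-swap (_≈_.close (ℂSum.Sum-cong f≈g F) 0<ε)) (h F uF F₀⊆F)) (_≈_.close s≈t 0<ε))

  converges-+ : {I : Set} {f g : I → ℂ} {s t : ℂ} →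
    Converges f s → Converges g t → Converges (λ i → f i + g i) (s + t)
  converges-+ {I} {f} {g} {s} {t} cf cg = converges-intro 2ℚ λ 0<ε → go (eventually cf 0<ε) (eventually cg 0<ε)
    where
    go : ∀ {ε} → ∃[ F₀ ] (∀ F → Unique F → F₀ ⊆ F → (Sum f F - s) ≺ ε) →
      ∃[ G₀ ] (∀ G → Unique G → G₀ ⊆ G → (Sum g G - t) ≺ ε) →
      ∃[ F₀ ] (∀ F → Unique F → F₀ ⊆ F → (Sum (λ i → f i + g i) F - (s + t)) ≺ 2ℚ Q.* ε)
    go {ε} (F₀ , hf) (G₀ , hg) = F₀ ++ G₀ , λ F uF ⊆F →
      ≺-resp (≐-trans (≐-id.+-difference (Sum f F) (Sum g F) s t)
                      (+-cong≐ (≐-sym (≐Sum.Sum-+ f g F)) ≐-refl))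
        (subst (((Sum f F - s) + (Sum g F - t)) ≺_) (ℚ-id.double ε)
          (≺-+ (hf F uF (λ ∈F₀ → ⊆F (∈-++⁺ˡ ∈F₀))) (hg F uF (λ ∈G₀ → ⊆F (∈-++⁺ʳ F₀ ∈G₀)))))

  converges-*ˡ : {I : Set} (c : ℂ) {f : I → ℂ} {s : ℂ} →
    Converges f s → Converges (λ i → c * f i) (c * s)
  converges-*ˡ c {f} {s} cf = go (≺-bound c)
    where
    go : ∃[ B ] c ≺ B → Converges (λ i → c * f i) (c * s)
    go (B , c≺B) = converges-intro B λ 0<ε → proj₁ (eventually cf 0<ε) , λ F uF F₀⊆F →
      ≺-resp (≐-trans (≐-ring.x[y-z]≈xy-xz c (Sum f F) s) (+-cong≐ (≐Sum.Sum-*ˡ c f F) ≐-refl))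
        (≺-* c≺B (proj₂ (eventually cf 0<ε) F uF F₀⊆F))
      where module ≐-ring = RingProperties (CommutativeRing.ring ℂ≐-ring)

  converges-conj : {I : Set} {f : I → ℂ} {s : ℂ} → Converges f s → Converges (λ i → conj (f i)) (conj s)
  converges-conj {f = f} {s} cf = mkConverges λ 0<ε → proj₁ (eventually cf 0<ε) , λ F uF F₀⊆F →
    ≺-resp (≐-trans (conj-- (Sum f F) s) (+-cong≐ (conj-Sum f F) ≐-refl)) (≺-conj (proj₂ (eventually cf 0<ε) F uF F₀⊆F))
    where
    conj-Sum : ∀ {I : Set} (f : I → ℂ) F → conj (Sum f F) ≐ Sum (λ i → conj (f i)) F
    conj-Sum f []      = conj-ℚ 0ℚ
    conj-Sum f (i ∷ F) = ≐-trans (conj-+ (f i) (Sum f F)) (+-cong≐ ≐-refl (conj-Sum f F))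

  module _ where
    open SemiringMult (CommutativeRing.semiring ℂ-ring) using (×-homo-+; ×1-homo-*) renaming (_×_ to _·_)

    opaque
      ι : ℕ → ℂ
      ι n = n · 1ℂ

      ι0 : ι 0 ≈ 0ℂ
      ι0 = ≈-refl

      ι1 : ι 1 ≈ 1ℂ
      ι1 = ≈-refl

      ι-+ : ∀ m n → ι (m ℕ.+ n) ≈ ι m + ι n
      ι-+ = ×-homo-+ 1ℂ

      ι-* : ∀ m n → ι (m ℕ.* n) ≈ ι m * ι n
      ι-* = ×1-homo-*

  ≡⇒≈ : ∀ {z w} → z ≡ w → z ≈ w
  ≡⇒≈ refl = ≈-refl

  -- A sum over `J` is rewritten as a sum over `I` of `f` times the indicator of the image. Sums
  -- over different subsets of `I` then have a common index set, and a partition of a subset becomes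
  -- a pointwise equation between indicators.
  module Pushforward {J I : Set} (e : Embedding J I) (f : I → ℂ) where
    open Embedding e

    extended : I → ℂ
    extended i = ι (indicator i) * f i

    Inside : I → Set
    Inside i = indicator i ≡ 1

    inside? : ∀ i → Dec (Inside i)
    inside? i = indicator i ℕ.≟ 1

    to-from-map : ∀ G → All Inside G → map to (map from G) ≡ G
    to-from-map []      []         = refl
    to-from-map (i ∷ G) (1≡ ∷ all) = cong₂ _∷_ (head (image i)) (to-from-map G all)
      where
      head : (indicator i ≡ 0) ⊎ (Inside i × (to (from i) ≡ i)) → to (from i) ≡ i
      head (inj₁ 0≡)       = contradiction (trans (sym 0≡) 1≡) λ ()
      head (inj₂ (_ , eq)) = eq

    inside : List I → List I
    inside = filter inside?

    pullback : List I → List J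
    pullback F = map from (inside F)

    to-pullback : ∀ F → map to (pullback F) ≡ inside F
    to-pullback F = to-from-map (inside F) (All.tabulate (all F))
      where
      all : ∀ F {i} → i ∈ inside F → Inside i
      all F i∈ = proj₂ (∈-filter⁻ inside? {xs = F} i∈)

    pullback-unique : ∀ F → Unique F → Unique (pullback F)
    pullback-unique F uF = AllPairs.map (λ ≢ eq → ≢ (cong to eq))
      (AllPairs.map⁻ (subst Unique (sym (to-pullback F)) (Unique.filter⁺ inside? uF)))

    pullback⁺ : ∀ {G F} → map to G ⊆ F → G ⊆ pullback F
    pullback⁺ {G} {F} ⊆F {j} j∈ = subst (_∈ pullback F) (from-to j)
      (∈-map⁺ from (∈-filter⁺ inside? (⊆F (∈-map⁺ to j∈)) (ind-to j)))

    extended-outside : ∀ i → ¬ Inside i → extended i ≈ 0ℂ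
    extended-outside i ≢1 = go (image i)
      where
      go : (indicator i ≡ 0) ⊎ (Inside i × (to (from i) ≡ i)) → extended i ≈ 0ℂ
      go (inj₁ 0≡)       = ≈-trans (*-cong≈ (≈-trans (≡⇒≈ (cong ι 0≡)) ι0) ≈-refl) (zeroˡ (f i))
      go (inj₂ (1≡ , _)) = contradiction 1≡ ≢1

    extended-to : ∀ j → extended (to j) ≈ f (to j)
    extended-to j = ≈-trans (*-cong≈ (≈-trans (≡⇒≈ (cong ι (ind-to j))) ι1) ≈-refl) (*-identityˡ (f (to j)))

    Sum-extended : ∀ F → Sum extended F ≈ Sum (λ j → f (to j)) (pullback F)
    Sum-extended F = begin
      Sum extended F                          ≈⟨ ℂSum.Sum-filter inside? extended extended-outside F ⟨
      Sum extended (inside F)                 ≡⟨ cong (Sum extended) (to-pullback F) ⟨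
      Sum extended (map to (pullback F))      ≡⟨ ℂSum.Sum-map extended to (pullback F) ⟩
      Sum (λ j → extended (to j)) (pullback F) ≈⟨ ℂSum.Sum-cong extended-to (pullback F) ⟩
      Sum (λ j → f (to j)) (pullback F)       ∎
      where open SetoidReasoning setoid

    converges : ∀ {s} → Converges (λ j → f (to j)) s → Converges extended s
    converges {s} cf = converges-intro 2ℚ λ 0<ε → go 0<ε (eventually cf 0<ε)
      where
      go : ∀ {ε} → 0ℚ Q.< ε → ∃[ G₀ ] (∀ G → Unique G → G₀ ⊆ G → (Sum (λ j → f (to j)) G - s) ≺ ε) →
        ∃[ F₀ ] (∀ F → Unique F → F₀ ⊆ F → (Sum extended F - s) ≺ 2ℚ Q.* ε)
      go {ε} 0<ε (G₀ , h) = map to G₀ , λ F uF ⊆F → subst ((Sum extended F - s) ≺_) (ℚ-id.double ε)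
        (≺-triangle (_≈_.close (Sum-extended F) 0<ε) (h (pullback F) (pullback-unique F uF) (pullback⁺ ⊆F)))

  bijection-embedding : {J I : Set} (to : J → I) (from : I → J) →
    (∀ j → from (to j) ≡ j) → (∀ i → to (from i) ≡ i) → Embedding J I
  bijection-embedding to from from-to to-from = record
    { to = to ; from = from ; indicator = λ _ → 1 ; from-to = from-to
    ; ind-to = λ _ → refl ; image = λ i → inj₂ (refl , to-from i) }

  converges-reindex : {J I : Set} (to : J → I) (from : I → J) →
    (∀ j → from (to j) ≡ j) → (∀ i → to (from i) ≡ i) →
    (f : I → ℂ) {s : ℂ} → Converges (λ j → f (to j)) s → Converges f s
  converges-reindex to from from-to to-from f cf = converges-cong
    (λ i → ≈-trans (*-cong≈ ι1 ≈-refl) (*-identityˡ (f i))) ≈-refl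
    (Pushforward.converges (bijection-embedding to from from-to to-from) f cf)

  -- Summable weights

  -- Cauchy's criterion for unordered sums: finite sets that avoid `F₀` contribute little. No value
  -- of the sum is mentioned, so the notion passes easily to smaller weights, to products and along
  -- injections.
  record SummableWeight {I : Set} (w : I → ℚ) : Set where
    field
      nonneg : ∀ i → 0ℚ Q.≤ w i
      tail   : ∀ {ε} → 0ℚ Q.< ε → ∃[ F₀ ] ∀ F → Unique F → (∀ {i} → i ∈ F → i ∉ F₀) → sumℚ w F Q.≤ ε

  open SummableWeight

  module _ {I : Set} (_≟_ : DecidableEquality I) {w : I → ℚ} (sw : SummableWeight w) where
    open Finite _≟_

    total-bound : ∃[ B ] (0ℚ Q.≤ B) × (∀ F → Unique F → sumℚ w F Q.≤ B)
    total-bound = go (tail sw Q.0<1)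
      where
      go : ∃[ F₀ ] (∀ F → Unique F → (∀ {i} → i ∈ F → i ∉ F₀) → sumℚ w F Q.≤ 1ℚ) →
        ∃[ B ] (0ℚ Q.≤ B) × (∀ F → Unique F → sumℚ w F Q.≤ B)
      go (F₀ , h) = sumℚ w F₀ Q.+ 1ℚ , +-nonneg (sumℚ-nonneg (nonneg sw) F₀) (Q.<⇒≤ Q.0<1) , λ F uF →
        Q.≤-trans (sumℚ-⊆ _≟_ (nonneg sw) {F} {F₀ ++ (F ∖ F₀)} uF (cover F))
          (Q.≤-trans (Q.≤-reflexive (ℚSum.Sum-++ w F₀ (F ∖ F₀)))
            (Q.+-monoʳ-≤ (sumℚ w F₀) (h (F ∖ F₀) (∖-unique F₀ uF) (λ i∈ → proj₂ (∖⁻ F F₀ i∈)))))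
        where
        cover : ∀ F → F ⊆ F₀ ++ (F ∖ F₀)
        cover F {i} i∈F = [ ∈-++⁺ˡ , ∈-++⁺ʳ F₀ ]′ (∖⁺ F F₀ i∈F)

  weight-reindex : {I J : Set} {w : I → ℚ} (to : J → I) (from : I → J) → (∀ j → from (to j) ≡ j) →
    SummableWeight w → SummableWeight (λ j → w (to j))
  weight-reindex {I} {J} {w} to from from-to sw = record
    { nonneg = λ j → nonneg sw (to j) ; tail = λ 0<ε → go (tail sw 0<ε) }
    where
    go : ∀ {ε} → ∃[ F₀ ] (∀ F → Unique F → (∀ {i} → i ∈ F → i ∉ F₀) → sumℚ w F Q.≤ ε) →
      ∃[ G₀ ] (∀ G → Unique G → (∀ {j} → j ∈ G → j ∉ G₀) → sumℚ (λ j → w (to j)) G Q.≤ ε)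
    go {ε} (F₀ , h) = map from F₀ , λ G uG disjoint → subst (Q._≤ ε) (ℚSum.Sum-map w to G)
      (h (map to G) (Unique.map⁺ (λ {j} {j′} eq → trans (sym (from-to j)) (trans (cong from eq) (from-to j′))) uG)
        λ i∈ → outside G disjoint (∈-map⁻ to i∈))
      where
      outside : ∀ G → (∀ {j} → j ∈ G → j ∉ map from F₀) → ∀ {i} → ∃[ j ] j ∈ G × (i ≡ to j) → i ∉ F₀
      outside G disjoint (j , j∈G , refl) i∈F₀ =
        disjoint j∈G (subst (_∈ map from F₀) (from-to j) (∈-map⁺ from i∈F₀))

  weight-* : {I : Set} {w : I → ℚ} (c : ℚ) → 0ℚ Q.≤ c → SummableWeight w → SummableWeight (λ i → c Q.* w i)
  weight-* {I} {w} c 0≤c sw = record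
    { nonneg = λ i → *-nonneg 0≤c (nonneg sw i) ; tail = λ 0<ε → go (shrink c 0<ε) }
    where
    go : ∀ {ε} → ∃[ δ ] (0ℚ Q.< δ) × (c Q.* δ Q.≤ ε) →
      ∃[ F₀ ] (∀ F → Unique F → (∀ {i} → i ∈ F → i ∉ F₀) → sumℚ (λ i → c Q.* w i) F Q.≤ ε)
    go (δ , 0<δ , cδ≤ε) = proj₁ (tail sw 0<δ) , λ F uF disjoint →
      Q.≤-trans (Q.≤-reflexive (sym (ℚSum.Sum-*ˡ c w F)))
        (Q.≤-trans (Q.*-monoˡ 0≤c (proj₂ (tail sw 0<δ) F uF disjoint)) cδ≤ε)

  -- The part of a rectangle F × G outside F₀ × G₀ is covered by two strips, in each of which one
  -- factor runs over a tail while the other factor has bounded sum.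
  weight-⊗ : {I J : Set} → DecidableEquality I → DecidableEquality J → {v : I → ℚ} {w : J → ℚ} →
    SummableWeight v → SummableWeight w → SummableWeight (λ ((i , j) : I × J) → v i Q.* w j)
  weight-⊗ {I} {J} _≟ᴵ_ _≟ᴶ_ {v} {w} sv sw = record
    { nonneg = λ (i , j) → *-nonneg (nonneg sv i) (nonneg sw j)
    ; tail   = λ 0<ε → go (total-bound _≟ᴵ_ sv) (total-bound _≟ᴶ_ sw) 0<ε }
    where
    module I = Finite _≟ᴵ_
    module J = Finite _≟ᴶ_
    v⊗w : I × J → ℚ
    v⊗w (i , j) = v i Q.* w j

    product-bound : ∀ {A B δ} → 0ℚ Q.≤ A → 0ℚ Q.≤ B → (∀ F → Unique F → sumℚ v F Q.≤ A) → (∀ G → Unique G → sumℚ w G Q.≤ B) →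
      ∀ F₀ → (∀ F → Unique F → (∀ {i} → i ∈ F → i ∉ F₀) → sumℚ v F Q.≤ δ) →
      ∀ G₀ → (∀ G → Unique G → (∀ {j} → j ∈ G → j ∉ G₀) → sumℚ w G Q.≤ δ) →
      ∀ H → Unique H → (∀ {k} → k ∈ H → k ∉ cartesianProduct F₀ G₀) → sumℚ v⊗w H Q.≤ (B Q.+ A) Q.* δ
    product-bound {A} {B} {δ} 0≤A 0≤B v≤A w≤B F₀ hF G₀ hG H uH disjoint = begin
      sumℚ v⊗w H
        ≤⟨ sumℚ-⊆ (≡-dec _≟ᴵ_ _≟ᴶ_) (λ (i , j) → *-nonneg (nonneg sv i) (nonneg sw j)) uH cover ⟩
      sumℚ v⊗w (cartesianProduct (F I.∖ F₀) G ++ cartesianProduct F (G J.∖ G₀))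
        ≡⟨ ℚSum.Sum-++ v⊗w (cartesianProduct (F I.∖ F₀) G) _ ⟩
      sumℚ v⊗w (cartesianProduct (F I.∖ F₀) G) Q.+ sumℚ v⊗w (cartesianProduct F (G J.∖ G₀))
        ≡⟨ cong₂ Q._+_ (ℚSum.Sum-product v w (F I.∖ F₀) G) (ℚSum.Sum-product v w F (G J.∖ G₀)) ⟨
      sumℚ v (F I.∖ F₀) Q.* sumℚ w G Q.+ sumℚ v F Q.* sumℚ w (G J.∖ G₀)
        ≤⟨ Q.+-mono-≤
             (*-mono (sumℚ-nonneg (nonneg sv) (F I.∖ F₀)) 0≤B
               (hF _ (I.∖-unique F₀ uF) (λ i∈ → proj₂ (I.∖⁻ F F₀ i∈))) (w≤B G uG))
             (*-mono (sumℚ-nonneg (nonneg sv) F) (Q.≤-trans (sumℚ-nonneg (nonneg sw) (G J.∖ G₀)) hG′) (v≤A F uF) hG′) ⟩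
      δ Q.* B Q.+ A Q.* δ
        ≡⟨ cong (Q._+ A Q.* δ) (Q.*-comm δ B) ⟩
      B Q.* δ Q.+ A Q.* δ
        ≡⟨ Q.*-distribʳ-+ δ B A ⟨
      (B Q.+ A) Q.* δ ∎
      where
      open Q.≤-Reasoning
      F : List I
      F = I.nub (map proj₁ H)
      G : List J
      G = J.nub (map proj₂ H)
      uF : Unique F
      uF = I.nub-unique (map proj₁ H)
      uG : Unique G
      uG = J.nub-unique (map proj₂ H)
      hG′ : sumℚ w (G J.∖ G₀) Q.≤ δ
      hG′ = hG _ (J.∖-unique G₀ uG) (λ j∈ → proj₂ (J.∖⁻ G G₀ j∈))
      cover : H ⊆ cartesianProduct (F I.∖ F₀) G ++ cartesianProduct F (G J.∖ G₀)
      cover {i , j} k∈H = go (I.∖⁺ F F₀ i∈F) (J.∖⁺ G G₀ j∈G)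
        where
        i∈F : i ∈ F
        i∈F = I.nub⁺ (∈-map⁺ proj₁ k∈H)
        j∈G : j ∈ G
        j∈G = J.nub⁺ (∈-map⁺ proj₂ k∈H)
        go : (i ∈ F₀) ⊎ (i ∈ F I.∖ F₀) → (j ∈ G₀) ⊎ (j ∈ G J.∖ G₀) →
          (i , j) ∈ cartesianProduct (F I.∖ F₀) G ++ cartesianProduct F (G J.∖ G₀)
        go (inj₂ i∈) _         = ∈-++⁺ˡ (∈-cartesianProduct⁺ i∈ j∈G)
        go (inj₁ i∈) (inj₂ j∈) = ∈-++⁺ʳ (cartesianProduct (F I.∖ F₀) G) (∈-cartesianProduct⁺ i∈F j∈)
        go (inj₁ i∈) (inj₁ j∈) = contradiction (∈-cartesianProduct⁺ i∈ j∈) (disjoint k∈H)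

    go : ∃[ A ] (0ℚ Q.≤ A) × (∀ F → Unique F → sumℚ v F Q.≤ A) →
      ∃[ B ] (0ℚ Q.≤ B) × (∀ G → Unique G → sumℚ w G Q.≤ B) → ∀ {ε} → 0ℚ Q.< ε →
      ∃[ H₀ ] (∀ H → Unique H → (∀ {k} → k ∈ H → k ∉ H₀) → sumℚ v⊗w H Q.≤ ε)
    go (A , 0≤A , v≤A) (B , 0≤B , w≤B) 0<ε = go′ (shrink (B Q.+ A) 0<ε)
      where
      go′ : ∀ {ε} → ∃[ δ ] (0ℚ Q.< δ) × ((B Q.+ A) Q.* δ Q.≤ ε) →
        ∃[ H₀ ] (∀ H → Unique H → (∀ {k} → k ∈ H → k ∉ H₀) → sumℚ v⊗w H Q.≤ ε)
      go′ (δ , 0<δ , ≤ε) =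
        cartesianProduct (proj₁ (tail sv 0<δ)) (proj₁ (tail sw 0<δ)) , λ H uH disjoint →
        Q.≤-trans (product-bound 0≤A 0≤B v≤A w≤B _ (proj₂ (tail sv 0<δ)) _ (proj₂ (tail sw 0<δ)) H uH disjoint) ≤ε

  -- Dominated families

  -- The `onset` is the same for all indices, whereas individual Cauchy sequences settle at
  -- unrelated stages. Tails of the series are thereby small at every approximation index beyond it
  -- at once.
  record Dominated {I : Set} (f : I → ℂ) : Set where
    field
      weight   : I → ℚ
      summable : SummableWeight weight
      onset    : ℕ
      dominates    : ∀ n → onset ℕ.≤ n → ∀ i → ‖ f i ‖ n Q.≤ weight i

  open Dominated

  ‖Sum‖ : {I : Set} {f : I → ℂ} (d : Dominated f) → ∀ n → onset d ℕ.≤ n → ∀ F → ‖ Sum f F ‖ n Q.≤ sumℚ (weight d) F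
  ‖Sum‖ d n ≤n []      = Q.≤-reflexive (‖0‖ n)
  ‖Sum‖ {f = f} d n ≤n (i ∷ F) =
    Q.≤-trans (‖+‖ (f i) (Sum f F) n) (Q.+-mono-≤ (dominates d n ≤n i) (‖Sum‖ d n ≤n F))

  dominated-reindex : {I J : Set} {f : I → ℂ} (to : J → I) (from : I → J) → (∀ j → from (to j) ≡ j) →
    Dominated f → Dominated (λ j → f (to j))
  dominated-reindex to from from-to d = record
    { weight = λ j → weight d (to j) ; summable = weight-reindex to from from-to (summable d)
    ; onset = onset d ; dominates = λ n ≤n j → dominates d n ≤n (to j) }

  dominated-⊗ : {I J : Set} → DecidableEquality I → DecidableEquality J → {f : I → ℂ} {g : J → ℂ} →
    Dominated f → Dominated g → Dominated (λ ((i , j) : I × J) → f i * g j)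
  dominated-⊗ _≟ᴵ_ _≟ᴶ_ {f} {g} df dg = record
    { weight = λ (i , j) → weight df i Q.* weight dg j
    ; summable = weight-⊗ _≟ᴵ_ _≟ᴶ_ (summable df) (summable dg)
    ; onset = onset df ℕ.⊔ onset dg
    ; dominates = λ n ≤n (i , j) → Q.≤-trans (‖*‖ (f i) (g j) n)
        (*-mono (‖‖-nonneg (f i) n) (nonneg (summable dg) j)
          (dominates df n (ℕ.m⊔n≤o⇒m≤o (onset df) (onset dg) ≤n) i)
          (dominates dg n (ℕ.m⊔n≤o⇒n≤o (onset df) (onset dg) ≤n) j)) }

  dominated-* : {I K : Set} {f : I → ℂ} {c : K → ℂ} {B : ℚ} →
    ∃[ N ] (∀ n → N ℕ.≤ n → ∀ k → ‖ c k ‖ n Q.≤ B) → (κ : I → K) → I → Dominated f → Dominated (λ i → c (κ i) * f i)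
  dominated-* {f = f} {c} {B} (N , h) κ i₀ d = record
    { weight = λ i → B Q.* weight d i
    ; summable = weight-* B 0≤B (summable d)
    ; onset = N ℕ.⊔ onset d
    ; dominates = λ n ≤n i → Q.≤-trans (‖*‖ (c (κ i)) (f i) n)
        (*-mono (‖‖-nonneg (c (κ i)) n) (nonneg (summable d) i)
          (h n (ℕ.m⊔n≤o⇒m≤o N (onset d) ≤n) (κ i)) (dominates d n (ℕ.m⊔n≤o⇒n≤o N (onset d) ≤n) i)) }
    where
    -- The index `i₀` supplies one coefficient whose norm lies below `B`.
    0≤B : 0ℚ Q.≤ B
    0≤B = Q.≤-trans (‖‖-nonneg (c (κ i₀)) N) (h N ℕ.≤-refl (κ i₀))

  module Existence {I : Set} (_≟_ : DecidableEquality I) {f : I → ℂ} (d : Dominated f) where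
    open Finite _≟_

    close-to-nub : ∀ {ε} F₀ → (∀ F → Unique F → (∀ {i} → i ∈ F → i ∉ F₀) → sumℚ (weight d) F Q.≤ ε) →
      ∀ n → onset d ℕ.≤ n → ∀ F → Unique F → F₀ ⊆ F → ‖ Sum f F - Sum f (nub F₀) ‖ n Q.≤ ε
    close-to-nub {ε} F₀ h n ≤n F uF F₀⊆F = Q.≤-trans (Q.≤-reflexive (‖‖-cong difference n))
      (Q.≤-trans (‖Sum‖ d n ≤n (F ∖ nub F₀))
        (h (F ∖ nub F₀) (∖-unique (nub F₀) uF) (λ i∈ i∈F₀ → proj₂ (∖⁻ F (nub F₀) i∈) (nub⁺ i∈F₀))))
      where
      difference : Sum f F - Sum f (nub F₀) ≐ Sum f (F ∖ nub F₀)
      difference = ≐-trans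
        (+-cong≐ (≐-trans (≐Sum.Sum-↭ f (∖-↭ uF (nub-unique F₀) (λ i∈ → F₀⊆F (nub⁻ F₀ i∈))))
                          (≐Sum.Sum-++ f (nub F₀) (F ∖ nub F₀))) ≐-refl)
        (≐-id.cancel (Sum f (nub F₀)) (Sum f (F ∖ nub F₀)))

    tail-list : ℕ → List I
    tail-list k = proj₁ (tail (summable d) (recip-pos k))

    partial : ℕ → ℂ
    partial k = Sum f (nub (tail-list k))

    close-to-partial : ∀ k n → onset d ℕ.≤ n → ∀ F → Unique F → tail-list k ⊆ F → ‖ Sum f F - partial k ‖ n Q.≤ recip k
    close-to-partial k = close-to-nub (tail-list k) (proj₂ (tail (summable d) (recip-pos k)))

    partials-close : ∀ j k n → onset d ℕ.≤ n → j ℕ.≤ k → ‖ partial j - partial k ‖ n Q.≤ 2ℚ Q.* recip j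
    partials-close j k n ≤n j≤k = begin
      ‖ partial j - partial k ‖ n                               ≤⟨ ‖‖-triangle (partial j) (Sum f F) (partial k) n ⟩
      ‖ partial j - Sum f F ‖ n Q.+ ‖ Sum f F - partial k ‖ n   ≡⟨ cong (Q._+ ‖ Sum f F - partial k ‖ n) (‖‖-swap (partial j) (Sum f F) n) ⟩
      ‖ Sum f F - partial j ‖ n Q.+ ‖ Sum f F - partial k ‖ n   ≤⟨ Q.+-mono-≤ (close-to-partial j n ≤n F uF (λ i∈ → nub⁺ (∈-++⁺ˡ i∈)))
                                                                     (Q.≤-trans (close-to-partial k n ≤n F uF (λ i∈ → nub⁺ (∈-++⁺ʳ (tail-list j) i∈))) (recip-antitone j≤k)) ⟩
      recip j Q.+ recip j                                       ≡⟨ ℚ-id.double (recip j) ⟩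
      2ℚ Q.* recip j                                            ∎
      where
      open Q.≤-Reasoning
      F : List I
      F = nub (tail-list j ++ tail-list k)
      uF : Unique F
      uF = nub-unique (tail-list j ++ tail-list k)

    -- The n-th approximation to the n-th partial sum; this is Cauchy since the
    -- domination is uniform in the index of the approximation.
    diagonal-cauchy : (x : ℂ → ℕ → ℚ) → (∀ z w n → Q.∣ x z n Q.- x w n ∣ Q.≤ ‖ z - w ‖ n) →
      (∀ z → Cauchy (x z)) → Cauchy (λ n → x (partial n) n)
    -- Five copies of δ: one from the Cauchy property of the fixed `partial k`, and two for each of
    -- the two passages between `partial k` and a diagonal entry.
    diagonal-cauchy x x≤ x-cauchy 0<ε = go (shrink (2ℚ Q.+ 3ℚ) 0<ε)
      where
      go : ∀ {ε} → ∃[ δ ] (0ℚ Q.< δ) × ((2ℚ Q.+ 3ℚ) Q.* δ Q.≤ ε) →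
        ∃[ N ] ∀ m n → N ℕ.≤ m → N ℕ.≤ n → Q.∣ x (partial m) m Q.- x (partial n) n ∣ Q.< ε
      go {ε} (δ , 0<δ , 5δ≤ε) = go′ (archimedean 0<δ)
        where
        go′ : ∃[ k ] recip k Q.≤ δ →
          ∃[ N ] ∀ m n → N ℕ.≤ m → N ℕ.≤ n → Q.∣ x (partial m) m Q.- x (partial n) n ∣ Q.< ε
        go′ (k , rk≤δ) = go″ (x-cauchy (partial k) 0<δ)
          where
          go″ : ∃[ N ] (∀ m n → N ℕ.≤ m → N ℕ.≤ n → Q.∣ x (partial k) m Q.- x (partial k) n ∣ Q.< δ) →
            ∃[ N ] ∀ m n → N ℕ.≤ m → N ℕ.≤ n → Q.∣ x (partial m) m Q.- x (partial n) n ∣ Q.< ε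
          go″ (N , h) = N ℕ.⊔ (k ℕ.⊔ onset d) , λ m n ≤m ≤n → Q.<-≤-trans (Q.≤-<-trans (path-bound m n)
              (<-sum (near m (ℕ.m⊔n≤o⇒n≤o N _ ≤m)) (h m n (ℕ.m⊔n≤o⇒m≤o N _ ≤m) (ℕ.m⊔n≤o⇒m≤o N _ ≤n))
                (near n (ℕ.m⊔n≤o⇒n≤o N _ ≤n))))
              (Q.≤-trans (Q.≤-reflexive (ℚ-id.quintuple δ)) 5δ≤ε)
            where
            near : ∀ n → k ℕ.⊔ onset d ℕ.≤ n → Q.∣ x (partial k) n Q.- x (partial n) n ∣ Q.≤ 2ℚ Q.* δ
            near n ≤n = Q.≤-trans (x≤ (partial k) (partial n) n)
              (Q.≤-trans (partials-close k n n (ℕ.m⊔n≤o⇒n≤o k (onset d) ≤n) (ℕ.m⊔n≤o⇒m≤o k (onset d) ≤n))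
                (Q.*-monoˡ (+-nonneg (Q.<⇒≤ Q.0<1) (Q.<⇒≤ Q.0<1)) rk≤δ))
            path-bound : ∀ m n → Q.∣ x (partial m) m Q.- x (partial n) n ∣ Q.≤
              (Q.∣ x (partial k) m Q.- x (partial m) m ∣ Q.+ Q.∣ x (partial k) m Q.- x (partial k) n ∣) Q.+
              Q.∣ x (partial k) n Q.- x (partial n) n ∣
            path-bound m n = ∣∣-triangle (x (partial m) m) (x (partial k) m) (x (partial k) n) (x (partial n) n)
            <-sum : ∀ {a b c} → a Q.≤ 2ℚ Q.* δ → b Q.< δ → c Q.≤ 2ℚ Q.* δ →
              (a Q.+ b) Q.+ c Q.< (δ Q.+ 2ℚ Q.* δ) Q.+ 2ℚ Q.* δ
            <-sum {a} {b} a≤ b< c≤ = Q.+-mono-<-≤ (subst (Q._< δ Q.+ 2ℚ Q.* δ) (Q.+-comm b a) (Q.+-mono-<-≤ b< a≤)) c≤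

    re-diagonal : Cauchy (λ n → reₙ (partial n) n)
    re-diagonal = diagonal-cauchy reₙ
      (λ z w n → subst (λ p → Q.∣ p ∣ Q.≤ ‖ z - w ‖ n) (re-sub z w n) (∣re∣≤‖‖ (z - w) n)) re-cauchy

    im-diagonal : Cauchy (λ n → imₙ (partial n) n)
    im-diagonal = diagonal-cauchy imₙ
      (λ z w n → subst (λ p → Q.∣ p ∣ Q.≤ ‖ z - w ‖ n) (im-sub z w n) (∣im∣≤‖‖ (z - w) n)) im-cauchy

    limit : ℂ
    limit = fromSeq re-diagonal im-diagonal

    ‖-limit‖ : ∀ z n → ‖ z - limit ‖ n ≡ ‖ z - partial n ‖ n
    ‖-limit‖ z n = trans (‖‖-def (z - limit) n) (trans (cong₂ (λ p q → Q.∣ p ∣ Q.+ Q.∣ q ∣)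
      (trans (re-sub z limit n) (trans (cong (λ p → reₙ z n Q.- p) (re-fromSeq re-diagonal im-diagonal n)) (sym (re-sub z (partial n) n))))
      (trans (im-sub z limit n) (trans (cong (λ p → imₙ z n Q.- p) (im-fromSeq re-diagonal im-diagonal n)) (sym (im-sub z (partial n) n)))))
      (sym (‖‖-def (z - partial n) n)))

    converges : Converges f limit
    converges = converges-intro 3ℚ λ 0<ε → go (archimedean 0<ε)
      where
      go : ∀ {ε} → ∃[ k ] recip k Q.≤ ε → ∃[ F₀ ] (∀ F → Unique F → F₀ ⊆ F → (Sum f F - limit) ≺ 3ℚ Q.* ε)
      go {ε} (k , rk≤ε) = tail-list k , λ F uF ⊆F → mk≺ (k ℕ.⊔ onset d) λ n ≤n → begin
        ‖ Sum f F - limit ‖ n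
          ≡⟨ ‖-limit‖ (Sum f F) n ⟩
        ‖ Sum f F - partial n ‖ n
          ≤⟨ ‖‖-triangle (Sum f F) (partial k) (partial n) n ⟩
        ‖ Sum f F - partial k ‖ n Q.+ ‖ partial k - partial n ‖ n
          ≤⟨ Q.+-mono-≤ (close-to-partial k n (ℕ.m⊔n≤o⇒n≤o k (onset d) ≤n) F uF ⊆F)
               (partials-close k n n (ℕ.m⊔n≤o⇒n≤o k (onset d) ≤n) (ℕ.m⊔n≤o⇒m≤o k (onset d) ≤n)) ⟩
        recip k Q.+ 2ℚ Q.* recip k
          ≡⟨ trans (cong (λ p → recip k Q.+ p) (sym (ℚ-id.double (recip k))))
               (trans (Q.+-comm (recip k) (recip k Q.+ recip k)) (ℚ-id.triple (recip k))) ⟩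
        3ℚ Q.* recip k
          ≤⟨ Q.*-monoˡ (+-nonneg (+-nonneg (Q.<⇒≤ Q.0<1) (Q.<⇒≤ Q.0<1)) (Q.<⇒≤ Q.0<1)) rk≤ε ⟩
        3ℚ Q.* ε ∎
        where open Q.≤-Reasoning

  dominated⇒converges : {I : Set} → DecidableEquality I → {f : I → ℂ} → Dominated f → ∃[ s ] Converges f s
  dominated⇒converges _≟_ d = Existence.limit _≟_ d , Existence.converges _≟_ d

  -- The product family is dominated and thus has some sum `p`. To identify it, finite sets are
  -- enlarged to rectangles, over which the sum factors exactly into a sum of `f` and a sum of `g`.
  converges-⊗ : {I J : Set} → DecidableEquality I → DecidableEquality J → {f : I → ℂ} {g : J → ℂ} {s t : ℂ} →
    Dominated f → Dominated g → Converges f s → Converges g t →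
    Converges (λ ((i , j) : I × J) → f i * g j) (s * t)
  converges-⊗ {I} {J} _≟ᴵ_ _≟ᴶ_ {f} {g} {s} {t} df dg cf cg =
    converges-cong (λ _ → ≈-refl) p≈st (proj₂ product)
    where
    module I = Finite _≟ᴵ_
    module J = Finite _≟ᴶ_
    f⊗g : I × J → ℂ
    f⊗g (i , j) = f i * g j
    product : ∃[ p ] Converges f⊗g p
    product = dominated⇒converges (≡-dec _≟ᴵ_ _≟ᴶ_) (dominated-⊗ _≟ᴵ_ _≟ᴶ_ df dg)
    p : ℂ
    p = proj₁ product
    p≈st : p ≈ s * t
    p≈st = go (total-bound _≟ᴵ_ (summable df)) (≺-bound t)
      where
      go : ∃[ A ] (0ℚ Q.≤ A) × (∀ F → Unique F → sumℚ (weight df) F Q.≤ A) → ∃[ B ] t ≺ B → p ≈ s * t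
      -- With S and T the partial sums of `f` and `g`, S T - s t = S (T - t) + t (S - s). `A` bounds
      -- every S, `B` bounds `t`, and the summand 1 accounts for the distance from `p`.
      go (A , _ , ≤A) (B , t≺B) = ≈-intro (1ℚ Q.+ (A Q.+ B)) λ 0<ε →
        go′ (Converges.eventually (proj₂ product) 0<ε) (Converges.eventually cf 0<ε) (Converges.eventually cg 0<ε)
        where
        go′ : ∀ {ε} → ∃[ H₀ ] (∀ H → Unique H → H₀ ⊆ H → (Sum f⊗g H - p) ≺ ε) →
          ∃[ F₀ ] (∀ F → Unique F → F₀ ⊆ F → (Sum f F - s) ≺ ε) →
          ∃[ G₀ ] (∀ G → Unique G → G₀ ⊆ G → (Sum g G - t) ≺ ε) →
          (p - s * t) ≺ (1ℚ Q.+ (A Q.+ B)) Q.* ε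
        go′ {ε} (H₀ , hp) (F₀ , hs) (G₀ , ht) = subst ((p - s * t) ≺_)
          (trans (cong (λ q → q Q.+ (A Q.* ε Q.+ B Q.* ε)) (sym (Q.*-identityˡ ε)))
            (trans (cong (λ q → 1ℚ Q.* ε Q.+ q) (sym (Q.*-distribʳ-+ ε A B))) (sym (Q.*-distribʳ-+ ε 1ℚ (A Q.+ B)))))
          (≺-triangle (≺-swap (hp (cartesianProduct F G) (Unique.cartesianProduct⁺ uF uG) H₀⊆))
            (≺-resp (≐-trans (≐-id.*-difference (Sum f F) s (Sum g G) t)
                             (+-cong≐ (≐Sum.Sum-product f g F G) ≐-refl))
              (≺-+ (≺-* ΣF≺A (ht G uG (λ j∈ → J.nub⁺ (∈-++⁺ˡ j∈)))) (≺-* t≺B (hs F uF (λ i∈ → I.nub⁺ (∈-++⁺ˡ i∈)))))))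
          where
          F : List I
          F = I.nub (F₀ ++ map proj₁ H₀)
          G : List J
          G = J.nub (G₀ ++ map proj₂ H₀)
          uF : Unique F
          uF = I.nub-unique (F₀ ++ map proj₁ H₀)
          uG : Unique G
          uG = J.nub-unique (G₀ ++ map proj₂ H₀)
          H₀⊆ : H₀ ⊆ cartesianProduct F G
          H₀⊆ {i , j} k∈ = ∈-cartesianProduct⁺
            (I.nub⁺ (∈-++⁺ʳ F₀ (∈-map⁺ proj₁ k∈))) (J.nub⁺ (∈-++⁺ʳ G₀ (∈-map⁺ proj₂ k∈)))
          ΣF≺A : Sum f F ≺ A
          ΣF≺A = mk≺ (onset df) λ n ≤n → Q.≤-trans (‖Sum‖ df n ≤n F) (≤A F uF)

  -- Geometric weights

  ^ℚ-nonneg : ∀ {τ} → 0ℚ Q.≤ τ → ∀ n → 0ℚ Q.≤ τ ^ℚ n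
  ^ℚ-nonneg 0≤τ zero    = Q.<⇒≤ Q.0<1
  ^ℚ-nonneg 0≤τ (suc n) = *-nonneg 0≤τ (^ℚ-nonneg 0≤τ n)

  ^ℚ-antitone : ∀ {τ} → 0ℚ Q.≤ τ → τ Q.≤ 1ℚ → ∀ {m n} → m ℕ.≤ n → τ ^ℚ n Q.≤ τ ^ℚ m
  ^ℚ-antitone 0≤τ τ≤1 {n = zero}  z≤n       = Q.≤-refl
  ^ℚ-antitone {τ} 0≤τ τ≤1 {n = suc n} z≤n   = Q.≤-trans
    (Q.≤-trans (*-monoʳ (^ℚ-nonneg 0≤τ n) τ≤1) (Q.≤-reflexive (Q.*-identityˡ (τ ^ℚ n))))
    (^ℚ-antitone 0≤τ τ≤1 {n = n} z≤n)
  ^ℚ-antitone 0≤τ τ≤1 (s≤s m≤n) = Q.*-monoˡ 0≤τ (^ℚ-antitone 0≤τ τ≤1 m≤n)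

  weight-mono : {I : Set} {v w : I → ℚ} → (∀ i → 0ℚ Q.≤ v i) → (∀ i → v i Q.≤ w i) → SummableWeight w → SummableWeight v
  weight-mono {I} {v} {w} 0≤v v≤w sw = record
    { nonneg = 0≤v
    ; tail = λ 0<ε → proj₁ (SummableWeight.tail sw 0<ε) , λ F uF disjoint →
        Q.≤-trans (sumℚ-mono v≤w F) (proj₂ (SummableWeight.tail sw 0<ε) F uF disjoint) }

  module Geometric {τ : ℚ} (0≤τ : 0ℚ Q.≤ τ) (τ<1 : τ Q.< 1ℚ) where
    δ : ℚ
    δ = 1ℚ Q.- τ

    0<δ : 0ℚ Q.< δ
    0<δ = 0<-diff τ<1

    -- Bernoulli's inequality, multiplied out to avoid inverting τ. In the induction step the gap is
    -- τ^n (n + 1) (1 - τ)².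
    bernoulli : ∀ n → τ ^ℚ n Q.* (1ℚ Q.+ Q.nat n Q.* δ) Q.≤ 1ℚ
    bernoulli zero    = Q.≤-reflexive (trans (Q.*-identityˡ _) (trans (cong (λ p → 1ℚ Q.+ p) (trans (cong (Q._* δ) Q.nat-0) (Q.zeroˡ δ))) (Q.+-identityʳ 1ℚ)))
    bernoulli (suc n) = begin
      τ ^ℚ suc n Q.* (1ℚ Q.+ Q.nat (suc n) Q.* δ)
        ≡⟨ cong (λ p → τ ^ℚ suc n Q.* (1ℚ Q.+ p Q.* δ)) (Q.nat-suc n) ⟩
      τ ^ℚ suc n Q.* (1ℚ Q.+ (1ℚ Q.+ Q.nat n) Q.* δ)
        ≤⟨ ≤-gap _ (*-nonneg (^ℚ-nonneg 0≤τ n) (*-nonneg (+-nonneg (Q.<⇒≤ Q.0<1) (nat-nonneg n)) (0≤sq δ)))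
             (ℚ-id.bernoulli-step τ (τ ^ℚ n) (Q.nat n)) ⟩
      τ ^ℚ n Q.* (1ℚ Q.+ Q.nat n Q.* δ)
        ≤⟨ bernoulli n ⟩
      1ℚ ∎
      where open Q.≤-Reasoning

    power-small : ∀ {η} → 0ℚ Q.< η → ∃[ k ] τ ^ℚ k Q.≤ η
    power-small {η} 0<η = go (archimedean (Q.*-pos 0<η 0<δ))
      where
      go : ∃[ k ] recip k Q.≤ η Q.* δ → ∃[ k ] τ ^ℚ k Q.≤ η
      go (k , rk≤) = suc k , (begin
        τ ^ℚ suc k                                                ≡⟨ Q.*-identityʳ _ ⟨
        τ ^ℚ suc k Q.* 1ℚ                                         ≤⟨ Q.*-monoˡ (^ℚ-nonneg 0≤τ (suc k)) 1≤ ⟩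
        τ ^ℚ suc k Q.* (η Q.* (1ℚ Q.+ Q.nat (suc k) Q.* δ))         ≡⟨ ℚ-id.*-swap (τ ^ℚ suc k) η _ ⟩
        η Q.* (τ ^ℚ suc k Q.* (1ℚ Q.+ Q.nat (suc k) Q.* δ))         ≤⟨ Q.*-monoˡ (Q.<⇒≤ 0<η) (bernoulli (suc k)) ⟩
        η Q.* 1ℚ                                                  ≡⟨ Q.*-identityʳ η ⟩
        η                                                         ∎)
        where
        open Q.≤-Reasoning
        1≤ : 1ℚ Q.≤ η Q.* (1ℚ Q.+ Q.nat (suc k) Q.* δ)
        1≤ = begin
          1ℚ                                         ≡⟨ nat*recip k ⟨
          Q.nat (suc k) Q.* recip k                    ≤⟨ Q.*-monoˡ (nat-nonneg (suc k)) rk≤ ⟩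
          Q.nat (suc k) Q.* (η Q.* δ)                  ≤⟨ ≤-gap η (Q.<⇒≤ 0<η) (ℚ-id.archimedean-step (Q.nat (suc k)) η δ) ⟩
          η Q.* (1ℚ Q.+ Q.nat (suc k) Q.* δ)           ∎

    telescope : ∀ n → δ Q.* sumℚ (τ ^ℚ_) (downFrom n) Q.+ τ ^ℚ n ≡ 1ℚ
    telescope zero    = trans (cong (Q._+ 1ℚ) (Q.zeroʳ δ)) (Q.+-identityˡ 1ℚ)
    telescope (suc n) = trans (ℚ-id.telescope-step τ (τ ^ℚ n) (sumℚ (τ ^ℚ_) (downFrom n))) (telescope n)

    -- Reduces a tail of the geometric series to τ^k times one of its initial segments.
    cover : ∀ k F → (∀ {i} → i ∈ F → i ∉ downFrom k) → ∃[ n ] F ⊆ map (k ℕ.+_) (downFrom n)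
    cover k []      _        = 0 , λ ()
    cover k (i ∷ F) disjoint = go (cover k F (λ i∈ → disjoint (there i∈)))
      where
      k≤i : k ℕ.≤ i
      k≤i = ℕ.≮⇒≥ (λ i<k → disjoint (here refl) (∈-downFrom⁺ i<k))
      go : ∃[ n ] F ⊆ map (k ℕ.+_) (downFrom n) → ∃[ n ] (i ∷ F) ⊆ map (k ℕ.+_) (downFrom n)
      go (n , F⊆) = suc i ℕ.⊔ n , λ
        { (here refl) → subst (_∈ map (k ℕ.+_) (downFrom (suc i ℕ.⊔ n))) (ℕ.m+[n∸m]≡n k≤i)
            (∈-map⁺ (k ℕ.+_) (∈-downFrom⁺ (ℕ.≤-trans (s≤s (ℕ.m∸n≤m i k)) (ℕ.m≤m⊔n (suc i) n))))
        ; (there j∈) → widen (∈-map⁻ (k ℕ.+_) (F⊆ j∈)) }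
        where
        widen : ∀ {j} → ∃[ x ] x ∈ downFrom n × (j ≡ k ℕ.+ x) → j ∈ map (k ℕ.+_) (downFrom (suc i ℕ.⊔ n))
        widen (x , x∈ , refl) = ∈-map⁺ (k ℕ.+_) (∈-downFrom⁺ (ℕ.≤-trans (∈-downFrom⁻ x∈) (ℕ.m≤n⊔m (suc i) n)))

    partial-≤ : ∀ {r} → 0ℚ Q.< r → δ Q.* r ≡ 1ℚ → ∀ n → sumℚ (τ ^ℚ_) (downFrom n) Q.≤ r
    partial-≤ {r} 0<r δr≡1 n = begin
      S                   ≡⟨ Q.*-identityˡ S ⟨
      1ℚ Q.* S            ≡⟨ cong (Q._* S) δr≡1 ⟨
      δ Q.* r Q.* S       ≡⟨ ℚ-id.*-rotate δ r S ⟩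
      r Q.* (δ Q.* S)     ≤⟨ Q.*-monoˡ (Q.<⇒≤ 0<r) (≤-gap (τ ^ℚ n) (^ℚ-nonneg 0≤τ n) (telescope n)) ⟩
      r Q.* 1ℚ            ≡⟨ Q.*-identityʳ r ⟩
      r                   ∎
      where
      open Q.≤-Reasoning
      S : ℚ
      S = sumℚ (τ ^ℚ_) (downFrom n)

    geometric : SummableWeight (τ ^ℚ_)
    geometric = record { nonneg = ^ℚ-nonneg 0≤τ ; tail = go (Q.inverse 0<δ) }
      where
      go : ∃[ r ] (0ℚ Q.< r) × (δ Q.* r ≡ 1ℚ) → ∀ {ε} → 0ℚ Q.< ε →
        ∃[ F₀ ] ∀ F → Unique F → (∀ {i} → i ∈ F → i ∉ F₀) → sumℚ (τ ^ℚ_) F Q.≤ ε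
      go (r , 0<r , δr≡1) 0<ε = go′ (shrink r 0<ε)
        where
        go′ : ∀ {ε} → ∃[ η ] (0ℚ Q.< η) × (r Q.* η Q.≤ ε) →
          ∃[ F₀ ] ∀ F → Unique F → (∀ {i} → i ∈ F → i ∉ F₀) → sumℚ (τ ^ℚ_) F Q.≤ ε
        go′ {ε} (η , 0<η , rη≤ε) = go″ (power-small 0<η)
          where
          go″ : ∃[ k ] τ ^ℚ k Q.≤ η → ∃[ F₀ ] ∀ F → Unique F → (∀ {i} → i ∈ F → i ∉ F₀) → sumℚ (τ ^ℚ_) F Q.≤ ε
          go″ (k , τᵏ≤η) = downFrom k , λ F uF disjoint → go‴ F uF (cover k F disjoint)
            where
            open Q.≤-Reasoning
            go‴ : ∀ F → Unique F → ∃[ n ] F ⊆ map (k ℕ.+_) (downFrom n) → sumℚ (τ ^ℚ_) F Q.≤ ε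
            go‴ F uF (n , F⊆) = begin
              sumℚ (τ ^ℚ_) F                                   ≤⟨ sumℚ-⊆ ℕ._≟_ (^ℚ-nonneg 0≤τ) uF F⊆ ⟩
              sumℚ (τ ^ℚ_) (map (k ℕ.+_) (downFrom n))         ≡⟨ ℚSum.Sum-map (τ ^ℚ_) (k ℕ.+_) (downFrom n) ⟩
              sumℚ (λ i → τ ^ℚ (k ℕ.+ i)) (downFrom n)         ≡⟨ ℚSum.Sum-cong (^ℚ-homo-* τ k) (downFrom n) ⟩
              sumℚ (λ i → τ ^ℚ k Q.* τ ^ℚ i) (downFrom n)      ≡⟨ ℚSum.Sum-*ˡ (τ ^ℚ k) (τ ^ℚ_) (downFrom n) ⟨
              τ ^ℚ k Q.* sumℚ (τ ^ℚ_) (downFrom n)             ≤⟨ *-mono (^ℚ-nonneg 0≤τ k) (Q.<⇒≤ 0<r) τᵏ≤η (partial-≤ 0<r δr≡1 n) ⟩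
              η Q.* r                                          ≡⟨ Q.*-comm η r ⟩
              r Q.* η                                          ≤⟨ rη≤ε ⟩
              ε                                                ∎

  -- The positive and the negative part of an integer. Their sum is the absolute value, so the
  -- geometric weight on ℤ is the pullback of a product of two geometric weights on ℕ along this
  -- injection.
  split-sign : ℤ → ℕ × ℕ
  split-sign (+ n)    = n , 0
  split-sign -[1+ n ] = 0 , suc n

  unsplit-sign : ℕ × ℕ → ℤ
  unsplit-sign (m , n) = m ℤ.⊖ n

  unsplit-split : ∀ i → unsplit-sign (split-sign i) ≡ i
  unsplit-split (+ n)    = ℤ.⊖-≥ z≤n
  unsplit-split -[1+ n ] = refl

  split-sign-sum : ∀ i → proj₁ (split-sign i) ℕ.+ proj₂ (split-sign i) ≡ ℤ.∣ i ∣
  split-sign-sum (+ n)    = ℕ.+-identityʳ n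
  split-sign-sum -[1+ n ] = refl

  _≟ℤ²_ : DecidableEquality (ℤ × ℤ)
  _≟ℤ²_ = ≡-dec ℤ._≟_ ℤ._≟_

  module _ {τ : ℚ} (0≤τ : 0ℚ Q.≤ τ) (τ<1 : τ Q.< 1ℚ) where
    private
      ℤ-weight : ℤ → ℚ
      ℤ-weight i = τ ^ℚ proj₁ (split-sign i) Q.* τ ^ℚ proj₂ (split-sign i)

      ℤ-weight≡ : ∀ i → ℤ-weight i ≡ τ ^ℚ ℤ.∣ i ∣
      ℤ-weight≡ i = trans (sym (^ℚ-homo-* τ (proj₁ (split-sign i)) (proj₂ (split-sign i)))) (cong (τ ^ℚ_) (split-sign-sum i))

    ℤ²-geometric : SummableWeight (λ ((m , n) : ℤ × ℤ) → τ ^ℚ (ℤ.∣ m ∣ ℕ.+ ℤ.∣ n ∣))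
    ℤ²-geometric = weight-mono (λ (m , n) → ^ℚ-nonneg 0≤τ (ℤ.∣ m ∣ ℕ.+ ℤ.∣ n ∣))
      (λ (m , n) → Q.≤-reflexive (trans (^ℚ-homo-* τ ℤ.∣ m ∣ ℤ.∣ n ∣) (sym (cong₂ Q._*_ (ℤ-weight≡ m) (ℤ-weight≡ n)))))
      (weight-⊗ ℤ._≟_ ℤ._≟_ ℤ-summable ℤ-summable)
      where
      ℤ-summable : SummableWeight ℤ-weight
      ℤ-summable = weight-reindex split-sign unsplit-sign unsplit-split
        (weight-⊗ ℕ._≟_ ℕ._≟_ (Geometric.geometric 0≤τ τ<1) (Geometric.geometric 0≤τ τ<1))

  -- The squared modulus

  sq : ℂ → ℕ → ℚ
  sq z n = reₙ z n Q.* reₙ z n Q.+ imₙ z n Q.* imₙ z n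

  sq-nonneg : ∀ z n → 0ℚ Q.≤ sq z n
  sq-nonneg z n = +-nonneg (0≤sq (reₙ z n)) (0≤sq (imₙ z n))

  sq-* : ∀ z w n → sq (z * w) n ≡ sq z n Q.* sq w n
  sq-* z w n = trans (cong₂ (λ x y → x Q.* x Q.+ y Q.* y) (re-* z w n) (im-* z w n))
    (ℚ-id.brahmagupta (reₙ z n) (imₙ z n) (reₙ w n) (imₙ w n))

  sq-1 : ∀ n → sq 1ℂ n ≡ 1ℚ
  sq-1 n = trans (cong₂ (λ x y → x Q.* x Q.+ y Q.* y) (re-ℚ 1ℚ n) (im-ℚ 1ℚ n))
    (trans (cong₂ Q._+_ (Q.*-identityˡ 1ℚ) (Q.zeroˡ 0ℚ)) (Q.+-identityʳ 1ℚ))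

  sq-^ : ∀ z k n → sq (z ^ k) n ≡ sq z n ^ℚ k
  sq-^ z zero    n = sq-1 n
  sq-^ z (suc k) n = trans (sq-* z (z ^ k) n) (cong (λ p → sq z n Q.* p) (sq-^ z k n))

  -- z · conj z is the squared modulus, so sq inherits the continuity of products.
  re-*conj : ∀ z n → reₙ (z * conj z) n ≡ sq z n
  re-*conj z n = trans (re-* z (conj z) n) (trans
    (cong₂ (λ x y → reₙ z n Q.* x Q.+ Q.- (imₙ z n Q.* y)) (re-conj z n) (im-conj z n))
    (ℚ-id.modulus (reₙ z n) (imₙ z n)))

  conj-cong : ∀ {z w} → z ≈ w → conj z ≈ conj w
  conj-cong {z} {w} z≈w = mk≈ λ 0<ε → ≺-resp (conj-- z w) (≺-conj (_≈_.close z≈w 0<ε))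

  ≺⇒re≤ : ∀ z w n {ε} → ‖ z - w ‖ n Q.≤ ε → reₙ z n Q.≤ reₙ w n Q.+ ε
  ≺⇒re≤ z w n {ε} h = begin
    reₙ z n                             ≡⟨ ℚ-id.difference-+ (reₙ z n) (reₙ w n) ⟨
    (reₙ z n Q.- reₙ w n) Q.+ reₙ w n   ≡⟨ Q.+-comm (reₙ z n Q.- reₙ w n) (reₙ w n) ⟩
    reₙ w n Q.+ (reₙ z n Q.- reₙ w n)   ≡⟨ cong (λ p → reₙ w n Q.+ p) (re-sub z w n) ⟨
    reₙ w n Q.+ reₙ (z - w) n           ≤⟨ Q.+-monoʳ-≤ (reₙ w n) (Q.≤-trans (p≤∣p∣ (reₙ (z - w) n)) (Q.≤-trans (∣re∣≤‖‖ (z - w) n) h)) ⟩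
    reₙ w n Q.+ ε                       ∎
    where open Q.≤-Reasoning

  sq≤⇒‖‖≤ : ∀ z n {r} → 0ℚ Q.≤ r → sq z n Q.≤ r Q.* r → ‖ z ‖ n Q.≤ 2ℚ Q.* r
  sq≤⇒‖‖≤ z n {r} 0≤r h = Q.≤-trans (Q.≤-reflexive (‖‖-def z n))
    (Q.≤-trans (Q.+-mono-≤ (part (reₙ z n) (≤-gap _ (0≤sq (imₙ z n)) refl))
                           (part (imₙ z n) (≤-gap _ (0≤sq (reₙ z n)) (Q.+-comm (imₙ z n Q.* imₙ z n) (reₙ z n Q.* reₙ z n)))))
               (Q.≤-reflexive (ℚ-id.double r)))
    where
    part : ∀ x → x Q.* x Q.≤ sq z n → Q.∣ x ∣ Q.≤ r
    part x x²≤ = sq-cancel-≤ (Q.0≤∣p∣ x) 0≤r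
      (Q.≤-trans (Q.≤-reflexive (∣∣-sq x)) (Q.≤-trans x²≤ h))

  sq≤‖‖² : ∀ z n → sq z n Q.≤ ‖ z ‖ n Q.* ‖ z ‖ n
  sq≤‖‖² z n = ≤-gap (2ℚ Q.* (a Q.* b)) (*-nonneg (+-nonneg (Q.<⇒≤ Q.0<1) (Q.<⇒≤ Q.0<1)) (*-nonneg (Q.0≤∣p∣ (reₙ z n)) (Q.0≤∣p∣ (imₙ z n))))
    (trans (cong₂ (λ x y → (x Q.+ y) Q.+ 2ℚ Q.* (a Q.* b)) (sym (∣∣-sq (reₙ z n))) (sym (∣∣-sq (imₙ z n))))
      (trans (cong (λ p → (a Q.* a Q.+ b Q.* b) Q.+ p) (sym (ℚ-id.double (a Q.* b))))
        (trans (ℚ-id.square-sum a b) (sym (cong₂ Q._*_ (‖‖-def z n) (‖‖-def z n))))))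
    where
    a b : ℚ
    a = Q.∣ reₙ z n ∣
    b = Q.∣ imₙ z n ∣

  -- Comparison with Defs

  opaque
    unfolding C._+_ C.ℚ→ℂ Q._+_

    +-defs : D._+_ ≡ C._+_
    +-defs = refl

    *-defs : D._*_ ≡ C._*_
    *-defs = refl

    neg-defs : D.-_ ≡ C.-_
    neg-defs = refl

    ℚ→ℂ-defs : D.ℚ→ℂ ≡ C.ℚ→ℂ
    ℚ→ℂ-defs = refl

    normSq-defs : ∀ z n → seq (normSq z) n ≡ sq z n
    normSq-defs z n = refl

    +ℚ-defs : ℚ._+_ ≡ Q._+_
    +ℚ-defs = refl

    *ℚ-defs : ℚ._*_ ≡ Q._*_
    *ℚ-defs = refl

  sub-defs : ∀ z w → z D.- w ≡ z - w
  sub-defs z w = cong₂ (λ (_⊕_ : ℂ → ℂ → ℂ) (⊝_ : ℂ → ℂ) → z ⊕ (⊝ w)) {x = D._+_} {y = C._+_} {u = D.-_} {v = C.-_} +-defs neg-defs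

  ∑-defs : ∀ {I : Set} (f : I → ℂ) F → D.∑ f F ≡ Sum f F
  ∑-defs f F = cong₂ (λ (_⊕_ : ℂ → ℂ → ℂ) (z : ℚ → ℂ) → foldr _⊕_ (z 0ℚ) (map f F)) {x = D._+_} {y = C._+_} {u = D.ℚ→ℂ} {v = C.ℚ→ℂ} +-defs ℚ→ℂ-defs

  ∑-difference : ∀ {I : Set} (f : I → ℂ) F s → D.∑ f F D.- s ≡ Sum f F - s
  ∑-difference f F s = trans {j = D.∑ f F - s} (sub-defs (D.∑ f F) s) (cong (λ (z : ℂ) → z - s) {x = D.∑ f F} {y = Sum f F} (∑-defs f F))

  modulus≡ : ∀ z n δ ε →
    (seq (normSq z) n ℚ.+ δ ℚ.≤ ε ℚ.* ε) ≡ (sq z n Q.+ δ Q.≤ ε Q.* ε)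
  modulus≡ z n δ ε = trans {j = seq (normSq z) n Q.+ δ Q.≤ ε Q.* ε}
    (cong₂ (λ (_⊕_ _⊛_ : ℚ → ℚ → ℚ) → (seq (normSq z) n ⊕ δ) Q.≤ (ε ⊛ ε)) {x = ℚ._+_} {y = Q._+_} {u = ℚ._*_} {v = Q._*_} +ℚ-defs *ℚ-defs)
    (cong (λ (p : ℚ) → p Q.+ δ Q.≤ ε Q.* ε) {x = seq (normSq z) n} {y = sq z n} (normSq-defs z n))

  modulus⁻ : ∀ {z ε} → D.∣ z ∣< ε →
    ∃[ δ ] (0ℚ Q.< δ) × (∃[ N ] ∀ n → N ℕ.≤ n → sq z n Q.+ δ Q.≤ ε Q.* ε)
  modulus⁻ {z} {ε} (δ , 0<δ , N , h) = δ , 0<δ , N , λ n N≤n → subst id (modulus≡ z n δ ε) (h n N≤n)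

  modulus⁺ : ∀ {z ε} → ∃[ δ ] (0ℚ Q.< δ) × (∃[ N ] ∀ n → N ℕ.≤ n → sq z n Q.+ δ Q.≤ ε Q.* ε) → D.∣ z ∣< ε
  modulus⁺ {z} {ε} (δ , 0<δ , N , h) = δ , 0<δ , N , λ n N≤n → subst id (sym (modulus≡ z n δ ε)) (h n N≤n)

  hasSum⇒converges : ∀ {I : Set} {f : I → ℂ} {s} → HasSum f s → Converges f s
  hasSum⇒converges {I} {f} {s} h = converges-intro 2ℚ λ 0<ε → go 0<ε (h 0<ε)
    where
    go : ∀ {ε} → 0ℚ Q.< ε → ∃[ F₀ ] (∀ F → Unique F → F₀ ⊆ F → D.∣ D.∑ f F D.- s ∣< ε) →
      ∃[ F₀ ] (∀ F → Unique F → F₀ ⊆ F → (Sum f F - s) ≺ 2ℚ Q.* ε)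
    go {ε} 0<ε (F₀ , g) = F₀ , λ F uF F₀⊆F →
      go′ F (modulus⁻ (subst (D.∣_∣< ε) (∑-difference f F s) (g F uF F₀⊆F)))
      where
      go′ : ∀ F → ∃[ δ ] (0ℚ Q.< δ) × (∃[ N ] ∀ n → N ℕ.≤ n → sq (Sum f F - s) n Q.+ δ Q.≤ ε Q.* ε) →
        (Sum f F - s) ≺ 2ℚ Q.* ε
      go′ F (δ , 0<δ , N , k) = mk≺ N λ n N≤n → sq≤⇒‖‖≤ (Sum f F - s) n (Q.<⇒≤ 0<ε)
        (Q.≤-trans (≤-gap δ (Q.<⇒≤ 0<δ) refl) (k n N≤n))

  -- The modulus bound demands a gap. With η = ε / 2 the squared modulus is at most η², so η² can be
  -- added and 2 η² still stays below ε² = 4 η².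
  ≺⇒modulus : ∀ {z ε} → 0ℚ Q.< ε → z ≺ ½ Q.* ε → D.∣ z ∣< ε
  ≺⇒modulus {z} {ε} 0<ε (mk≺ N h) = modulus⁺ (η Q.* η , Q.*-pos 0<η 0<η , N , λ n N≤n → begin
      sq z n Q.+ η Q.* η              ≤⟨ Q.+-monoˡ-≤ (η Q.* η) (Q.≤-trans (sq≤‖‖² z n)
                                          (*-mono (‖‖-nonneg z n) (Q.<⇒≤ 0<η) (h n N≤n) (h n N≤n))) ⟩
      η Q.* η Q.+ η Q.* η             ≤⟨ ≤-gap (η Q.* η Q.+ η Q.* η) (+-nonneg (0≤sq η) (0≤sq η)) (ℚ-id.square-sum η η) ⟩
      (η Q.+ η) Q.* (η Q.+ η)         ≡⟨ cong₂ Q._*_ (½+½ ε) (½+½ ε) ⟩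
      ε Q.* ε                         ∎)
    where
    open Q.≤-Reasoning
    η : ℚ
    η = ½ Q.* ε
    0<η : 0ℚ Q.< η
    0<η = 0<½* 0<ε

  converges⇒hasSum : ∀ {I : Set} {f : I → ℂ} {s} → Converges f s → HasSum f s
  converges⇒hasSum {I} {f} {s} c {ε} 0<ε = proj₁ (Converges.eventually c (0<½* 0<ε)) , λ F uF F₀⊆F →
    subst (D.∣_∣< ε) (sym (∑-difference f F s))
      (≺⇒modulus 0<ε (proj₂ (Converges.eventually c (0<½* 0<ε)) F uF F₀⊆F))

  -- Numbers of modulus less than 1

  record Small (z : ℂ) : Set where
    field
      radius     : ℚ
      radius<1   : radius Q.< 1ℚ
      settled : ℕ
      sq≤radius  : ∀ n → settled ℕ.≤ n → sq z n Q.≤ radius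

  modulus⇒small : ∀ {z} → D.∣ z ∣< 1ℚ → Small z
  modulus⇒small {z} h = go (modulus⁻ h)
    where
    go : ∃[ δ ] (0ℚ Q.< δ) × (∃[ N ] ∀ n → N ℕ.≤ n → sq z n Q.+ δ Q.≤ 1ℚ Q.* 1ℚ) → Small z
    go (δ , 0<δ , N , k) = record
      { radius = 1ℚ Q.- δ ; radius<1 = <-gap 0<δ (ℚ-id.difference-+ 1ℚ δ) ; settled = N
      ; sq≤radius = λ n N≤n → begin
          sq z n                    ≡⟨ ℚ-id.+-difference-cancel (sq z n) δ ⟨
          (sq z n Q.+ δ) Q.- δ      ≤⟨ Q.+-monoˡ-≤ (Q.- δ) (Q.≤-trans (k n N≤n) (Q.≤-reflexive (Q.*-identityˡ 1ℚ))) ⟩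
          1ℚ Q.- δ                  ∎ }
      where open Q.≤-Reasoning

  -- Since t³ is at most t for t between 0 and 1, the same radius serves.
  small-^3 : ∀ {z} → Small z → Small (z ^ 3)
  small-^3 {z} s = record
    { radius = Small.radius s ; radius<1 = Small.radius<1 s ; settled = Small.settled s
    ; sq≤radius = λ n ≤n → Q.≤-trans (Q.≤-reflexive (sq-^ z 3 n))
        (Q.≤-trans (^ℚ-antitone (sq-nonneg z n) (Q.≤-trans (Small.sq≤radius s n ≤n) (Q.<⇒≤ (Small.radius<1 s))) {1} {3} (s≤s z≤n))
          (Q.≤-trans (Q.≤-reflexive (Q.*-identityʳ (sq z n))) (Small.sq≤radius s n ≤n))) }

  -- With x = |r|² the bound comes from (x - 1)² (x + 2) ≥ 0, i.e. 3 x ≤ x³ + 2.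
  small-root : ∀ {r z} → r ^ 3 ≈ z → Small z → Small r
  small-root {r} {z} r³≈z s = go (Q.inverse 0<3) (_≈_.close (*-cong r³≈z (conj-cong r³≈z)) 0<η)
    where
    open Small s
    η : ℚ
    η = ½ Q.* (1ℚ Q.- radius)
    0<η : 0ℚ Q.< η
    0<η = 0<½* (0<-diff radius<1)
    0<3 : 0ℚ Q.< 3ℚ
    0<3 = +-pos (+-pos Q.0<1 (Q.<⇒≤ Q.0<1)) (Q.<⇒≤ Q.0<1)
    go : ∃[ t ] (0ℚ Q.< t) × (3ℚ Q.* t ≡ 1ℚ) → (r ^ 3 * conj (r ^ 3) - z * conj z) ≺ η → Small r
    go (t , 0<t , 3t≡1) (mk≺ M h) = record
      { radius = 1ℚ Q.- t Q.* η
      ; radius<1 = <-gap (Q.*-pos 0<t 0<η) (ℚ-id.difference-+ 1ℚ (t Q.* η))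
      ; settled = M ℕ.⊔ settled
      ; sq≤radius = λ n ≤n → root-bound n (cube n (ℕ.m⊔n≤o⇒m≤o M settled ≤n) (ℕ.m⊔n≤o⇒n≤o M settled ≤n)) }
      where
      open Q.≤-Reasoning
      cube : ∀ n → M ℕ.≤ n → settled ℕ.≤ n → sq r n ^ℚ 3 Q.≤ 1ℚ Q.- η
      cube n M≤n ≤n = begin
        sq r n ^ℚ 3                            ≡⟨ sq-^ r 3 n ⟨
        sq (r ^ 3) n                           ≡⟨ re-*conj (r ^ 3) n ⟨
        reₙ (r ^ 3 * conj (r ^ 3)) n           ≤⟨ ≺⇒re≤ (r ^ 3 * conj (r ^ 3)) (z * conj z) n (h n M≤n) ⟩
        reₙ (z * conj z) n Q.+ η               ≡⟨ cong (Q._+ η) (re-*conj z n) ⟩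
        sq z n Q.+ η                           ≤⟨ Q.+-monoˡ-≤ η (sq≤radius n ≤n) ⟩
        radius Q.+ η                                ≡⟨ ℚ-id.half-way radius ½ Q.½+½≡1 ⟩
        1ℚ Q.- η                               ∎
      root-bound : ∀ n → sq r n ^ℚ 3 Q.≤ 1ℚ Q.- η → sq r n Q.≤ 1ℚ Q.- t Q.* η
      root-bound n x³≤ = begin
        x                             ≡⟨ ℚ-id.third x t 3t≡1 ⟨
        t Q.* (3ℚ Q.* x)              ≤⟨ Q.*-monoˡ (Q.<⇒≤ 0<t) (≤-gap _ (*-nonneg (0≤sq (x Q.- 1ℚ)) (+-nonneg (sq-nonneg r n) (+-nonneg (Q.<⇒≤ Q.0<1) (Q.<⇒≤ Q.0<1)))) (ℚ-id.cubic x)) ⟩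
        t Q.* (x ^ℚ 3 Q.+ 2ℚ)         ≤⟨ Q.*-monoˡ (Q.<⇒≤ 0<t) (Q.+-monoˡ-≤ 2ℚ x³≤) ⟩
        t Q.* ((1ℚ Q.- η) Q.+ 2ℚ)     ≡⟨ ℚ-id.third′ η t 3t≡1 ⟩
        1ℚ Q.- t Q.* η                ∎
        where
        x : ℚ
        x = sq r n

  -- A rational substitute for the square root: by the inequality of the arithmetic and the
  -- geometric mean of 1 and r, (1 + r) / 2 bounds √r from above, and it remains below 1.
  average-≥ : ∀ {r} → 0ℚ Q.≤ r → r Q.< 1ℚ → ∃[ μ ] (0ℚ Q.≤ μ) × (μ Q.< 1ℚ) × (r Q.≤ μ Q.* μ)
  average-≥ {r} 0≤r r<1 = ½ Q.* (1ℚ Q.+ r) , *-nonneg (Q.<⇒≤ Q.0<½) (+-nonneg (Q.<⇒≤ Q.0<1) 0≤r)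
    , <-gap (0<½* (0<-diff r<1)) (ℚ-id.average-gap r ½ Q.½+½≡1)
    , ≤-gap _ (0≤sq (½ Q.* (1ℚ Q.- r))) (ℚ-id.average-square r ½ Q.½+½≡1)

  -- The exponent `k + k` is adapted to `size≤norm`: twice the norm bounds |m| + |n|. To obtain it,
  -- τ⁴ has to bound |z|², hence the two applications of `average-≥`.
  PowerBound : ℂ → Set
  PowerBound z = ∃[ τ ] (0ℚ Q.≤ τ) × (τ Q.< 1ℚ) ×
    (∃[ N ] ∀ n → N ℕ.≤ n → ∀ k → ‖ z ^ k ‖ n Q.≤ 2ℚ Q.* τ ^ℚ (k ℕ.+ k))

  small⇒powerBound : ∀ {z} → Small z → PowerBound z
  small⇒powerBound {z} s = go (average-≥ (Q.≤-trans (sq-nonneg z settled) (sq≤radius settled ℕ.≤-refl)) radius<1)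
    where
    open Small s
    go : ∃[ μ ] (0ℚ Q.≤ μ) × (μ Q.< 1ℚ) × (radius Q.≤ μ Q.* μ) → PowerBound z
    go (μ , 0≤μ , μ<1 , radius≤μ²) = go′ (average-≥ 0≤μ μ<1)
      where
      go′ : ∃[ τ ] (0ℚ Q.≤ τ) × (τ Q.< 1ℚ) × (μ Q.≤ τ Q.* τ) → PowerBound z
      go′ (τ , 0≤τ , τ<1 , μ≤τ²) = τ , 0≤τ , τ<1 , settled , λ n ≤n k → sq≤⇒‖‖≤ (z ^ k) n (^ℚ-nonneg 0≤τ (k ℕ.+ k)) (begin
            sq (z ^ k) n                                 ≡⟨ sq-^ z k n ⟩
            sq z n ^ℚ k                                  ≤⟨ ^ℚ-mono (sq-nonneg z n) (sq≤ n ≤n) k ⟩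
            ((τ Q.* τ) Q.* (τ Q.* τ)) ^ℚ k               ≡⟨ ^ℚ-distrib-* (τ Q.* τ) (τ Q.* τ) k ⟩
            (τ Q.* τ) ^ℚ k Q.* (τ Q.* τ) ^ℚ k            ≡⟨ cong (λ p → p Q.* p) (trans (^ℚ-distrib-* τ τ k) (sym (^ℚ-homo-* τ k k))) ⟩
            τ ^ℚ (k ℕ.+ k) Q.* τ ^ℚ (k ℕ.+ k)            ∎)
        where
        open Q.≤-Reasoning
        ^ℚ-mono : ∀ {p q} → 0ℚ Q.≤ p → p Q.≤ q → ∀ k → p ^ℚ k Q.≤ q ^ℚ k
        ^ℚ-mono 0≤p p≤q zero    = Q.≤-refl
        ^ℚ-mono 0≤p p≤q (suc k) = *-mono 0≤p (^ℚ-nonneg (Q.≤-trans 0≤p p≤q) k) p≤q (^ℚ-mono 0≤p p≤q k)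
        sq≤ : ∀ n → settled ℕ.≤ n → sq z n Q.≤ (τ Q.* τ) Q.* (τ Q.* τ)
        sq≤ n ≤n = Q.≤-trans (sq≤radius n ≤n) (Q.≤-trans radius≤μ² (*-mono 0≤μ (*-nonneg 0≤τ 0≤τ) μ≤τ² μ≤τ²))

  norm-dominated : ∀ {z} → Small z → Dominated (λ l → z ^ ℤ.∣ norm l ∣)
  norm-dominated {z} s = go (small⇒powerBound s)
    where
    0≤2 : 0ℚ Q.≤ 2ℚ
    0≤2 = +-nonneg (Q.<⇒≤ Q.0<1) (Q.<⇒≤ Q.0<1)
    go : PowerBound z → Dominated (λ l → z ^ ℤ.∣ norm l ∣)
    go (τ , 0≤τ , τ<1 , N , power) = record
      { weight = λ (m , n) → 2ℚ Q.* τ ^ℚ (ℤ.∣ m ∣ ℕ.+ ℤ.∣ n ∣)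
      ; summable = weight-* 2ℚ 0≤2 (ℤ²-geometric 0≤τ τ<1)
      ; onset = N
      ; dominates = λ k ≤k (m , n) → Q.≤-trans (power k ≤k ℤ.∣ norm (m , n) ∣)
          (Q.*-monoˡ 0≤2 (^ℚ-antitone 0≤τ (Q.<⇒≤ τ<1) (size≤norm m n))) }

  -- Reciprocals of factorials

  nat-+ : ∀ m n → Q.nat (m ℕ.+ n) ≡ Q.nat m Q.+ Q.nat n
  nat-+ zero    n = sym (trans (cong (Q._+ Q.nat n) Q.nat-0) (Q.+-identityˡ (Q.nat n)))
  nat-+ (suc m) n = trans (Q.nat-suc (m ℕ.+ n)) (trans (cong (λ p → 1ℚ Q.+ p) (nat-+ m n))
    (trans (sym (Q.+-assoc 1ℚ (Q.nat m) (Q.nat n))) (cong (Q._+ Q.nat n) (sym (Q.nat-suc m)))))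

  nat-* : ∀ m n → Q.nat (m ℕ.* n) ≡ Q.nat m Q.* Q.nat n
  nat-* zero    n = trans Q.nat-0 (sym (trans (cong (Q._* Q.nat n) Q.nat-0) (Q.zeroˡ (Q.nat n))))
  nat-* (suc m) n = trans (nat-+ n (m ℕ.* n)) (trans (cong₂ Q._+_ (sym (Q.*-identityˡ (Q.nat n))) (nat-* m n))
    (trans (sym (Q.*-distribʳ-+ (Q.nat n) 1ℚ (Q.nat m))) (cong (Q._* Q.nat n) (sym (Q.nat-suc m)))))

  opaque
    unfolding Q._+_ Q.nat

    invFact : ℕ → ℚ
    invFact n = (+ 1 ℚ./ (n !)) {{n ℕ.!≢0}}

    invFact-def : ∀ n → (+ 1 ℚ./ (n !)) {{n ℕ.!≢0}} ≡ invFact n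
    invFact-def n = refl

    invFact≡recip : ∀ n → ∃[ k ] (n ! ≡ suc k) × (invFact n ≡ recip k)
    invFact≡recip n = go (n !) {{n ℕ.!≢0}}
      where
      go : ∀ m .{{_ : ℕ.NonZero m}} → ∃[ k ] (m ≡ suc k) × (+ 1 ℚ./ m ≡ recip k)
      go (suc k) = k , refl , ℚ.↥p/↧p≡p (recip k)

  invFact-nonneg : ∀ n → 0ℚ Q.≤ invFact n
  invFact-nonneg n = go (invFact≡recip n)
    where
    go : ∃[ k ] (n ! ≡ suc k) × (invFact n ≡ recip k) → 0ℚ Q.≤ invFact n
    go (k , _ , eq) = subst (0ℚ Q.≤_) (sym eq) (Q.<⇒≤ (recip-pos k))

  nat!*invFact : ∀ n → Q.nat (n !) Q.* invFact n ≡ 1ℚ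
  nat!*invFact n = go (invFact≡recip n)
    where
    go : ∃[ k ] (n ! ≡ suc k) × (invFact n ≡ recip k) → Q.nat (n !) Q.* invFact n ≡ 1ℚ
    go (k , eq , eq′) = trans (cong₂ (λ m r → Q.nat m Q.* r) eq eq′) (nat*recip k)

  nat*invFact : ∀ n → Q.nat (suc n) Q.* invFact (suc n) ≡ invFact n
  nat*invFact n = begin
    a Q.* x                        ≡⟨ Q.*-identityʳ (a Q.* x) ⟨
    a Q.* x Q.* 1ℚ                 ≡⟨ cong (λ p → a Q.* x Q.* p) (nat!*invFact n) ⟨
    a Q.* x Q.* (b Q.* y)          ≡⟨ ℚ-id.*-regroup a x b y ⟩
    a Q.* b Q.* x Q.* y            ≡⟨ cong (λ p → p Q.* x Q.* y) (nat-* (suc n) (n !)) ⟨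
    Q.nat (suc n !) Q.* x Q.* y    ≡⟨ cong (Q._* y) (nat!*invFact (suc n)) ⟩
    1ℚ Q.* y                       ≡⟨ Q.*-identityˡ y ⟩
    y                              ∎
    where
    open ≡.≡-Reasoning
    a b x y : ℚ
    a = Q.nat (suc n)
    b = Q.nat (n !)
    x = invFact (suc n)
    y = invFact n

  invFact-0 : invFact 0 ≡ 1ℚ
  invFact-0 = trans (sym (Q.*-identityˡ (invFact 0))) (trans (cong (Q._* invFact 0) (sym nat-1)) (nat!*invFact 0))
    where
    nat-1 : Q.nat 1 ≡ 1ℚ
    nat-1 = trans (Q.nat-suc 0) (trans (cong (λ p → 1ℚ Q.+ p) Q.nat-0) (Q.+-identityʳ 1ℚ))

  nat-unbounded : ∀ B → 0ℚ Q.< B → ∃[ k ] B Q.≤ Q.nat (suc k)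
  nat-unbounded B 0<B = go (Q.inverse 0<B)
    where
    go : ∃[ r ] (0ℚ Q.< r) × (B Q.* r ≡ 1ℚ) → ∃[ k ] B Q.≤ Q.nat (suc k)
    go (r , 0<r , Br≡1) = go′ (archimedean 0<r)
      where
      go′ : ∃[ k ] recip k Q.≤ r → ∃[ k ] B Q.≤ Q.nat (suc k)
      go′ (k , rk≤r) = k , (begin
        B                                      ≡⟨ Q.*-identityʳ B ⟨
        B Q.* 1ℚ                               ≡⟨ cong (λ p → B Q.* p) (nat*recip k) ⟨
        B Q.* (Q.nat (suc k) Q.* recip k)      ≤⟨ Q.*-monoˡ (Q.<⇒≤ 0<B) (Q.*-monoˡ (nat-nonneg (suc k)) rk≤r) ⟩
        B Q.* (Q.nat (suc k) Q.* r)            ≡⟨ ℚ-id.*-rotate′ B (Q.nat (suc k)) r ⟩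
        B Q.* r Q.* Q.nat (suc k)              ≡⟨ cong (Q._* Q.nat (suc k)) Br≡1 ⟩
        1ℚ Q.* Q.nat (suc k)                   ≡⟨ Q.*-identityˡ _ ⟩
        Q.nat (suc k)                          ∎)
        where open Q.≤-Reasoning

  decreasing⇒bounded : ∀ K (b : ℕ → ℚ) → (∀ n → 0ℚ Q.≤ b n) → (∀ n → K ℕ.≤ n → b (suc n) Q.≤ b n) →
    ∃[ B ] (0ℚ Q.≤ B) × (∀ n → b n Q.≤ B)
  decreasing⇒bounded zero    b 0≤b dec = b 0 , 0≤b 0 , b≤b0
    where
    b≤b0 : ∀ n → b n Q.≤ b 0
    b≤b0 zero    = Q.≤-refl
    b≤b0 (suc n) = Q.≤-trans (dec n z≤n) (b≤b0 n)
  decreasing⇒bounded (suc K) b 0≤b dec =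
    go (decreasing⇒bounded K (λ n → b (suc n)) (λ n → 0≤b (suc n)) (λ n K≤n → dec (suc n) (s≤s K≤n)))
    where
    go : ∃[ B ] (0ℚ Q.≤ B) × (∀ n → b (suc n) Q.≤ B) → ∃[ B ] (0ℚ Q.≤ B) × (∀ n → b n Q.≤ B)
    go (B , 0≤B , h) = b 0 Q.+ B , +-nonneg (0≤b 0) 0≤B , λ
      { zero    → ≤-gap B 0≤B refl
      ; (suc n) → Q.≤-trans (h n) (≤-gap (b 0) (0≤b 0) (Q.+-comm B (b 0))) }

  module _ {M : ℚ} (0≤M : 0ℚ Q.≤ M) where
    private
      0≤2 : 0ℚ Q.≤ 2ℚ
      0≤2 = +-nonneg (Q.<⇒≤ Q.0<1) (Q.<⇒≤ Q.0<1)

      b : ℕ → ℚ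
      b n = invFact n Q.* (2ℚ Q.* M) ^ℚ n

      0≤2M^ : ∀ n → 0ℚ Q.≤ (2ℚ Q.* M) ^ℚ n
      0≤2M^ = ^ℚ-nonneg (*-nonneg 0≤2 0≤M)

      b-decreasing : ∀ n → 2ℚ Q.* M Q.≤ Q.nat (suc n) → b (suc n) Q.≤ b n
      b-decreasing n 2M≤ = begin
        invFact (suc n) Q.* (2ℚ Q.* M Q.* (2ℚ Q.* M) ^ℚ n)
          ≤⟨ Q.*-monoˡ (invFact-nonneg (suc n)) (*-monoʳ (0≤2M^ n) 2M≤) ⟩
        invFact (suc n) Q.* (Q.nat (suc n) Q.* (2ℚ Q.* M) ^ℚ n)
          ≡⟨ ℚ-id.*-swap′ (invFact (suc n)) (Q.nat (suc n)) ((2ℚ Q.* M) ^ℚ n) ⟩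
        Q.nat (suc n) Q.* invFact (suc n) Q.* (2ℚ Q.* M) ^ℚ n
          ≡⟨ cong (Q._* (2ℚ Q.* M) ^ℚ n) (nat*invFact n) ⟩
        b n ∎
        where open Q.≤-Reasoning

    -- M^n / n! is b n / 2^n for b n = (2 M)^n / n!. The sequence b decreases once n + 1 reaches 2
    -- M, so it is bounded, and a geometric weight of ratio ½ dominates.
    exp-weight : SummableWeight (λ n → invFact n Q.* M ^ℚ n)
    -- The added 1 makes the bound positive even for M = 0, as `nat-unbounded` requires.
    exp-weight = go (nat-unbounded (1ℚ Q.+ 2ℚ Q.* M) (+-pos Q.0<1 (*-nonneg 0≤2 0≤M)))
      where
      go : ∃[ k ] (1ℚ Q.+ 2ℚ Q.* M) Q.≤ Q.nat (suc k) → SummableWeight (λ n → invFact n Q.* M ^ℚ n)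
      go (k , ≤nat) = go′ (decreasing⇒bounded k b (λ n → *-nonneg (invFact-nonneg n) (0≤2M^ n))
          (λ n k≤n → b-decreasing n (Q.≤-trans (≤-gap 1ℚ (Q.<⇒≤ Q.0<1) (Q.+-comm (2ℚ Q.* M) 1ℚ))
            (Q.≤-trans ≤nat (nat-mono (s≤s k≤n))))))
        where
        nat-mono : ∀ {m n} → m ℕ.≤ n → Q.nat m Q.≤ Q.nat n
        nat-mono {m} {n} m≤n = ≤-gap (Q.nat (n ℕ.∸ m)) (nat-nonneg (n ℕ.∸ m))
          (trans (sym (nat-+ m (n ℕ.∸ m))) (cong Q.nat (ℕ.m+[n∸m]≡n m≤n)))
        go′ : ∃[ B ] (0ℚ Q.≤ B) × (∀ n → b n Q.≤ B) → SummableWeight (λ n → invFact n Q.* M ^ℚ n)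
        go′ (B , 0≤B , b≤B) = weight-mono (λ n → *-nonneg (invFact-nonneg n) (^ℚ-nonneg 0≤M n))
          (λ n → begin
            invFact n Q.* M ^ℚ n                              ≡⟨ cong (λ p → invFact n Q.* p ^ℚ n) (half-double M) ⟨
            invFact n Q.* (2ℚ Q.* M Q.* ½) ^ℚ n               ≡⟨ cong (λ p → invFact n Q.* p) (^ℚ-distrib-* (2ℚ Q.* M) ½ n) ⟩
            invFact n Q.* ((2ℚ Q.* M) ^ℚ n Q.* ½ ^ℚ n)        ≡⟨ Q.*-assoc (invFact n) ((2ℚ Q.* M) ^ℚ n) (½ ^ℚ n) ⟨
            b n Q.* ½ ^ℚ n                                    ≤⟨ *-monoʳ (^ℚ-nonneg (Q.<⇒≤ Q.0<½) n) (b≤B n) ⟩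
            B Q.* ½ ^ℚ n                                      ∎)
          (weight-* B 0≤B (Geometric.geometric (Q.<⇒≤ Q.0<½) ½<1))
          where
          open Q.≤-Reasoning
          half-double : ∀ M → 2ℚ Q.* M Q.* ½ ≡ M
          half-double M = trans (Q.*-comm (2ℚ Q.* M) ½) (trans (cong (λ p → ½ Q.* p) (sym (ℚ-id.double M)))
            (trans (Q.*-distribˡ-+ ½ M M) (½+½ M)))
          ½<1 : ½ Q.< 1ℚ
          ½<1 = subst (½ Q.<_) Q.½+½≡1 (<-gap Q.0<½ refl)

  -- The exponential series

  ℚ→ℂ-* : ∀ p q → ℚ→ℂ (p Q.* q) ≐ ℚ→ℂ p * ℚ→ℂ q
  ℚ→ℂ-* p q = mk≐
    (λ n → trans (re-ℚ (p Q.* q) n) (sym (trans (re-* (ℚ→ℂ p) (ℚ→ℂ q) n) (trans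
      (cong₂ Q._+_ (cong₂ Q._*_ (re-ℚ p n) (re-ℚ q n)) (cong Q.-_ (cong₂ Q._*_ (im-ℚ p n) (im-ℚ q n))))
      (ℚ-id.real-* p q)))))
    (λ n → trans (im-ℚ (p Q.* q) n) (sym (trans (im-* (ℚ→ℂ p) (ℚ→ℂ q) n) (trans
      (cong₂ Q._+_ (cong₂ Q._*_ (re-ℚ p n) (im-ℚ q n)) (cong₂ Q._*_ (im-ℚ p n) (re-ℚ q n)))
      (trans (cong₂ Q._+_ (Q.zeroʳ p) (Q.zeroˡ q)) (Q.+-identityˡ 0ℚ))))))

  ℚ→ℂ-+ : ∀ p q → ℚ→ℂ (p Q.+ q) ≐ ℚ→ℂ p + ℚ→ℂ q
  ℚ→ℂ-+ p q = mk≐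
    (λ n → trans (re-ℚ (p Q.+ q) n) (sym (trans (re-+ (ℚ→ℂ p) (ℚ→ℂ q) n) (cong₂ Q._+_ (re-ℚ p n) (re-ℚ q n)))))
    (λ n → trans (im-ℚ (p Q.+ q) n) (sym (trans (im-+ (ℚ→ℂ p) (ℚ→ℂ q) n)
      (trans (cong₂ Q._+_ (im-ℚ p n) (im-ℚ q n)) (Q.+-identityˡ 0ℚ)))))

  ‖ℚ→ℂ‖ : ∀ p n → ‖ ℚ→ℂ p ‖ n ≡ Q.∣ p ∣
  ‖ℚ→ℂ‖ p n = trans (‖‖-def (ℚ→ℂ p) n) (trans (cong₂ (λ x y → Q.∣ x ∣ Q.+ Q.∣ y ∣) (re-ℚ p n) (im-ℚ p n))
    (trans (cong (λ q → Q.∣ p ∣ Q.+ q) (Q.0≤p⇒∣p∣≡p Q.≤-refl)) (Q.+-identityʳ Q.∣ p ∣)))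

  expTerm : ℂ → ℕ → ℂ
  expTerm z n = ℚ→ℂ (invFact n) * z ^ n

  natℂ : ℕ → ℂ
  natℂ n = ℚ→ℂ (Q.nat n)

  natℂ-0 : natℂ 0 ≈ 0ℂ
  natℂ-0 = ≡⇒≈ (cong ℚ→ℂ Q.nat-0)

  natℂ-+ : ∀ m n → natℂ (m ℕ.+ n) ≈ natℂ m + natℂ n
  natℂ-+ m n = ≈-trans (≡⇒≈ (cong ℚ→ℂ (nat-+ m n))) (≐⇒≈ (ℚ→ℂ-+ (Q.nat m) (Q.nat n)))

  natℂ-inverse : ∀ n → ℚ→ℂ (recip n) * natℂ (suc n) ≈ 1ℂ
  natℂ-inverse n = ≈-trans (≈-sym (≐⇒≈ (ℚ→ℂ-* (recip n) (Q.nat (suc n)))))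
    (≡⇒≈ (cong ℚ→ℂ (trans (Q.*-comm (recip n) (Q.nat (suc n))) (nat*recip n))))

  module Exp = DividedPowers ℂ-ring
  IsExpSeries : ℂ → (ℕ → ℂ) → Set
  IsExpSeries = Exp.IsDividedPowers natℂ natℂ-0 natℂ-+ (λ n → ℚ→ℂ (recip n)) natℂ-inverse

  expTerm-dividedPowers : ∀ z → IsExpSeries z (expTerm z)
  expTerm-dividedPowers z = record
    { E-0 = ≈-trans (*-identityʳ (ℚ→ℂ (invFact 0))) (≡⇒≈ (cong ℚ→ℂ invFact-0))
    ; E-suc = λ n → begin
        natℂ (suc n) * (ℚ→ℂ (invFact (suc n)) * (z * z ^ n))    ≈⟨ *-assoc _ _ _ ⟨
        natℂ (suc n) * ℚ→ℂ (invFact (suc n)) * (z * z ^ n)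
          ≈⟨ *-congʳ (≈-trans (≈-sym (≐⇒≈ (ℚ→ℂ-* (Q.nat (suc n)) (invFact (suc n))))) (≡⇒≈ (cong ℚ→ℂ (nat*invFact n)))) ⟩
        ℚ→ℂ (invFact n) * (z * z ^ n)                           ≈⟨ ≈-id.*-swap (ℚ→ℂ (invFact n)) z (z ^ n) ⟩
        z * (ℚ→ℂ (invFact n) * z ^ n)                           ∎ }
    where open SetoidReasoning setoid

  ‖^‖ : ∀ z n {M} → ‖ z ‖ n Q.≤ M → ∀ k → ‖ z ^ k ‖ n Q.≤ M ^ℚ k
  ‖^‖ z n {M} z≤M zero    = Q.≤-reflexive (trans (‖ℚ→ℂ‖ 1ℚ n) (Q.0≤p⇒∣p∣≡p (Q.<⇒≤ Q.0<1)))
  ‖^‖ z n {M} z≤M (suc k) = Q.≤-trans (‖*‖ z (z ^ k) n)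
    (*-mono (‖‖-nonneg z n) (^ℚ-nonneg (Q.≤-trans (‖‖-nonneg z n) z≤M) k) z≤M (‖^‖ z n z≤M k))

  expTerm-dominated : ∀ z → Dominated (expTerm z)
  expTerm-dominated z = go (≺-bound z)
    where
    go : ∃[ M ] z ≺ M → Dominated (expTerm z)
    go (M , z≺M) = record
      { weight = λ n → invFact n Q.* M ^ℚ n
      ; summable = exp-weight (≺-nonneg z≺M)
      ; onset = _≺_.start z≺M
      ; dominates = λ n ≤n k → Q.≤-trans (‖*‖ (ℚ→ℂ (invFact k)) (z ^ k) n)
          (*-mono (‖‖-nonneg (ℚ→ℂ (invFact k)) n) (^ℚ-nonneg (≺-nonneg z≺M) k)
            (Q.≤-reflexive (trans (‖ℚ→ℂ‖ (invFact k) n) (Q.0≤p⇒∣p∣≡p (invFact-nonneg k))))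
            (‖^‖ z n (_≺_.bound z≺M n ≤n) k)) }

  Expℂ : ℂ → ℂ → Set
  Expℂ z s = Converges (expTerm z) s

  bounded-by : {I : Set} (h : I → ℕ) (F : List I) → ∃[ n ] ∀ {i} → i ∈ F → h i ℕ.< n
  bounded-by h []      = 0 , λ ()
  bounded-by h (i ∷ F) = suc (h i) ℕ.⊔ proj₁ (bounded-by h F) , λ
    { (here refl) → ℕ.m≤m⊔n (suc (h i)) (proj₁ (bounded-by h F))
    ; (there j∈)  → ℕ.≤-trans (proj₂ (bounded-by h F) j∈) (ℕ.m≤n⊔m (suc (h i)) (proj₁ (bounded-by h F))) }

  -- The double series with sum s t and the series for z + w are compared along triangles and
  -- initial segments, where the divided-power form of the binomial theorem makes the finite sums
  -- equal.
  exp-+ : ∀ {z w s t} → Expℂ z s → Expℂ w t → Expℂ (z + w) (s * t)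
  exp-+ {z} {w} {s} {t} Ez Ew = converges-cong (λ _ → ≈-refl) (≈-sym st≈p) (proj₂ sum)
    where
    sum : ∃[ p ] Expℂ (z + w) p
    sum = dominated⇒converges ℕ._≟_ (expTerm-dominated (z + w))
    st≈p : s * t ≈ proj₁ sum
    st≈p = converges-compare
      (converges-⊗ ℕ._≟_ ℕ._≟_ (expTerm-dominated z) (expTerm-dominated w) Ez Ew) (proj₂ sum)
      λ F₀ G₀ → let m = proj₁ (bounded-by (λ (i , j) → i ℕ.+ j) F₀) ; n = proj₁ (bounded-by id G₀) in
        triangle (m ℕ.⊔ n) , downFrom (m ℕ.⊔ n) , triangle-unique (m ℕ.⊔ n) , Unique.downFrom⁺ (m ℕ.⊔ n) ,
        (λ k∈ → triangle⁺ (m ℕ.⊔ n) (ℕ.≤-trans (proj₂ (bounded-by (λ (i , j) → i ℕ.+ j) F₀) k∈) (ℕ.m≤m⊔n m n))) ,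
        (λ k∈ → ∈-downFrom⁺ (ℕ.≤-trans (proj₂ (bounded-by id G₀) k∈) (ℕ.m≤n⊔m m n))) ,
        Exp.Sum-triangle natℂ natℂ-0 natℂ-+ (λ k → ℚ→ℂ (recip k)) natℂ-inverse
          (expTerm-dividedPowers z) (expTerm-dividedPowers w) (expTerm-dividedPowers (z + w)) (m ℕ.⊔ n)

  exp-cong : ∀ {z w s t} → z ≈ w → s ≈ t → Expℂ z s → Expℂ w t
  exp-cong z≈w = converges-cong (λ n → *-congˡ (^-congˡ n z≈w))

  exp-unique : ∀ {z s t} → Expℂ z s → Expℂ z t → s ≈ t
  exp-unique = converges-unique ℕ._≟_

  exp-conj : ∀ {z s} → Expℂ z s → Expℂ (conj z) (conj s)
  exp-conj {z} Ez = converges-cong (λ n → ≐⇒≈ (conj-term n)) ≈-refl (converges-conj Ez)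
    where
    conj-^ : ∀ n → conj (z ^ n) ≐ conj z ^ n
    conj-^ zero    = conj-ℚ 1ℚ
    conj-^ (suc n) = ≐-trans (conj-* z (z ^ n)) (*-cong≐ ≐-refl (conj-^ n))
    conj-term : ∀ n → conj (expTerm z n) ≐ expTerm (conj z) n
    conj-term n = ≐-trans (conj-* (ℚ→ℂ (invFact n)) (z ^ n)) (*-cong≐ (conj-ℚ (invFact n)) (conj-^ n))

  -- Only the term of index 0 survives, so the series is pushed forward from a one-point index set.
  exp-0 : Expℂ 0ℂ 1ℂ
  exp-0 = converges-cong term ≈-refl (Pushforward.converges origin (expTerm 0ℂ) single)
    where
    origin : Embedding ⊤ ℕ
    origin = record
      { to = λ _ → 0 ; from = λ _ → tt ; indicator = λ { zero → 1 ; (suc _) → 0 }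
      ; from-to = λ _ → refl ; ind-to = λ _ → refl
      ; image = λ { zero → inj₂ (refl , refl) ; (suc _) → inj₁ refl } }
    single : Converges (λ _ → expTerm 0ℂ 0) 1ℂ
    single = mkConverges λ 0<ε → (tt ∷ []) , λ F uF ⊆F → _≈_.close
      (≈-trans (ℂSum.Sum-↭ (λ _ → expTerm 0ℂ 0) (unique-↭ uF ([] ∷ []) (λ _ → here refl) ⊆F))
        (≈-trans (+-identityʳ _) (Exp.IsDividedPowers.E-0 (expTerm-dividedPowers 0ℂ)))) 0<ε
    term : ∀ n → ι (Embedding.indicator origin n) * expTerm 0ℂ n ≈ expTerm 0ℂ n
    term zero    = ≈-trans (*-congʳ ι1) (*-identityˡ _)
    term (suc n) = ≈-trans (*-congˡ vanish) (≈-trans (zeroʳ _) (≈-sym vanish))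
      where
      vanish : expTerm 0ℂ (suc n) ≈ 0ℂ
      vanish = ≈-trans (*-congˡ (zeroˡ (0ℂ ^ n))) (zeroʳ (ℚ→ℂ (invFact (suc n))))

  power-defs : {A : Set} (_∼₁_ _∼₂_ : A → A → Set) {_⊛₁_ _⊛₂_ : A → A → A} {e₁ e₂ : A} →
    _⊛₁_ ≡ _⊛₂_ → e₁ ≡ e₂ → ∀ x n →
    RawMonoidDefs._×_ (record { Carrier = A ; _≈_ = _∼₁_ ; _∙_ = _⊛₁_ ; ε = e₁ }) n x ≡
    RawMonoidDefs._×_ (record { Carrier = A ; _≈_ = _∼₂_ ; _∙_ = _⊛₂_ ; ε = e₂ }) n x
  power-defs _ _ refl refl x zero    = refl
  power-defs ∼₁ ∼₂ {⊛₁} {⊛₂} {e₁} {e₂} refl refl x (suc n) =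
    cong (⊛₁ x) (power-defs ∼₁ ∼₂ {⊛₁} {⊛₁} {e₁} {e₁} refl refl x n)

  1-defs : D.1ℂ ≡ 1ℂ
  1-defs = cong (λ (f : ℚ → ℂ) → f 1ℚ) {x = D.ℚ→ℂ} {y = C.ℚ→ℂ} ℚ→ℂ-defs

  ^-defs : ∀ z n → z D.^ n ≡ z ^ n
  ^-defs z n = power-defs D._≃_ _≈_ {D._*_} {C._*_} {D.1ℂ} {1ℂ} *-defs 1-defs z n

  apply-defs : {A B : Set} (f g : B → A) (_⊛_ _⊛′_ : A → A → A) (p q : B) (x y : A) →
    f ≡ g → _⊛_ ≡ _⊛′_ → p ≡ q → x ≡ y → f p ⊛ x ≡ g q ⊛′ y
  apply-defs f .f _⊛_ .(_⊛_) p .p x .x refl refl refl refl = refl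

  -- The equations between operations of Defs are given without a type, since
  -- unification against an expected type would unfold them.
  expTerm-defs : ∀ z n → _
  expTerm-defs z n = apply-defs D.ℚ→ℂ C.ℚ→ℂ D._*_ C._*_ ((+ 1 ℚ./ (n !)) {{n ℕ.!≢0}}) (invFact n) (z D.^ n) (z ^ n)
    ℚ→ℂ-defs *-defs (invFact-def n) (^-defs z n)

  isExp⇒exp : ∀ {z w} → IsExp z w → Expℂ z w
  isExp⇒exp {z} {w} h = converges-cong (λ n → ≡⇒≈ (expTerm-defs z n)) ≈-refl
    (hasSum⇒converges {f = λ n → D.ℚ→ℂ ((+ 1 ℚ./ (n !)) {{n ℕ.!≢0}}) D.* z D.^ n} {s = w} h)

  exp⇒isExp : ∀ {z w} → Expℂ z w → IsExp z w
  exp⇒isExp {z} {w} h = converges⇒hasSum {f = λ n → D.ℚ→ℂ ((+ 1 ℚ./ (n !)) {{n ℕ.!≢0}}) D.* z D.^ n} {s = w}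
    (converges-cong (λ n → ≡⇒≈ (sym (expTerm-defs z n))) ≈-refl h)

  opaque
    unfolding C._+_ Q._+_

    re-+i : ∀ x y n → reₙ (x +i y) n ≡ seq x n
    re-+i x y n = refl

    im-+i : ∀ x y n → imₙ (x +i y) n ≡ seq y n
    im-+i x y n = refl

    seq-scale : ∀ p x n → seq (ℚ→ℝ p *ℝ x) n ≡ p Q.* seq x n
    seq-scale p x n = refl

    re-part : ℂ → ℝ
    re-part = re

    seq-re-part : ∀ z n → seq (re-part z) n ≡ reₙ z n
    seq-re-part z n = refl

  -- The value of exp at 2πi/3 as a primitive cube root of unity

  ⅓ ⅔ : ℚ
  ⅓ = + 1 ℚ./ 3
  ⅔ = + 2 ℚ./ 3

  opaque
    unfolding Q._+_

    3*⅔ : (⅔ Q.+ ⅔) Q.+ ⅔ ≡ 1ℚ Q.+ 1ℚ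
    3*⅔ = refl

    ⅔+⅓ : ⅔ Q.+ ⅓ ≡ 1ℚ
    ⅔+⅓ = refl

  0<⅓ : 0ℚ Q.< ⅓
  0<⅓ = ℚ.positive⁻¹ ⅓

  0<⅔ : 0ℚ Q.< ⅔
  0<⅔ = ℚ.positive⁻¹ ⅔

  <ℝ-defs : ∀ x y n ε → (seq x n ℚ.+ ε ℚ.≤ seq y n) ≡ (seq x n Q.+ ε Q.≤ seq y n)
  <ℝ-defs x y n ε = cong (λ (_⊕_ : ℚ → ℚ → ℚ) → (seq x n ⊕ ε) Q.≤ seq y n) {x = ℚ._+_} {y = Q._+_} +ℚ-defs

  imaginary-conj : ∀ x → (0ℝ +i x) + conj (0ℝ +i x) ≐ 0ℂ
  imaginary-conj x = mk≐ re≗ im≗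
    where
    z : ℂ
    z = 0ℝ +i x
    re≗ : ∀ n → reₙ (z + conj z) n ≡ reₙ 0ℂ n
    re≗ n = trans (re-+ z (conj z) n) (trans (cong₂ Q._+_ (re-+i 0ℝ x n) (trans (re-conj z n) (re-+i 0ℝ x n)))
      (trans (Q.+-identityˡ 0ℚ) (sym (re-ℚ 0ℚ n))))
    im≗ : ∀ n → imₙ (z + conj z) n ≡ imₙ 0ℂ n
    im≗ n = trans (im-+ z (conj z) n) (trans (cong (λ p → imₙ z n Q.+ p) (im-conj z n))
      (trans (Q.+-inverseʳ (imₙ z n)) (sym (im-ℚ 0ℚ n))))

  -- For z purely imaginary, conj z = -z, so exp z times its conjugate is exp 0.
  exp-imaginary-modulus : ∀ x {s} → Expℂ (0ℝ +i x) s → s * conj s ≈ 1ℂ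
  exp-imaginary-modulus x Es =
    exp-unique (exp-cong (≐⇒≈ (imaginary-conj x)) ≈-refl (exp-+ Es (exp-conj Es))) exp-0

  real-conj : ∀ c → conj (c +i 0ℝ) ≐ (c +i 0ℝ)
  real-conj c = mk≐ (re-conj (c +i 0ℝ)) λ n → trans (im-conj (c +i 0ℝ) n)
    (trans (cong Q.-_ (im-+i c 0ℝ n)) (trans ℚ-id.neg-0 (sym (im-+i c 0ℝ n))))

  -- Cancellation of a factor bounded away from 0, done on squared moduli since these are
  -- multiplicative at each approximation index; no inverse of `V` is formed.
  zero-product : ∀ {Y V μ N} → Y * V ≈ 0ℂ → 0ℚ Q.< μ → (∀ n → N ℕ.≤ n → μ Q.* μ Q.≤ sq V n) → Y ≈ 0ℂ
  zero-product {Y} {V} {μ} {N} YV≈0 0<μ V≥μ = ≈-intro 2ℚ λ 0<ε → go 0<ε (_≈_.close YV≈0 (Q.*-pos 0<μ 0<ε))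
    where
    sub-0 : ∀ z → z - 0ℂ ≐ z
    sub-0 z = ≐-id.sub-0 z
    go : ∀ {ε} → 0ℚ Q.< ε → (Y * V - 0ℂ) ≺ μ Q.* ε → (Y - 0ℂ) ≺ 2ℚ Q.* ε
    go {ε} 0<ε YV≺ = go′ (≺-resp (sub-0 (Y * V)) YV≺)
      where
      go′ : Y * V ≺ μ Q.* ε → (Y - 0ℂ) ≺ 2ℚ Q.* ε
      go′ (mk≺ M h) = ≺-resp (≐-sym (sub-0 Y)) (mk≺ (M ℕ.⊔ N) λ n ≤n →
        sq≤⇒‖‖≤ Y n (Q.<⇒≤ 0<ε) (*-cancelˡ-≤ (Q.*-pos 0<μ 0<μ) (begin
          μ Q.* μ Q.* sq Y n                   ≤⟨ *-monoʳ (sq-nonneg Y n) (V≥μ n (ℕ.m⊔n≤o⇒n≤o M N ≤n)) ⟩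
          sq V n Q.* sq Y n                    ≡⟨ trans (Q.*-comm (sq V n) (sq Y n)) (sym (sq-* Y V n)) ⟩
          sq (Y * V) n                         ≤⟨ sq≤‖‖² (Y * V) n ⟩
          ‖ Y * V ‖ n Q.* ‖ Y * V ‖ n          ≤⟨ *-mono (‖‖-nonneg (Y * V) n) (Q.<⇒≤ (Q.*-pos 0<μ 0<ε))
                                                    (h n (ℕ.m⊔n≤o⇒m≤o M N ≤n)) (h n (ℕ.m⊔n≤o⇒m≤o M N ≤n)) ⟩
          μ Q.* ε Q.* (μ Q.* ε)                ≡⟨ ℚ-id.*-interchange μ ε ⟩
          μ Q.* μ Q.* (ε Q.* ε)                ∎)))
        where open Q.≤-Reasoning

  module PrimitiveCubeRoot (w : ℂ) (ww̄≈1 : w * conj w ≈ 1ℂ) (w³≈1 : (w * w) * w ≈ 1ℂ)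
    (nonreal : ¬ (w ≈ conj w)) where
    open SetoidReasoning setoid

    Y u : ℂ
    Y = w - w * w
    u = (1ℂ + w) + w * w

    w̄≈w² : conj w ≈ w * w
    w̄≈w² = begin
      conj w                   ≈⟨ *-identityˡ (conj w) ⟨
      1ℂ * conj w              ≈⟨ *-congʳ w³≈1 ⟨
      ((w * w) * w) * conj w   ≈⟨ *-assoc (w * w) w (conj w) ⟩
      (w * w) * (w * conj w)   ≈⟨ *-congˡ ww̄≈1 ⟩
      (w * w) * 1ℂ             ≈⟨ *-identityʳ (w * w) ⟩
      w * w                    ∎

    1-w³ : 1ℂ - (w * w) * w ≈ 0ℂ
    1-w³ = ≈-trans (+-congˡ (-‿cong w³≈1)) (-‿inverseʳ 1ℂ)

    Yu≈0 : Y * u ≈ 0ℂ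
    Yu≈0 = begin
      Y * u                      ≈⟨ ≈-id.root-factor w ⟩
      w * (1ℂ - (w * w) * w)     ≈⟨ *-congˡ 1-w³ ⟩
      w * 0ℂ                     ≈⟨ zeroʳ w ⟩
      0ℂ                         ∎

    -- Y is 2i times the imaginary part of w, so this is -(4 im² - 3).
    V : ℂ
    V = Y * Y + ((1ℂ + 1ℂ) + 1ℂ)

    V≈u : V ≈ u
    V≈u = begin
      V                                                   ≈⟨ ≈-id.root-square w ⟩
      u + (1ℂ - (w * w) * w) * ((1ℂ + 1ℂ) - w)            ≈⟨ +-congˡ (≈-trans (*-congʳ 1-w³) (zeroˡ _)) ⟩
      u + 0ℂ                                              ≈⟨ +-identityʳ u ⟩
      u                                                   ∎

    Y≉0 : ¬ (Y ≈ 0ℂ)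
    Y≉0 Y≈0 = nonreal (begin
      w                      ≈⟨ ≈-id.difference-+ w (w * w) ⟨
      (w - w * w) + w * w    ≈⟨ +-congʳ Y≈0 ⟩
      0ℂ + w * w             ≈⟨ CommutativeRing.+-identityˡ ℂ-ring (w * w) ⟩
      w * w                  ≈⟨ w̄≈w² ⟨
      conj w                 ∎)

    -- `Y≉0` alone does not allow `Y` to be cancelled from `Y * u ≈ 0ℂ`. If |Y|² is visibly large,
    -- it can be. If it is visibly bounded, then `V`, which equals `u`, is bounded away from 0, and
    -- cancelling it from the same product gives `Y ≈ 0ℂ`, a contradiction.
    u≈0 : u ≈ 0ℂ
    u≈0 = decide (re-cauchy (Y * conj Y) Q.0<1)
      where
      decide : (∃[ N ] ∀ m n → N ℕ.≤ m → N ℕ.≤ n → Q.∣ reₙ (Y * conj Y) m Q.- reₙ (Y * conj Y) n ∣ Q.< 1ℚ) → u ≈ 0ℂ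
      -- Beyond `N` the approximations of |Y|² vary by less than 1. Comparing one of them with 3/2
      -- therefore keeps all later ones above ½ or below 5/2; both suffice, the second because the
      -- real part of Y² + 3 is then at least ½.
      decide (N , h) = cases (Q.≤-total (sq Y N) (1ℚ Q.+ ½))
        where
        near : ∀ m n → N ℕ.≤ m → N ℕ.≤ n → sq Y m Q.≤ sq Y n Q.+ 1ℚ
        near m n N≤m N≤n = ∣-∣≤⇒≤ (Q.<⇒≤ (subst₂ (λ p q → Q.∣ p Q.- q ∣ Q.< 1ℚ) (re-*conj Y m) (re-*conj Y n) (h m n N≤m N≤n)))
        cases : (sq Y N Q.≤ 1ℚ Q.+ ½) ⊎ (1ℚ Q.+ ½ Q.≤ sq Y N) → u ≈ 0ℂ
        cases (inj₂ large) = zero-product {u} {Y} {½} {N} (≈-trans (*-comm u Y) Yu≈0) Q.0<½ λ n N≤n →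
          Q.≤-trans ½²≤½ (+-cancelʳ-≤ {r = 1ℚ} (Q.≤-trans (Q.≤-reflexive (Q.+-comm ½ 1ℚ)) (Q.≤-trans large (near N n ℕ.≤-refl N≤n))))
          where
          ½²≤½ : ½ Q.* ½ Q.≤ ½
          ½²≤½ = ≤-gap (½ Q.* ½) (Q.<⇒≤ (Q.*-pos Q.0<½ Q.0<½)) (½+½ ½)
        cases (inj₁ small) = contradiction (zero-product {Y} {V} {½} {N} (≈-trans (*-congˡ V≈u) Yu≈0) Q.0<½ V≥½) Y≉0
          where
          reV : ∀ n → reₙ V n ≡ (reₙ Y n Q.* reₙ Y n Q.+ Q.- (imₙ Y n Q.* imₙ Y n)) Q.+ 3ℚ
          reV n = trans (re-+ (Y * Y) ((1ℂ + 1ℂ) + 1ℂ) n) (cong₂ Q._+_ (re-* Y Y n)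
            (trans (re-+ (1ℂ + 1ℂ) 1ℂ n) (cong₂ Q._+_ (trans (re-+ 1ℂ 1ℂ n) (cong₂ Q._+_ (re-ℚ 1ℚ n) (re-ℚ 1ℚ n))) (re-ℚ 1ℚ n))))
          ½≤reV : ∀ n → N ℕ.≤ n → ½ Q.≤ reₙ V n
          ½≤reV n N≤n = ≤-gap
            ((reₙ Y n Q.* reₙ Y n Q.+ reₙ Y n Q.* reₙ Y n) Q.+ (((1ℚ Q.+ ½) Q.+ 1ℚ) Q.- sq Y n))
            (+-nonneg (+-nonneg (0≤sq (reₙ Y n)) (0≤sq (reₙ Y n)))
              (0≤-diff (Q.≤-trans (near n N N≤n ℕ.≤-refl) (Q.+-monoˡ-≤ 1ℚ small))))
            (trans (ℚ-id.half-bound (reₙ Y n) (imₙ Y n) ½ Q.½+½≡1) (sym (reV n)))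
          V≥½ : ∀ n → N ℕ.≤ n → ½ Q.* ½ Q.≤ sq V n
          V≥½ n N≤n = Q.≤-trans
            (*-mono (Q.<⇒≤ Q.0<½) (Q.≤-trans (Q.<⇒≤ Q.0<½) (½≤reV n N≤n)) (½≤reV n N≤n) (½≤reV n N≤n))
            (≤-gap (imₙ V n Q.* imₙ V n) (0≤sq (imₙ V n)) refl)

  module _ (π : ℝ) (isPi : IsPi π) (x : ℝ) (x≡⅔π : ∀ n → seq x n ≡ ⅔ Q.* seq π n) {w : ℂ} (isExp : IsExp (0ℝ +i x) w) where
    private
      im-z : ∀ n → imₙ (0ℝ +i x) n ≡ ⅔ Q.* seq π n
      im-z n = trans (im-+i 0ℝ x n) (x≡⅔π n)

      3z≐2y : ((0ℝ +i x) + (0ℝ +i x)) + (0ℝ +i x) ≐ (0ℝ +i π) + (0ℝ +i π)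
      3z≐2y = mk≐
        (λ n → trans (re-+ ((0ℝ +i x) + (0ℝ +i x)) (0ℝ +i x) n) (trans (cong₂ Q._+_ (trans (re-+ (0ℝ +i x) (0ℝ +i x) n) (cong₂ Q._+_ (re-+i 0ℝ x n) (re-+i 0ℝ x n))) (re-+i 0ℝ x n))
          (trans (cong (Q._+ 0ℚ) (Q.+-identityˡ 0ℚ)) (sym (trans (re-+ (0ℝ +i π) (0ℝ +i π) n) (cong₂ Q._+_ (re-+i 0ℝ π n) (re-+i 0ℝ π n)))))))
        (λ n → trans (im-+ ((0ℝ +i x) + (0ℝ +i x)) (0ℝ +i x) n) (trans (cong₂ Q._+_ (trans (im-+ (0ℝ +i x) (0ℝ +i x) n) (cong₂ Q._+_ (im-z n) (im-z n))) (im-z n))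
          (trans (sym (trans (Q.*-distribʳ-+ (seq π n) (⅔ Q.+ ⅔) ⅔) (cong (Q._+ ⅔ Q.* seq π n) (Q.*-distribʳ-+ (seq π n) ⅔ ⅔))))
            (trans (cong (Q._* seq π n) 3*⅔) (trans (sym (ℚ-id.double (seq π n)))
              (sym (trans (im-+ (0ℝ +i π) (0ℝ +i π) n) (cong₂ Q._+_ (im-+i 0ℝ π n) (im-+i 0ℝ π n)))))))))

      Ez : Expℂ (0ℝ +i x) w
      Ez = isExp⇒exp {0ℝ +i x} {w} isExp

      w³≈1 : (w * w) * w ≈ 1ℂ
      w³≈1 = go (proj₁ (proj₂ isPi))
        where
        go : IsSin π 0ℝ → (w * w) * w ≈ 1ℂ
        go (c , Ec) = ≈-trans
          (exp-unique (exp-cong (≐⇒≈ 3z≐2y) ≈-refl (exp-+ (exp-+ Ez Ez) Ez)) (exp-+ Ey Ey))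
          -- As sin π = 0, exp (π i) is real, so its square is its squared modulus, which is 1.
          (≈-trans (*-congˡ (≈-sym (≐⇒≈ (real-conj c)))) (exp-imaginary-modulus π Ey))
          where
          Ey : Expℂ (0ℝ +i π) (c +i 0ℝ)
          Ey = isExp⇒exp {0ℝ +i π} {c +i 0ℝ} Ec

      0<x : 0ℝ <ℝ x
      0<x = go (proj₁ isPi)
        where
        go : 0ℝ <ℝ π → 0ℝ <ℝ x
        go (ε , 0<ε , N , h) = ⅔ Q.* ε , Q.*-pos 0<⅔ 0<ε , N , λ n N≤n → subst id (sym (<ℝ-defs 0ℝ x n (⅔ Q.* ε)))
          (Q.≤-trans (Q.≤-reflexive (Q.+-identityˡ (⅔ Q.* ε)))
            (Q.≤-trans (Q.*-monoˡ (Q.<⇒≤ 0<⅔)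
              (Q.≤-trans (Q.≤-reflexive (sym (Q.+-identityˡ ε))) (subst id (<ℝ-defs 0ℝ π n ε) (h n N≤n))))
              (Q.≤-reflexive (sym (x≡⅔π n)))))

      x<π : x <ℝ π
      x<π = go (proj₁ isPi)
        where
        go : 0ℝ <ℝ π → x <ℝ π
        go (ε , 0<ε , N , h) = ⅓ Q.* ε , Q.*-pos 0<⅓ 0<ε , N , λ n N≤n → subst id (sym (<ℝ-defs x π n (⅓ Q.* ε)))
          (Q.≤-trans (Q.+-mono-≤ (Q.≤-reflexive (x≡⅔π n)) (Q.*-monoˡ (Q.<⇒≤ 0<⅓)
              (Q.≤-trans (Q.≤-reflexive (sym (Q.+-identityˡ ε))) (subst id (<ℝ-defs 0ℝ π n ε) (h n N≤n)))))
            (Q.≤-reflexive (trans (sym (Q.*-distribʳ-+ (seq π n) ⅔ ⅓))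
              (trans (cong (Q._* seq π n) ⅔+⅓) (Q.*-identityˡ (seq π n))))))

      -- If `w` equalled its conjugate, its imaginary part would vanish, and x = 2π/3 would be a
      -- zero of sin strictly between 0 and π.
      nonreal : ¬ (w ≈ conj w)
      nonreal w≈w̄ = proj₂ (proj₂ isPi) x 0<x x<π
        (re-part w , exp⇒isExp {0ℝ +i x} {re-part w +i 0ℝ} (exp-cong (≐⇒≈ (≐-refl {0ℝ +i x})) w≈real Ez))
        where
        ‖w-r‖≤ : ∀ n → ‖ w - (re-part w +i 0ℝ) ‖ n Q.≤ ‖ w - conj w ‖ n
        ‖w-r‖≤ n = begin
          ‖ w - (re-part w +i 0ℝ) ‖ n
            ≡⟨ ‖‖-def (w - (re-part w +i 0ℝ)) n ⟩
          Q.∣ reₙ (w - (re-part w +i 0ℝ)) n ∣ Q.+ Q.∣ imₙ (w - (re-part w +i 0ℝ)) n ∣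
            ≡⟨ cong₂ (λ p q → Q.∣ p ∣ Q.+ Q.∣ q ∣)
                 (trans (re-sub w (re-part w +i 0ℝ) n) (trans (cong (λ p → reₙ w n Q.- p) (trans (re-+i (re-part w) 0ℝ n) (seq-re-part w n))) (Q.+-inverseʳ (reₙ w n))))
                 (trans (im-sub w (re-part w +i 0ℝ) n) (trans (cong (λ p → imₙ w n Q.- p) (im-+i (re-part w) 0ℝ n)) (ℚ-id.sub-0 (imₙ w n)))) ⟩
          Q.∣ 0ℚ ∣ Q.+ Q.∣ imₙ w n ∣
            ≡⟨ trans (cong (Q._+ Q.∣ imₙ w n ∣) (Q.0≤p⇒∣p∣≡p Q.≤-refl)) (Q.+-identityˡ Q.∣ imₙ w n ∣) ⟩
          Q.∣ imₙ w n ∣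
            ≤⟨ ≤-gap Q.∣ imₙ w n ∣ (Q.0≤∣p∣ (imₙ w n)) (trans (ℚ-id.double Q.∣ imₙ w n ∣)
                 (trans (cong (Q._* Q.∣ imₙ w n ∣) (sym (Q.0≤p⇒∣p∣≡p (+-nonneg (Q.<⇒≤ Q.0<1) (Q.<⇒≤ Q.0<1)))))
                   (trans (sym (Q.∣p*q∣≡∣p∣*∣q∣ 2ℚ (imₙ w n))) (cong Q.∣_∣ (ℚ-id.double-neg (imₙ w n)))))) ⟩
          Q.∣ imₙ w n Q.- Q.- imₙ w n ∣
            ≡⟨ cong Q.∣_∣ (trans (cong (λ p → imₙ w n Q.- p) (sym (im-conj w n))) (sym (im-sub w (conj w) n))) ⟩
          Q.∣ imₙ (w - conj w) n ∣
            ≤⟨ ∣im∣≤‖‖ (w - conj w) n ⟩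
          ‖ w - conj w ‖ n ∎
          where open Q.≤-Reasoning
        w≈real : w ≈ re-part w +i 0ℝ
        w≈real = mk≈ λ 0<ε → mk≺ (_≺_.start (_≈_.close w≈w̄ 0<ε)) λ n ≤n →
          Q.≤-trans (‖w-r‖≤ n) (_≺_.bound (_≈_.close w≈w̄ 0<ε) n ≤n)

    exp-2πi/3-root : (1ℂ + w) + w * w ≈ 0ℂ
    exp-2πi/3-root = PrimitiveCubeRoot.u≈0 w (exp-imaginary-modulus x Ez) w³≈1 nonreal

    exp-2πi/3-cube : (w * w) * w ≈ 1ℂ
    exp-2πi/3-cube = w³≈1

-- Residues modulo 3

0₃ 1₃ 2₃ : Fin 3
0₃ = zero
1₃ = suc zero
2₃ = suc (suc zero)

ofFin : Fin 3 → ℤ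
ofFin r = + toℕ r

opaque
  res : ℤ → Fin 3
  res i = fromℕ< (ℤ.n%ℕd<d i 3)

  quot : ℤ → ℤ
  quot i = i ℤ./ℕ 3

  res-quot : ∀ i → i ≡ ofFin (res i) ℤ.+ + 3 ℤ.* quot i
  res-quot i = trans (ℤ.a≡a%ℕn+[a/ℕn]*n i 3)
    (cong₂ (λ r m → + r ℤ.+ m) (sym (Fin.toℕ-fromℕ< (ℤ.n%ℕd<d i 3))) (ℤ.*-comm (i ℤ./ℕ 3) (+ 3)))

-- Distinct residues differ by 1 or 2 in absolute value, and 3 divides neither.
ofFin-unique : ∀ r s m → ℤ.∣ ofFin r ℤ.- ofFin s ∣ ≡ 3 ℕ.* m → r ≡ s
ofFin-unique r s m eq = go r s (divides m (trans eq (ℕ.*-comm 3 m)))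
  where
  go : ∀ r s → 3 ∣ ℤ.∣ ofFin r ℤ.- ofFin s ∣ → r ≡ s
  go zero             zero             _   = refl
  go zero             (suc zero)       3∣1 = contradiction 3∣1 (from-no (3 ∣? 1))
  go zero             (suc (suc zero)) 3∣2 = contradiction 3∣2 (from-no (3 ∣? 2))
  go (suc zero)       zero             3∣1 = contradiction 3∣1 (from-no (3 ∣? 1))
  go (suc zero)       (suc zero)       _   = refl
  go (suc zero)       (suc (suc zero)) 3∣1 = contradiction 3∣1 (from-no (3 ∣? 1))
  go (suc (suc zero)) zero             3∣2 = contradiction 3∣2 (from-no (3 ∣? 2))
  go (suc (suc zero)) (suc zero)       3∣1 = contradiction 3∣1 (from-no (3 ∣? 1))
  go (suc (suc zero)) (suc (suc zero)) _   = refl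

res-unique : ∀ {i} r k → i ≡ ofFin r ℤ.+ + 3 ℤ.* k → res i ≡ r
res-unique {i} r k eq = ofFin-unique (res i) r ℤ.∣ k ℤ.- quot i ∣
  (trans (cong ℤ.∣_∣ (ℤ-id.remainder-difference (ofFin (res i)) (ofFin r) (quot i) k (trans (sym (res-quot i)) eq)))
         (ℤ.abs-* (+ 3) (k ℤ.- quot i)))

add₃ : Fin 3 → Fin 3 → Fin 3
add₃ zero             s                = s
add₃ (suc zero)       zero             = 1₃
add₃ (suc zero)       (suc zero)       = 2₃
add₃ (suc zero)       (suc (suc zero)) = 0₃
add₃ (suc (suc zero)) zero             = 2₃
add₃ (suc (suc zero)) (suc zero)       = 0₃
add₃ (suc (suc zero)) (suc (suc zero)) = 1₃

add₃-identityʳ : ∀ r → add₃ r 0₃ ≡ r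
add₃-identityʳ zero             = refl
add₃-identityʳ (suc zero)       = refl
add₃-identityʳ (suc (suc zero)) = refl

neg₃ : Fin 3 → Fin 3
neg₃ zero             = 0₃
neg₃ (suc zero)       = 2₃
neg₃ (suc (suc zero)) = 1₃

add₃-carry : ∀ r s → ∃[ c ] ofFin r ℤ.+ ofFin s ≡ ofFin (add₃ r s) ℤ.+ + 3 ℤ.* c
add₃-carry zero             zero             = + 0 , refl
add₃-carry zero             (suc zero)       = + 0 , refl
add₃-carry zero             (suc (suc zero)) = + 0 , refl
add₃-carry (suc zero)       zero             = + 0 , refl
add₃-carry (suc zero)       (suc zero)       = + 0 , refl
add₃-carry (suc zero)       (suc (suc zero)) = + 1 , refl
add₃-carry (suc (suc zero)) zero             = + 0 , refl
add₃-carry (suc (suc zero)) (suc zero)       = + 1 , refl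
add₃-carry (suc (suc zero)) (suc (suc zero)) = + 1 , refl

neg₃-carry : ∀ r → ∃[ c ] ℤ.- ofFin r ≡ ofFin (neg₃ r) ℤ.+ + 3 ℤ.* c
neg₃-carry zero             = + 0 , refl
neg₃-carry (suc zero)       = -[1+ 0 ] , refl
neg₃-carry (suc (suc zero)) = -[1+ 0 ] , refl

res-+ : ∀ i j → res (i ℤ.+ j) ≡ add₃ (res i) (res j)
res-+ i j = go (add₃-carry (res i) (res j))
  where
  go : ∃[ c ] ofFin (res i) ℤ.+ ofFin (res j) ≡ ofFin (add₃ (res i) (res j)) ℤ.+ + 3 ℤ.* c →
    res (i ℤ.+ j) ≡ add₃ (res i) (res j)
  go (c , eq) = res-unique (add₃ (res i) (res j)) (c ℤ.+ (quot i ℤ.+ quot j))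
    (trans (cong₂ ℤ._+_ (res-quot i) (res-quot j))
      (ℤ-id.carry-+ (ofFin (res i)) (ofFin (res j)) (quot i) (quot j) (ofFin (add₃ (res i) (res j))) c eq))

res-neg : ∀ i → res (ℤ.- i) ≡ neg₃ (res i)
res-neg i = go (neg₃-carry (res i))
  where
  go : ∃[ c ] ℤ.- ofFin (res i) ≡ ofFin (neg₃ (res i)) ℤ.+ + 3 ℤ.* c → res (ℤ.- i) ≡ neg₃ (res i)
  go (c , eq) = res-unique (neg₃ (res i)) (c ℤ.- quot i)
    (trans (cong ℤ.-_ (res-quot i)) (ℤ-id.carry-neg (ofFin (res i)) (quot i) (ofFin (neg₃ (res i))) c eq))

res-3* : ∀ k → res (+ 3 ℤ.* k) ≡ 0₃
res-3* k = res-unique 0₃ k (sym (ℤ.+-identityˡ (+ 3 ℤ.* k)))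

res-1 : res (+ 1) ≡ 1₃
res-1 = res-unique 1₃ (+ 0) refl

exact : ∀ {i} → res i ≡ 0₃ → i ≡ + 3 ℤ.* quot i
exact {i} r≡0 = trans (res-quot i) (trans (cong (λ r → ofFin r ℤ.+ + 3 ℤ.* quot i) r≡0) (ℤ.+-identityˡ (+ 3 ℤ.* quot i)))

3*-injective : ∀ {i j} → + 3 ℤ.* i ≡ + 3 ℤ.* j → i ≡ j
3*-injective {i} {j} = ℤ.*-cancelˡ-≡ (+ 3) i j

quot-3* : ∀ {i k} → i ≡ + 3 ℤ.* k → quot i ≡ k
quot-3* {i} {k} eq = 3*-injective (trans (sym (exact (trans (cong res eq) (res-3* k)))) eq)

-- The value is a natural number so that conjunctions of congruences are products and disjoint
-- unions are sums.
δ : Fin 3 → Fin 3 → ℕ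
δ zero             zero             = 1
δ (suc zero)       (suc zero)       = 1
δ (suc (suc zero)) (suc (suc zero)) = 1
δ _                _                = 0

-- Integral linear forms, evaluated over ℤ and over ℤ/3

data Lin (n : ℕ) : Set where
  var : Fin n → Lin n
  one : Lin n
  _⊞_ : Lin n → Lin n → Lin n
  ⊟_  : Lin n → Lin n

infixl 6 _⊞_
infix  8 ⊟_

⟦_⟧ : ∀ {n} → Lin n → Vec ℤ n → ℤ
⟦ var x ⟧   ρ = lookup ρ x
⟦ one ⟧     ρ = + 1
⟦ e ⊞ e′ ⟧  ρ = ⟦ e ⟧ ρ ℤ.+ ⟦ e′ ⟧ ρ
⟦ ⊟ e ⟧     ρ = ℤ.- ⟦ e ⟧ ρ

⟦_⟧₃ : ∀ {n} → Lin n → Vec (Fin 3) n → Fin 3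
⟦ var x ⟧₃   ρ = lookup ρ x
⟦ one ⟧₃     ρ = 1₃
⟦ e ⊞ e′ ⟧₃  ρ = add₃ (⟦ e ⟧₃ ρ) (⟦ e′ ⟧₃ ρ)
⟦ ⊟ e ⟧₃     ρ = neg₃ (⟦ e ⟧₃ ρ)

-- Since reduction modulo 3 commutes with every form, an indicator given by forms is a function of
-- the residues of the coordinates. Statements about all lattice points thus reduce to enumeration
-- over `Fin 3`.
res-⟦⟧ : ∀ {n} (e : Lin n) ρ → res (⟦ e ⟧ ρ) ≡ ⟦ e ⟧₃ (Vec.map res ρ)
res-⟦⟧ (var x)  ρ = sym (Vec.lookup-map x res ρ)
res-⟦⟧ one      ρ = res-1
res-⟦⟧ (e ⊞ e′) ρ = trans (res-+ (⟦ e ⟧ ρ) (⟦ e′ ⟧ ρ)) (cong₂ add₃ (res-⟦⟧ e ρ) (res-⟦⟧ e′ ρ))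
res-⟦⟧ (⊟ e)    ρ = trans (res-neg (⟦ e ⟧ ρ)) (cong neg₃ (res-⟦⟧ e ρ))

substitute : ∀ {m n} → Vec (Lin m) n → Vec ℤ m → Vec ℤ n
substitute es ρ = Vec.map (λ e → ⟦ e ⟧ ρ) es

substitute₃ : ∀ {m n} → Vec (Lin m) n → Vec (Fin 3) m → Vec (Fin 3) n
substitute₃ es ρ = Vec.map (λ e → ⟦ e ⟧₃ ρ) es

res-substitute : ∀ {m n} (es : Vec (Lin m) n) ρ → Vec.map res (substitute es ρ) ≡ substitute₃ es (Vec.map res ρ)
res-substitute es ρ = trans (sym (Vec.map-∘ res (λ e → ⟦ e ⟧ ρ) es)) (Vec.map-cong (λ e → res-⟦⟧ e ρ) es)

divisible₃ : ∀ {n} → Vec (Fin 3) n → ℕ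
divisible₃ []       = 1
divisible₃ (r ∷ rs) = δ 0₃ r ℕ.* divisible₃ rs

divisible : ∀ {n} → Vec ℤ n → ℕ
divisible ρ = divisible₃ (Vec.map res ρ)

divisible-substitute : ∀ {m n} (es : Vec (Lin m) n) ρ → divisible (substitute es ρ) ≡ divisible₃ (substitute₃ es (Vec.map res ρ))
divisible-substitute es ρ = cong divisible₃ (res-substitute es ρ)

divisible-3* : ∀ {n} (is ks : Vec ℤ n) → is ≡ Vec.map (+ 3 ℤ.*_) ks → divisible is ≡ 1
divisible-3* []       []       refl = refl
divisible-3* (i ∷ is) (k ∷ ks) refl = cong₂ (λ r d → δ 0₃ r ℕ.* d) (res-3* k) (divisible-3* is ks refl)

quot-map-3* : ∀ {n} (is ks : Vec ℤ n) → is ≡ Vec.map (+ 3 ℤ.*_) ks → Vec.map quot is ≡ ks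
quot-map-3* []       []       refl = refl
quot-map-3* (i ∷ is) (k ∷ ks) refl = cong₂ _∷_ (quot-3* refl) (quot-map-3* is ks refl)

divisible-cases : ∀ {n} (is : Vec ℤ n) →
  (divisible is ≡ 0) ⊎ ((divisible is ≡ 1) × (is ≡ Vec.map (+ 3 ℤ.*_) (Vec.map quot is)))
divisible-cases []       = inj₂ (refl , refl)
divisible-cases (i ∷ is) = go (res i) refl (divisible-cases is)
  where
  Tail : Set
  Tail = (divisible is ≡ 0) ⊎ ((divisible is ≡ 1) × (is ≡ Vec.map (+ 3 ℤ.*_) (Vec.map quot is)))
  go : ∀ r → res i ≡ r → Tail →
    (δ 0₃ (res i) ℕ.* divisible is ≡ 0) ⊎
    ((δ 0₃ (res i) ℕ.* divisible is ≡ 1) × (i ∷ is ≡ Vec.map (+ 3 ℤ.*_) (Vec.map quot (i ∷ is))))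
  go zero             eq (inj₁ 0≡)         = inj₁ (cong₂ (λ r d → δ 0₃ r ℕ.* d) eq 0≡)
  go zero             eq (inj₂ (1≡ , eqs)) = inj₂ (cong₂ (λ r d → δ 0₃ r ℕ.* d) eq 1≡ , cong₂ _∷_ (exact eq) eqs)
  go (suc zero)       eq _                 = inj₁ (cong (λ r → δ 0₃ r ℕ.* divisible is) eq)
  go (suc (suc zero)) eq _                 = inj₁ (cong (λ r → δ 0₃ r ℕ.* divisible is) eq)

-- An affine map of lattices whose inverse is given, up to the factor 3, by the
-- linear forms es.
lattice-embedding : ∀ {J I : Set} {m n} (coordinates : I → Vec ℤ m) (es : Vec (Lin m) n)
  (to : J → I) (point : Vec ℤ n → I → J) (parameters : J → Vec ℤ n) →
  (∀ j → substitute es (coordinates (to j)) ≡ Vec.map (+ 3 ℤ.*_) (parameters j)) →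
  (∀ j → point (parameters j) (to j) ≡ j) →
  (∀ i ks → substitute es (coordinates i) ≡ Vec.map (+ 3 ℤ.*_) ks → to (point ks i) ≡ i) →
  Embedding J I
lattice-embedding coordinates es to point parameters forms point-parameters to-point = record
  { to        = to
  ; from      = λ i → point (Vec.map quot (substitute es (coordinates i))) i
  ; indicator = λ i → divisible (substitute es (coordinates i))
  ; from-to   = λ j → trans
      (cong (λ ks → point ks (to j)) (quot-map-3* (substitute es (coordinates (to j))) (parameters j) (forms j)))
      (point-parameters j)
  ; ind-to    = λ j → divisible-3* (substitute es (coordinates (to j))) (parameters j) (forms j)
  ; image     = λ i → [ inj₁ , (λ (1≡ , eq) → inj₂ (1≡ , to-point i _ eq)) ]′
                        (divisible-cases (substitute es (coordinates i)))
  }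

-- Composing an embedding with a bijection of the target composes its indicator with the inverse
-- bijection.
rotate : ∀ {J I : Set} (ρ ρ⁻¹ : I → I) → (∀ i → ρ (ρ⁻¹ i) ≡ i) → (∀ i → ρ⁻¹ (ρ i) ≡ i) → Embedding J I → Embedding J I
rotate ρ ρ⁻¹ ρρ⁻¹ ρ⁻¹ρ e = record
  { to        = λ j → ρ (to j)
  ; from      = λ i → from (ρ⁻¹ i)
  ; indicator = λ i → indicator (ρ⁻¹ i)
  ; from-to   = λ j → trans (cong from (ρ⁻¹ρ (to j))) (from-to j)
  ; ind-to    = λ j → trans (cong indicator (ρ⁻¹ρ (to j))) (ind-to j)
  ; image     = λ i → [ inj₁ , (λ (1≡ , eq) → inj₂ (1≡ , trans (cong ρ eq) (ρρ⁻¹ i))) ]′ (image (ρ⁻¹ i))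
  }
  where open Embedding e

-- The Eisenstein lattice, (m , n) standing for m + n ζ with ζ² = ζ - 1; then
-- ω = ζ - 1, and m - n is the residue modulo √-3.

L L³ : Set
L  = ℤ × ℤ
L³ = L × L × L

ω· ω²· : L → L
ω·  (m , n) = ℤ.- m ℤ.- n , m
ω²· (m , n) = n , ℤ.- m ℤ.- n

ωω² : ∀ l → ω· (ω²· l) ≡ l
ωω² (m , n) = cong₂ _,_ (ℤ-id.rotation-inverse₁ m n) refl

ω²ω : ∀ l → ω²· (ω· l) ≡ l
ω²ω (m , n) = cong₂ _,_ refl (ℤ-id.rotation-inverse₂ m n)

vec : L → Vec ℤ 2
vec (m , n) = m ∷ n ∷ []

vec³ : L³ → Vec ℤ 6
vec³ ((a , b) , (c , d) , (e , f)) = a ∷ b ∷ c ∷ d ∷ e ∷ f ∷ []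

v₀ v₁ : ∀ {n} → Lin (suc (suc n))
v₀ = var zero
v₁ = var (suc zero)

-- The coset 1 + 3 L and its rotations: the elements ≡ 1 modulo √-3

1+3· : L → L
1+3· (m , n) = + 1 ℤ.+ + 3 ℤ.* m , + 3 ℤ.* n

coset-forms : Vec (Lin 2) 2
coset-forms = (v₀ ⊞ ⊟ one) ∷ v₁ ∷ []

coset : Embedding L L
coset = lattice-embedding vec coset-forms 1+3· (λ { (k ∷ k′ ∷ []) _ → k , k′ }) vec
  (λ (m , n) → cong (_∷ + 3 ℤ.* n ∷ []) (ℤ-id.coset-form m))
  (λ _ → refl)
  (λ { (m , n) (k ∷ k′ ∷ []) eq → cong₂ _,_
       (trans (cong (λ i → + 1 ℤ.+ i) (sym (Vec.∷-injectiveˡ eq))) (ℤ-id.coset-point m))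
       (sym (Vec.∷-injectiveˡ (Vec.∷-injectiveʳ eq))) })

coset-ω coset-ω² : Embedding L L
coset-ω  = rotate ω·  ω²· ωω² ω²ω coset
coset-ω² = rotate ω²· ω·  ω²ω ωω² coset

ω-forms ω²-forms : Vec (Lin 2) 2
ω-forms  = (⊟ v₀ ⊞ ⊟ v₁) ∷ v₀ ∷ []
ω²-forms = v₁ ∷ (⊟ v₀ ⊞ ⊟ v₁) ∷ []

χ : L → Fin 3
χ (m , n) = res (m ℤ.- n)

χ-form : Lin 2
χ-form = v₀ ⊞ ⊟ v₁

Fin3² : ∀ (f g : Vec (Fin 3) 2 → ℕ) → Dec (∀ a b → f (a ∷ b ∷ []) ≡ g (a ∷ b ∷ []))
Fin3² f g = Fin.all? λ a → Fin.all? λ b → f (a ∷ b ∷ []) ℕ.≟ g (a ∷ b ∷ [])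

-- Modulo 3 the elements congruent to 1 modulo √-3 form the classes of 1, ω and ω², one for each
-- rotation. Both sides depend on residues only, which leaves nine cases.
coset-partition : ∀ l → Embedding.indicator coset l ℕ.+ Embedding.indicator coset-ω l ℕ.+ Embedding.indicator coset-ω² l
  ≡ δ 1₃ (χ l)
coset-partition l@(m , n) = trans
  -- The forms are crossed: membership in the image rotated by ω is tested after applying ω², and
  -- conversely.
  (cong₂ ℕ._+_ (cong₂ ℕ._+_ (divisible-substitute coset-forms (vec l)) (rotated ω²-forms)) (rotated ω-forms))
  (trans (check (res m) (res n)) (sym (cong (δ 1₃) (res-⟦⟧ χ-form (vec l)))))
  where
  rotated : ∀ es → divisible (substitute coset-forms (substitute es (vec l))) ≡
    divisible₃ (substitute₃ coset-forms (substitute₃ es (Vec.map res (vec l))))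
  rotated es = trans (divisible-substitute coset-forms (substitute es (vec l)))
    (cong (λ r → divisible₃ (substitute₃ coset-forms r)) (res-substitute es (vec l)))
  check : ∀ a b → divisible₃ (substitute₃ coset-forms (a ∷ b ∷ []))
      ℕ.+ divisible₃ (substitute₃ coset-forms (substitute₃ ω²-forms (a ∷ b ∷ [])))
      ℕ.+ divisible₃ (substitute₃ coset-forms (substitute₃ ω-forms (a ∷ b ∷ [])))
    ≡ δ 1₃ (⟦ χ-form ⟧₃ (a ∷ b ∷ []))
  check = from-yes (Fin3²
    (λ r → divisible₃ (substitute₃ coset-forms r)
      ℕ.+ divisible₃ (substitute₃ coset-forms (substitute₃ ω²-forms r))
      ℕ.+ divisible₃ (substitute₃ coset-forms (substitute₃ ω-forms r)))
    (λ r → δ 1₃ (⟦ χ-form ⟧₃ r)))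

-- Multiplication by √-3 (up to a unit), whose image is χ = 0

√-3· : L → L
√-3· (m , n) = m ℤ.+ + 2 ℤ.* n , ℤ.- (+ 2 ℤ.* m) ℤ.- n

√-3-embedding : Embedding L L
√-3-embedding = lattice-embedding vec (χ-form ∷ []) √-3·
  (λ { (k ∷ []) (a , b) → + 2 ℤ.* k ℤ.- a , a ℤ.- k }) (λ (m , n) → (m ℤ.+ n) ∷ [])
  (λ (m , n) → cong (_∷ []) (ℤ-id.√-3-form m n))
  (λ (m , n) → cong₂ _,_ (ℤ-id.√-3-point₁ m n) (ℤ-id.√-3-point₂ m n))
  (λ { (a , b) (k ∷ []) eq → cong₂ _,_ (ℤ-id.√-3-image₁ a k)
       (trans (ℤ-id.√-3-image₂ a k) (trans (cong (λ i → a ℤ.- i) (sym (Vec.∷-injectiveˡ eq))) (ℤ-id.√-3-image₃ a b))) })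

√-3-indicator : ∀ l → Embedding.indicator √-3-embedding l ≡ δ 0₃ (χ l)
√-3-indicator l = ℕ.*-identityʳ (δ 0₃ (χ l))

-- The elements with χ = 1 as (3 m + 1 + n , n)

shear : L → L
shear (m , n) = + 3 ℤ.* m ℤ.+ + 1 ℤ.+ n , n

shear-forms : Vec (Lin 2) 1
shear-forms = ((v₀ ⊞ ⊟ v₁) ⊞ ⊟ one) ∷ []

shear-embedding : Embedding L L
shear-embedding = lattice-embedding vec shear-forms shear
  (λ { (k ∷ []) (a , b) → k , b }) (λ (m , n) → m ∷ [])
  (λ (m , n) → cong (_∷ []) (ℤ-id.shear-form m n))
  (λ _ → refl)
  (λ { (a , b) (k ∷ []) eq → cong (_, b)
       (trans (cong (λ i → i ℤ.+ + 1 ℤ.+ b) (sym (Vec.∷-injectiveˡ eq))) (ℤ-id.shear-point a b)) })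

shear-indicator : ∀ l → Embedding.indicator shear-embedding l ≡ δ 1₃ (χ l)
shear-indicator l@(m , n) = trans (divisible-substitute shear-forms (vec l))
  (trans (check (res m) (res n)) (sym (cong (δ 1₃) (res-⟦⟧ χ-form (vec l)))))
  where
  check : ∀ a b → divisible₃ (substitute₃ shear-forms (a ∷ b ∷ [])) ≡ δ 1₃ (⟦ χ-form ⟧₃ (a ∷ b ∷ []))
  check = from-yes (Fin3² (λ r → divisible₃ (substitute₃ shear-forms r)) (λ r → δ 1₃ (⟦ χ-form ⟧₃ r)))

-- (x , y , z) ↦ (u , v , w) is 1/√-3 times the unitary 3 × 3 Fourier matrix, applied
-- to (1 + 3 x , 1 + 3 y , 1 + 3 z), up to a unit.

fourier : L³ → L³
fourier ((x₁ , x₂) , (y₁ , y₂) , (z₁ , z₂)) =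
  (+ 1 ℤ.+ x₁ ℤ.+ y₁ ℤ.+ z₁ , x₂ ℤ.+ y₂ ℤ.+ z₂) ,
  (x₁ ℤ.+ (ℤ.- y₁ ℤ.- y₂) ℤ.+ z₂ , x₂ ℤ.+ y₁ ℤ.+ (ℤ.- z₁ ℤ.- z₂)) ,
  (x₁ ℤ.+ y₂ ℤ.+ (ℤ.- z₁ ℤ.- z₂) , x₂ ℤ.+ (ℤ.- y₁ ℤ.- y₂) ℤ.+ z₁)

v₂ v₃ v₄ v₅ : Lin 6
v₂ = var (suc (suc zero))
v₃ = var (suc (suc (suc zero)))
v₄ = var (suc (suc (suc (suc zero))))
v₅ = var (suc (suc (suc (suc (suc zero)))))

-- The conjugate Fourier matrix applied to (u , v , w), minus the offset 1 in each component. On the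
-- image of `fourier` these forms are 3 x, 3 y and 3 z.
fourier-forms : Vec (Lin 6) 6
fourier-forms =
  (v₀ ⊞ v₂ ⊞ v₄ ⊞ ⊟ one) ∷ (v₁ ⊞ v₃ ⊞ v₅) ∷
  (v₀ ⊞ v₃ ⊞ (⊟ v₄ ⊞ ⊟ v₅) ⊞ ⊟ one) ∷ (v₁ ⊞ (⊟ v₂ ⊞ ⊟ v₃) ⊞ v₄) ∷
  (v₀ ⊞ (⊟ v₂ ⊞ ⊟ v₃) ⊞ v₅ ⊞ ⊟ one) ∷ (v₁ ⊞ v₂ ⊞ (⊟ v₄ ⊞ ⊟ v₅)) ∷ []

unvec³ : Vec ℤ 6 → L³
unvec³ (a ∷ b ∷ c ∷ d ∷ e ∷ f ∷ []) = (a , b) , (c , d) , (e , f)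

fourier-embedding : Embedding L³ L³
fourier-embedding = lattice-embedding vec³ fourier-forms fourier (λ ks _ → unvec³ ks) vec³
  (λ ((a , b) , (c , d) , (e , f)) →
    cong₂ _∷_ (ℤ-id.fourier₁ a b c d e f) (cong₂ _∷_ (ℤ-id.fourier₂ a b c d e f)
    (cong₂ _∷_ (ℤ-id.fourier₃ a b c d e f) (cong₂ _∷_ (ℤ-id.fourier₄ a b c d e f)
    (cong₂ _∷_ (ℤ-id.fourier₅ a b c d e f) (cong₂ _∷_ (ℤ-id.fourier₆ a b c d e f) refl))))))
  (λ _ → refl)
  λ { ((a , b) , (c , d) , (e , f)) ks@(k₁ ∷ k₂ ∷ k₃ ∷ k₄ ∷ k₅ ∷ k₆ ∷ []) eq →
    -- Only the triples of the parameters `ks` are known, through `eq`. Each coordinate equation is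
    -- therefore proved after multiplication by 3, when both sides become expressions `G` in the
    -- values of the forms.
    let recover : (G : Vec ℤ 6 → ℤ) → ∀ {i j} → + 3 ℤ.* i ≡ G (Vec.map (+ 3 ℤ.*_) ks) →
          G (substitute fourier-forms (a ∷ b ∷ c ∷ d ∷ e ∷ f ∷ [])) ≡ + 3 ℤ.* j → i ≡ j
        recover G p r = 3*-injective (trans p (trans (cong G (sym eq)) r))
    in cong₂ _,_
      (cong₂ _,_
        (recover (λ { (l₁ ∷ l₂ ∷ l₃ ∷ l₄ ∷ l₅ ∷ l₆ ∷ []) → + 3 ℤ.+ l₁ ℤ.+ l₃ ℤ.+ l₅ })
          (ℤ-id.triple-1+++ k₁ k₃ k₅) (ℤ-id.inverse₁ a b c d e f))
        (recover (λ { (l₁ ∷ l₂ ∷ l₃ ∷ l₄ ∷ l₅ ∷ l₆ ∷ []) → l₂ ℤ.+ l₄ ℤ.+ l₆ })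
          (ℤ-id.triple-++ k₂ k₄ k₆) (ℤ-id.inverse₂ a b c d e f)))
      (cong₂ _,_
        (cong₂ _,_
          (recover (λ { (l₁ ∷ l₂ ∷ l₃ ∷ l₄ ∷ l₅ ∷ l₆ ∷ []) → l₁ ℤ.+ (ℤ.- l₃ ℤ.- l₄) ℤ.+ l₆ })
            (ℤ-id.triple-+-+ k₁ k₃ k₄ k₆) (ℤ-id.inverse₃ a b c d e f))
          (recover (λ { (l₁ ∷ l₂ ∷ l₃ ∷ l₄ ∷ l₅ ∷ l₆ ∷ []) → l₂ ℤ.+ l₃ ℤ.+ (ℤ.- l₅ ℤ.- l₆) })
            (ℤ-id.triple-++- k₂ k₃ k₅ k₆) (ℤ-id.inverse₄ a b c d e f)))
        (cong₂ _,_
          (recover (λ { (l₁ ∷ l₂ ∷ l₃ ∷ l₄ ∷ l₅ ∷ l₆ ∷ []) → l₁ ℤ.+ l₄ ℤ.+ (ℤ.- l₅ ℤ.- l₆) })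
            (ℤ-id.triple-++- k₁ k₄ k₅ k₆) (ℤ-id.inverse₅ a b c d e f))
          (recover (λ { (l₁ ∷ l₂ ∷ l₃ ∷ l₄ ∷ l₅ ∷ l₆ ∷ []) → l₂ ℤ.+ (ℤ.- l₃ ℤ.- l₄) ℤ.+ l₅ })
            (ℤ-id.triple-+-+ k₂ k₃ k₄ k₅) (ℤ-id.inverse₆ a b c d e f)))) }

-- As ω ≡ 1 modulo √-3, neither map changes the residues χ. The sum u + v + w grows under `ρ` by (ω
-- - 1)(u + (ω + 1) w), which modulo 3 is ω - 1 if u - w ≡ 1 modulo √-3. So it passes cyclically
-- through the classes of 1, ω and ω² modulo 3.
ρ ρ⁻¹ : L³ → L³
ρ   (u , v , w) = ω· u  , v , ω²· w
ρ⁻¹ (u , v , w) = ω²· u , v , ω· w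

ρρ⁻¹ : ∀ i → ρ (ρ⁻¹ i) ≡ i
ρρ⁻¹ (u , v , w) = cong₂ (λ u w → u , v , w) (ωω² u) (ω²ω w)

ρ⁻¹ρ : ∀ i → ρ⁻¹ (ρ i) ≡ i
ρ⁻¹ρ (u , v , w) = cong₂ (λ u w → u , v , w) (ω²ω u) (ωω² w)

fourier-ρ fourier-ρ⁻¹ : Embedding L³ L³
fourier-ρ   = rotate ρ ρ⁻¹ ρρ⁻¹ ρ⁻¹ρ fourier-embedding
fourier-ρ⁻¹ = rotate ρ⁻¹ ρ ρ⁻¹ρ ρρ⁻¹ fourier-embedding

ρ-forms ρ⁻¹-forms : Vec (Lin 6) 6
ρ-forms   = (⊟ v₀ ⊞ ⊟ v₁) ∷ v₀ ∷ v₂ ∷ v₃ ∷ v₅ ∷ (⊟ v₄ ⊞ ⊟ v₅) ∷ []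
ρ⁻¹-forms = v₁ ∷ (⊟ v₀ ⊞ ⊟ v₁) ∷ v₂ ∷ v₃ ∷ (⊟ v₄ ⊞ ⊟ v₅) ∷ v₄ ∷ []

χᵤ χᵥ χw : Lin 6
χᵤ = v₀ ⊞ ⊟ v₁
χᵥ = v₂ ⊞ ⊟ v₃
χw = v₄ ⊞ ⊟ v₅

-- The three summands are the triples of residues that v ≡ w ≡ u - 1 permits. They yield γ α², γ γ²
-- and α γ² in this order.
classes : Fin 3 → Fin 3 → Fin 3 → ℕ
classes a b c = δ 1₃ a ℕ.* (δ 0₃ b ℕ.* δ 0₃ c) ℕ.+ δ 2₃ a ℕ.* (δ 1₃ b ℕ.* δ 1₃ c) ℕ.+ δ 0₃ a ℕ.* (δ 2₃ b ℕ.* δ 2₃ c)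

-- The images of the three rotated embeddings partition
-- {χ v = χ w = χ u - 1}: u + v + w runs modulo 3 through the rotations.
fourier-partition : ∀ u v w →
  Embedding.indicator fourier-embedding (u , v , w) ℕ.+ Embedding.indicator fourier-ρ (u , v , w)
    ℕ.+ Embedding.indicator fourier-ρ⁻¹ (u , v , w)
  ≡ classes (χ u) (χ v) (χ w)
fourier-partition u@(a , b) v@(c , d) w@(e , f) = trans
  (cong₂ ℕ._+_ (cong₂ ℕ._+_ (divisible-substitute fourier-forms i) (rotated ρ⁻¹-forms)) (rotated ρ-forms))
  (trans (check (res a) (res b) (res c) (res d) (res e) (res f))
    (sym (cong₂ (λ r (s , t) → classes r s t) (res-⟦⟧ χᵤ i) (cong₂ _,_ (res-⟦⟧ χᵥ i) (res-⟦⟧ χw i)))))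
  where
  i : Vec ℤ 6
  i = vec³ (u , v , w)
  rotated : ∀ es → divisible (substitute fourier-forms (substitute es i)) ≡
    divisible₃ (substitute₃ fourier-forms (substitute₃ es (Vec.map res i)))
  rotated es = trans (divisible-substitute fourier-forms (substitute es i))
    (cong (λ r → divisible₃ (substitute₃ fourier-forms r)) (res-substitute es i))
  images : Vec (Fin 3) 6 → ℕ
  images r = divisible₃ (substitute₃ fourier-forms r)
    ℕ.+ divisible₃ (substitute₃ fourier-forms (substitute₃ ρ⁻¹-forms r))
    ℕ.+ divisible₃ (substitute₃ fourier-forms (substitute₃ ρ-forms r))
  check : ∀ a b c d e f → images (a ∷ b ∷ c ∷ d ∷ e ∷ f ∷ []) ≡
    classes (⟦ χᵤ ⟧₃ (a ∷ b ∷ c ∷ d ∷ e ∷ f ∷ [])) (⟦ χᵥ ⟧₃ (a ∷ b ∷ c ∷ d ∷ e ∷ f ∷ [])) (⟦ χw ⟧₃ (a ∷ b ∷ c ∷ d ∷ e ∷ f ∷ []))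
  check = from-yes (Fin.all? λ a → Fin.all? λ b → Fin.all? λ c → Fin.all? λ d → Fin.all? λ e → Fin.all? λ f →
    images (a ∷ b ∷ c ∷ d ∷ e ∷ f ∷ []) ℕ.≟
    classes (⟦ χᵤ ⟧₃ (a ∷ b ∷ c ∷ d ∷ e ∷ f ∷ [])) (⟦ χᵥ ⟧₃ (a ∷ b ∷ c ∷ d ∷ e ∷ f ∷ [])) (⟦ χw ⟧₃ (a ∷ b ∷ c ∷ d ∷ e ∷ f ∷ [])))

-- Norms

norm-ω : ∀ l → norm (ω· l) ≡ norm l
norm-ω (m , n) = ℤ-id.norm-ω m n

norm-ω² : ∀ l → norm (ω²· l) ≡ norm l
norm-ω² (m , n) = ℤ-id.norm-ω² m n

norm-√-3 : ∀ l → norm (√-3· l) ≡ + 3 ℤ.* norm l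
norm-√-3 (m , n) = ℤ-id.norm-√-3 m n

∣norm∣ : L → ℕ
∣norm∣ l = ℤ.∣ norm l ∣

+∣norm∣ : ∀ l → + ∣norm∣ l ≡ norm l
+∣norm∣ l = ℤ.0≤i⇒+∣i∣≡i (norm-nonneg l)

norm-fourier : ∀ x y z → let (u , v , w) = fourier (x , y , z) in
  3 ℕ.* (∣norm∣ u ℕ.+ (∣norm∣ v ℕ.+ ∣norm∣ w)) ≡ ∣norm∣ (1+3· x) ℕ.+ (∣norm∣ (1+3· y) ℕ.+ ∣norm∣ (1+3· z))
norm-fourier x@(a , b) y@(c , d) z@(e , f) = ℤ.+-injective (begin
  + (3 ℕ.* (∣norm∣ u ℕ.+ (∣norm∣ v ℕ.+ ∣norm∣ w)))       ≡⟨ ℤ.pos-* 3 (∣norm∣ u ℕ.+ (∣norm∣ v ℕ.+ ∣norm∣ w)) ⟩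
  + 3 ℤ.* (+ ∣norm∣ u ℤ.+ (+ ∣norm∣ v ℤ.+ + ∣norm∣ w))
    ≡⟨ cong (+ 3 ℤ.*_) (cong₂ ℤ._+_ (+∣norm∣ u) (cong₂ ℤ._+_ (+∣norm∣ v) (+∣norm∣ w))) ⟩
  + 3 ℤ.* (norm u ℤ.+ (norm v ℤ.+ norm w))               ≡⟨ ℤ-id.norm-fourier a b c d e f ⟩
  norm (1+3· x) ℤ.+ (norm (1+3· y) ℤ.+ norm (1+3· z))
    ≡⟨ cong₂ ℤ._+_ (+∣norm∣ (1+3· x)) (cong₂ ℤ._+_ (+∣norm∣ (1+3· y)) (+∣norm∣ (1+3· z))) ⟨
  + ∣norm∣ (1+3· x) ℤ.+ (+ ∣norm∣ (1+3· y) ℤ.+ + ∣norm∣ (1+3· z)) ∎)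
  where
  open ≡.≡-Reasoning
  u v w : L
  u = proj₁ (fourier (x , y , z))
  v = proj₁ (proj₂ (fourier (x , y , z)))
  w = proj₂ (proj₂ (fourier (x , y , z)))

-- Theta series of the lattice and the two cubic identities

module Identity where
  open C
  open Analysis

  open CommutativeRing ℂ-ring using (*-assoc; *-comm; *-cong; *-congʳ; *-congˡ; *-identityʳ; *-identityˡ; +-cong; +-congʳ; +-congˡ; +-identityʳ; +-identityˡ; distribʳ; setoid; zeroʳ; zeroˡ)
    renaming (refl to ≈-refl)

  3ℂ : ℂ
  3ℂ = (1ℂ + 1ℂ) + 1ℂ

  _≟L²_ : DecidableEquality (L × L)
  _≟L²_ = ≡-dec _≟ℤ²_ _≟ℤ²_

  _≟L³_ : DecidableEquality L³
  _≟L³_ = ≡-dec _≟ℤ²_ _≟L²_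

  finite-bound : (c : Fin 3 → ℂ) → ∃[ B ] ∃[ N ] (∀ n → N ℕ.≤ n → ∀ k → ‖ c k ‖ n Q.≤ B)
  finite-bound c = go (≺-bound (c 0₃)) (≺-bound (c 1₃)) (≺-bound (c 2₃))
    where
    go : ∃[ A ] c 0₃ ≺ A → ∃[ B ] c 1₃ ≺ B → ∃[ D ] c 2₃ ≺ D → ∃[ B ] ∃[ N ] (∀ n → N ℕ.≤ n → ∀ k → ‖ c k ‖ n Q.≤ B)
    go (A , p₀@(mk≺ M h₀)) (B , p₁@(mk≺ N h₁)) (D , p₂@(mk≺ O h₂)) =
      (A Q.+ B) Q.+ D , M ℕ.⊔ (N ℕ.⊔ O) , λ n ≤n →
        let M≤ = ℕ.m⊔n≤o⇒m≤o M (N ℕ.⊔ O) ≤n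
            NO≤ = ℕ.m⊔n≤o⇒n≤o M (N ℕ.⊔ O) ≤n
        in λ { zero             → Q.≤-trans (h₀ n M≤) (≤-gap (B Q.+ D) (+-nonneg (≺-nonneg p₁) (≺-nonneg p₂)) (sym (Q.+-assoc A B D)))
             ; (suc zero)       → Q.≤-trans (h₁ n (ℕ.m⊔n≤o⇒m≤o N O NO≤)) (≤-gap (A Q.+ D) (+-nonneg (≺-nonneg p₀) (≺-nonneg p₂)) (ℚ-id.middle A B D))
             ; (suc (suc zero)) → Q.≤-trans (h₂ n (ℕ.m⊔n≤o⇒n≤o N O NO≤)) (≤-gap (A Q.+ B) (+-nonneg (≺-nonneg p₀) (≺-nonneg p₁)) (Q.+-comm D (A Q.+ B))) }

  dominated-weighted : {I : Set} (c : Fin 3 → ℂ) (κ : I → Fin 3) → I → {f : I → ℂ} → Dominated f → Dominated (λ i → c (κ i) * f i)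
  dominated-weighted c κ i₀ d = dominated-* (proj₂ (finite-bound c)) κ i₀ d

  ι-sum₃ : ∀ a b c {d} z → a ℕ.+ b ℕ.+ c ≡ d → (ι a * z + ι b * z) + ι c * z ≈ ι d * z
  ι-sum₃ a b c {d} z refl = begin
    (ι a * z + ι b * z) + ι c * z   ≈⟨ +-congʳ (distribʳ z (ι a) (ι b)) ⟨
    (ι a + ι b) * z + ι c * z       ≈⟨ distribʳ z (ι a + ι b) (ι c) ⟨
    ((ι a + ι b) + ι c) * z         ≈⟨ *-congʳ (≈-trans (ι-+ (a ℕ.+ b) c) (+-congʳ (ι-+ a b))) ⟨
    ι (a ℕ.+ b ℕ.+ c) * z           ∎
    where open SetoidReasoning setoid

  theta : ℂ → L → ℂ
  theta q l = q ^ ∣norm∣ l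

  theta-norm : ∀ q l l′ → norm l ≡ norm l′ → theta q l ≈ theta q l′
  theta-norm q l l′ eq = ≡⇒≈ (cong (λ i → q ^ ℤ.∣ i ∣) eq)

  module Theta (q : ℂ) (small : Small q) where

    class-term : Fin 3 → L → ℂ
    class-term j l = ι (δ j (χ l)) * theta q l

    theta-dominated : Dominated (theta q)
    theta-dominated = norm-dominated small

    class-dominated : ∀ j → Dominated (class-term j)
    class-dominated j = dominated-weighted (λ r → ι (δ j r)) χ (+ 0 , + 0) theta-dominated

    class-sum : ∀ j → ∃[ s ] Converges (class-term j) s
    class-sum j = dominated⇒converges _≟ℤ²_ (class-dominated j)

    γ : Fin 3 → ℂ
    γ j = proj₁ (class-sum j)

    γ-converges : ∀ j → Converges (class-term j) (γ j)
    γ-converges j = proj₂ (class-sum j)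

    -- Negation of lattice points preserves norms and exchanges the residues 1 and 2.
    γ₂≈γ₁ : γ 2₃ ≈ γ 1₃
    γ₂≈γ₁ = converges-unique _≟ℤ²_ (γ-converges 2₃)
      (converges-reindex negate negate negate-negate negate-negate (class-term 2₃)
        (converges-cong (λ l → *-cong (≡⇒≈ (cong ι (sym (χ-negate l)))) (theta-norm q l (negate l) (sym (ℤ-id.norm-neg (proj₁ l) (proj₂ l)))))
          ≈-refl (γ-converges 1₃)))
      where
      negate : L → L
      negate (m , n) = ℤ.- m , ℤ.- n
      negate-negate : ∀ l → negate (negate l) ≡ l
      negate-negate (m , n) = cong₂ _,_ (ℤ.neg-involutive m) (ℤ.neg-involutive n)
      χ-negate : ∀ l → δ 2₃ (χ (negate l)) ≡ δ 1₃ (χ l)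
      χ-negate (m , n) = trans (cong (δ 2₃) (trans (cong res (sym (ℤ.neg-distrib-+ m (ℤ.- n)))) (res-neg (m ℤ.- n))))
        (flip (res (m ℤ.- n)))
        where
        flip : ∀ r → δ 2₃ (neg₃ r) ≡ δ 1₃ r
        flip zero             = refl
        flip (suc zero)       = refl
        flip (suc (suc zero)) = refl

    weighted-term : (Fin 3 → ℂ) → L → ℂ
    weighted-term c l = c (χ l) * theta q l

    -- Weights that depend only on the residue modulo √-3. The powers of ω give the first sum of the
    -- first identity, the constant 1 gives the unweighted theta series.
    weighted-sum : ∀ c → Converges (weighted-term c) ((c 0₃ * γ 0₃ + c 1₃ * γ 1₃) + c 2₃ * γ 1₃)
    weighted-sum c = converges-cong term (+-congˡ (*-congˡ γ₂≈γ₁))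
      (converges-+ (converges-+ (converges-*ˡ (c 0₃) (γ-converges 0₃)) (converges-*ˡ (c 1₃) (γ-converges 1₃)))
        (converges-*ˡ (c 2₃) (γ-converges 2₃)))
      where
      pick : ∀ r z → (c 0₃ * (ι (δ 0₃ r) * z) + c 1₃ * (ι (δ 1₃ r) * z)) + c 2₃ * (ι (δ 2₃ r) * z) ≈ c r * z
      pick r z = ≈-trans (+-cong (+-cong (regroup 0₃) (regroup 1₃)) (regroup 2₃)) (go r)
        where
        regroup : ∀ j → c j * (ι (δ j r) * z) ≈ ι (δ j r) * (c j * z)
        regroup j = ≈-id.*-swap (c j) (ι (δ j r)) z
        hit : ∀ {n} x → n ≡ 1 → ι n * x ≈ x
        hit x refl = ≈-trans (*-congʳ ι1) (*-identityˡ x)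
        miss : ∀ {n} x → n ≡ 0 → ι n * x ≈ 0ℂ
        miss x refl = ≈-trans (*-congʳ ι0) (zeroˡ x)
        go : ∀ r → (ι (δ 0₃ r) * (c 0₃ * z) + ι (δ 1₃ r) * (c 1₃ * z)) + ι (δ 2₃ r) * (c 2₃ * z) ≈ c r * z
        go zero             = ≈-trans (+-cong (+-cong (hit (c 0₃ * z) refl) (miss (c 1₃ * z) refl)) (miss (c 2₃ * z) refl))
          (≈-trans (+-identityʳ _) (+-identityʳ _))
        go (suc zero)       = ≈-trans (+-cong (+-cong (miss (c 0₃ * z) refl) (hit (c 1₃ * z) refl)) (miss (c 2₃ * z) refl))
          (≈-trans (+-identityʳ _) (+-identityˡ _))
        go (suc (suc zero)) = ≈-trans (+-cong (+-cong (miss (c 0₃ * z) refl) (miss (c 1₃ * z) refl)) (hit (c 2₃ * z) refl))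
          (≈-trans (+-congʳ (+-identityˡ 0ℂ)) (+-identityˡ _))
      term : ∀ l → (c 0₃ * class-term 0₃ l + c 1₃ * class-term 1₃ l) + c 2₃ * class-term 2₃ l ≈ weighted-term c l
      term l = pick (χ l) (theta q l)

    theta-sum : Converges (theta q) ((γ 0₃ + γ 1₃) + γ 1₃)
    theta-sum = converges-cong (λ l → *-identityˡ (theta q l))
      (+-cong (+-cong (*-identityˡ (γ 0₃)) (*-identityˡ (γ 1₃))) (*-identityˡ (γ 1₃))) (weighted-sum (λ _ → 1ℂ))

    -- The rotations of 1 + 3 L contribute equally to the class χ = 1.
    coset-sum : ∀ {B} → Converges (λ l → theta q (1+3· l)) B → (B + B) + B ≈ γ 1₃
    coset-sum {B} cB = converges-unique _≟ℤ²_
      (converges-cong (λ l → ι-sum₃ (Embedding.indicator coset l) (Embedding.indicator coset-ω l) (Embedding.indicator coset-ω² l)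
          (theta q l) (coset-partition l)) ≈-refl
        (converges-+ (converges-+
          (Pushforward.converges coset (theta q) cB)
          (Pushforward.converges coset-ω (theta q) (converges-cong (λ l → theta-norm q (1+3· l) (ω· (1+3· l)) (sym (norm-ω (1+3· l)))) ≈-refl cB)))
          (Pushforward.converges coset-ω² (theta q) (converges-cong (λ l → theta-norm q (1+3· l) (ω²· (1+3· l)) (sym (norm-ω² (1+3· l)))) ≈-refl cB))))
      (γ-converges 1₃)

    theta³ : L³ → ℂ
    theta³ (u , v , w) = theta q u * (theta q v * theta q w)

    triple-term : Fin 3 → Fin 3 → L³ → ℂ
    triple-term j k (u , v , w) = class-term j u * (class-term k v * class-term k w)

    triple-sum : ∀ j k → Converges (triple-term j k) (γ j * (γ k * γ k))
    triple-sum j k = converges-⊗ _≟ℤ²_ _≟L²_ (class-dominated j)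
      (dominated-⊗ _≟ℤ²_ _≟ℤ²_ (class-dominated k) (class-dominated k)) (γ-converges j)
      (converges-⊗ _≟ℤ²_ _≟ℤ²_ (class-dominated k) (class-dominated k) (γ-converges k) (γ-converges k))

    classes-sum : Converges (λ (u , v , w) → ι (classes (χ u) (χ v) (χ w)) * theta³ (u , v , w))
      ((γ 1₃ * (γ 0₃ * γ 0₃) + γ 1₃ * (γ 1₃ * γ 1₃)) + γ 0₃ * (γ 1₃ * γ 1₃))
    classes-sum = converges-cong term
      (+-cong (+-congˡ (*-congʳ γ₂≈γ₁)) (*-congˡ (*-cong γ₂≈γ₁ γ₂≈γ₁)))
      (converges-+ (converges-+ (triple-sum 1₃ 0₃) (triple-sum 2₃ 1₃)) (triple-sum 0₃ 2₃))
      where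
      product : ∀ a b c x y z → (ι a * x) * ((ι b * y) * (ι c * z)) ≈ ι (a ℕ.* (b ℕ.* c)) * (x * (y * z))
      product a b c x y z = ≈-trans (≈-id.*-regroup₆ (ι a) x (ι b) y (ι c) z)
        (*-congʳ (≈-sym (≈-trans (ι-* a (b ℕ.* c)) (*-congˡ (ι-* b c)))))
      term : ∀ i → (triple-term 1₃ 0₃ i + triple-term 2₃ 1₃ i) + triple-term 0₃ 2₃ i ≈
        ι (classes (χ (proj₁ i)) (χ (proj₁ (proj₂ i))) (χ (proj₂ (proj₂ i)))) * theta³ i
      term (u , v , w) = ≈-trans
        (+-cong (+-cong (product _ _ _ _ _ _) (product _ _ _ _ _ _)) (product _ _ _ _ _ _))
        (ι-sum₃ (δ 1₃ (χ u) ℕ.* (δ 0₃ (χ v) ℕ.* δ 0₃ (χ w))) (δ 2₃ (χ u) ℕ.* (δ 1₃ (χ v) ℕ.* δ 1₃ (χ w)))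
          (δ 0₃ (χ u) ℕ.* (δ 2₃ (χ v) ℕ.* δ 2₃ (χ w))) (theta³ (u , v , w)) refl)

    module _ {r : ℂ} (r³≈q : r ^ 3 ≈ q) (small-r : Small r) where

      coset-term : L → ℂ
      coset-term l = theta r (1+3· l)

      coset-dominated : Dominated coset-term
      coset-dominated = dominated-reindex {f = theta r} (Embedding.to coset) (Embedding.from coset) (Embedding.from-to coset) (norm-dominated small-r)

      theta³-fourier : ∀ x y z → theta³ (fourier (x , y , z)) ≈ coset-term x * (coset-term y * coset-term z)
      theta³-fourier x y z = ≈-id.cube-root-powers r³≈q
        (∣norm∣ (proj₁ (fourier (x , y , z)))) (∣norm∣ (proj₁ (proj₂ (fourier (x , y , z))))) (∣norm∣ (proj₂ (proj₂ (fourier (x , y , z)))))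
        {∣norm∣ (1+3· x)} {∣norm∣ (1+3· y)} {∣norm∣ (1+3· z)} (norm-fourier x y z)

      theta³-ρ : ∀ i → theta³ (ρ i) ≈ theta³ i
      theta³-ρ (u , v , w) = *-cong (theta-norm q (ω· u) u (norm-ω u)) (*-congˡ (theta-norm q (ω²· w) w (norm-ω² w)))

      theta³-ρ⁻¹ : ∀ i → theta³ (ρ⁻¹ i) ≈ theta³ i
      theta³-ρ⁻¹ (u , v , w) = *-cong (theta-norm q (ω²· u) u (norm-ω² u)) (*-congˡ (theta-norm q (ω· w) w (norm-ω w)))

      -- B³ is a sum over L³ which `fourier` carries onto its image. The rotations `ρ` and `ρ⁻¹`
      -- preserve the norms of the components, so each of the three images contributes B³, and their
      -- indicators add up to `classes`.
      cube-identity : ∀ {B} → Converges coset-term B →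
        (B * (B * B) + B * (B * B)) + B * (B * B) ≈
        (γ 1₃ * (γ 0₃ * γ 0₃) + γ 1₃ * (γ 1₃ * γ 1₃)) + γ 0₃ * (γ 1₃ * γ 1₃)
      cube-identity {B} cB = converges-unique _≟L³_
        (converges-cong (λ i@(u , v , w) → ι-sum₃ (Embedding.indicator fourier-embedding i) (Embedding.indicator fourier-ρ i)
            (Embedding.indicator fourier-ρ⁻¹ i) (theta³ i) (fourier-partition u v w)) ≈-refl
          (converges-+ (converges-+
            (Pushforward.converges fourier-embedding theta³ pulled)
            (Pushforward.converges fourier-ρ theta³ (converges-cong (λ i → ≈-sym (theta³-ρ (fourier i))) ≈-refl pulled)))
            (Pushforward.converges fourier-ρ⁻¹ theta³ (converges-cong (λ i → ≈-sym (theta³-ρ⁻¹ (fourier i))) ≈-refl pulled))))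
        classes-sum
        where
        pulled : Converges (λ i → theta³ (fourier i)) (B * (B * B))
        pulled = converges-cong (λ (x , y , z) → ≈-sym (theta³-fourier x y z)) ≈-refl
          (converges-⊗ _≟ℤ²_ _≟L²_ coset-dominated (dominated-⊗ _≟ℤ²_ _≟ℤ²_ coset-dominated coset-dominated) cB
            (converges-⊗ _≟ℤ²_ _≟ℤ²_ coset-dominated coset-dominated cB cB))

  -- Powers of a cube root of unity

  module CubeRoot (w : ℂ) (root : (1ℂ + w) + w * w ≈ 0ℂ) (cube : (w * w) * w ≈ 1ℂ) where

    ŵ : Fin 3 → ℂ
    ŵ zero             = 1ℂ
    ŵ (suc zero)       = w
    ŵ (suc (suc zero)) = w * w

    cubic-theta : ∀ {q r} (small : Small q) (r³≈q : r ^ 3 ≈ q) {A B C : ℂ} →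
      Converges (λ l → ŵ (χ l) * theta q l) A → Converges (λ l → theta r (1+3· l)) B → Converges (theta q) C →
      A ^ 3 + (3ℂ * B) ^ 3 ≈ C ^ 3
    cubic-theta {q} {r} small r³≈q {A} {B} {C} cA cB cC = ≈-id.cubic-identity A B C (γ 0₃) (γ 1₃)
      (≈-trans (+-congʳ (converges-unique _≟ℤ²_ cA (weighted-sum ŵ)))
        (≈-trans (≈-id.root-sum w (γ 0₃) (γ 1₃)) (≈-trans (+-congˡ (≈-trans (*-congʳ root) (zeroˡ (γ 1₃)))) (+-identityʳ (γ 0₃)))))
      (converges-unique _≟ℤ²_ cC theta-sum)
      (cube-identity r³≈q (small-root r³≈q small) cB)
      where open Theta q small

    average : Fin 3 → Fin 3 → ℂ
    average a b = (ŵ (neg₃ (add₃ a b)) + ŵ a) + ŵ b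

    -- The three exponents -(a + b), a and b add up to 0 modulo 3, so they are either all equal,
    -- which happens for a = b, or all distinct, when the powers cancel by 1 + ω + ω² = 0.
    average≈ : ∀ a b → average a b ≈ 3ℂ * (ι (δ 0₃ (add₃ a (neg₃ b))) * ŵ a)
    average≈ = λ
      { zero             zero             → hit 1ℂ
      ; zero             (suc zero)       → miss 1ℂ (≈-id.permute-201 1ℂ w (w * w))
      ; zero             (suc (suc zero)) → miss 1ℂ (≈-id.permute-102 1ℂ w (w * w))
      ; (suc zero)       zero             → miss w (≈-id.permute-210 1ℂ w (w * w))
      ; (suc zero)       (suc zero)       → hit w
      ; (suc zero)       (suc (suc zero)) → miss w ≈-refl
      ; (suc (suc zero)) zero             → miss (w * w) (≈-id.permute-120 1ℂ w (w * w))
      ; (suc (suc zero)) (suc zero)       → miss (w * w) (≈-id.permute-021 1ℂ w (w * w))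
      ; (suc (suc zero)) (suc (suc zero)) → hit (w * w) }
      where
      hit : ∀ z → (z + z) + z ≈ 3ℂ * (ι 1 * z)
      hit z = ≈-trans (≈-id.triple z) (*-congˡ (≈-sym (≈-trans (*-congʳ ι1) (*-identityˡ z))))
      miss : ∀ z {s} → s ≈ (1ℂ + w) + w * w → s ≈ 3ℂ * (ι 0 * z)
      miss z eq = ≈-trans eq (≈-trans root
        (≈-sym (≈-trans (*-congˡ (≈-trans (*-congʳ ι0) (zeroˡ z))) (zeroʳ 3ℂ))))

    -- The exponent of ω in the second identity after the substitution k = m + n: there m - n = 2 m
    -- - k, which is -m - k modulo 3.
    χ′ : L → Fin 3
    χ′ (m , n) = res (ℤ.- m ℤ.- n)

    fst₃ : L → Fin 3
    fst₃ (m , _) = res m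

    -- Rotating the lattice moves the weight from -m - n to m and to n without changing the sum.
    -- Adding the three versions filters out the points with nonzero residue modulo √-3.
    average-sum : ∀ {q s} → Converges (λ l → ŵ (χ′ l) * theta q l) s →
      Converges (λ l → 3ℂ * (ι (δ 0₃ (χ l)) * (ŵ (fst₃ l) * theta q l))) ((s + s) + s)
    average-sum {q} {s} cs = converges-cong term ≈-refl (converges-+ (converges-+ cs first) second)
      where
      -- χ′ is the first coordinate of ω· l and the second coordinate of ω²· l.
      first : Converges (λ l → ŵ (fst₃ l) * theta q l) s
      first = converges-reindex ω· ω²· ω²ω ωω² (λ l → ŵ (fst₃ l) * theta q l)
        (converges-cong (λ l → *-congˡ (theta-norm q l (ω· l) (sym (norm-ω l)))) ≈-refl cs)
      second : Converges (λ l → ŵ (res (proj₂ l)) * theta q l) s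
      second = converges-reindex ω²· ω· ωω² ω²ω (λ l → ŵ (res (proj₂ l)) * theta q l)
        (converges-cong (λ l → *-congˡ (theta-norm q l (ω²· l) (sym (norm-ω² l)))) ≈-refl cs)
      term : ∀ l → (ŵ (χ′ l) * theta q l + ŵ (fst₃ l) * theta q l) + ŵ (res (proj₂ l)) * theta q l ≈
        3ℂ * (ι (δ 0₃ (χ l)) * (ŵ (fst₃ l) * theta q l))
      term l@(m , n) = begin
        (ŵ (χ′ l) * theta q l + ŵ (res m) * theta q l) + ŵ (res n) * theta q l
          ≈⟨ ≈-id.factor₃ (ŵ (χ′ l)) (ŵ (res m)) (ŵ (res n)) (theta q l) ⟩
        ((ŵ (χ′ l) + ŵ (res m)) + ŵ (res n)) * theta q l
          ≡⟨ cong (λ r → ((ŵ r + ŵ (res m)) + ŵ (res n)) * theta q l)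
               (trans (cong res (sym (ℤ.neg-distrib-+ m n))) (trans (res-neg (m ℤ.+ n)) (cong neg₃ (res-+ m n)))) ⟩
        average (res m) (res n) * theta q l
          ≈⟨ *-congʳ (average≈ (res m) (res n)) ⟩
        (3ℂ * (ι (δ 0₃ (add₃ (res m) (neg₃ (res n)))) * ŵ (res m))) * theta q l
          ≡⟨ cong (λ r → (3ℂ * (ι (δ 0₃ r) * ŵ (res m))) * theta q l) (res-⟦⟧ χ-form (vec l)) ⟨
        (3ℂ * (ι (δ 0₃ (χ l)) * ŵ (res m))) * theta q l
          ≈⟨ ≈-id.reassociate 3ℂ (ι (δ 0₃ (χ l))) (ŵ (res m)) (theta q l) ⟩
        3ℂ * (ι (δ 0₃ (χ l)) * (ŵ (res m) * theta q l)) ∎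
        where open SetoidReasoning setoid

    -- Multiplication by √-3 triples the norm, so the series at q³ runs over the multiples of √-3 in
    -- the series at q.
    √-3-sum : ∀ {q s} → Converges (λ l → ŵ (χ l) * theta (q ^ 3) l) s →
      Converges (λ l → ι (δ 0₃ (χ l)) * (ŵ (fst₃ l) * theta q l)) s
    √-3-sum {q} {s} cs = converges-cong (λ l → *-congʳ (≡⇒≈ (cong ι (√-3-indicator l)))) ≈-refl
      (Pushforward.converges √-3-embedding (λ l → ŵ (fst₃ l) * theta q l)
        (converges-cong term ≈-refl cs))
      where
      term : ∀ l → ŵ (χ l) * theta (q ^ 3) l ≈ ŵ (fst₃ (√-3· l)) * theta q (√-3· l)
      term l@(m , n) = *-cong (≡⇒≈ (cong ŵ residue))
        (≈-trans (^-assocʳ q 3 (∣norm∣ l)) (≡⇒≈ (cong (q ^_) (sym (trans (cong ℤ.∣_∣ (norm-√-3 l)) (ℤ.abs-* (+ 3) (norm l)))))))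
        where
        -- The first coordinate of the image is m + 2 n ≡ m - n; with this choice of unit in `√-3·`,
        -- the residue appears without a sign.
        residue : χ l ≡ fst₃ (√-3· l)
        residue = sym (trans (cong res (ℤ-id.mod-3 m n)) (trans (res-+ (m ℤ.- n) (+ 3 ℤ.* n))
          (trans (cong (add₃ (res (m ℤ.- n))) (res-3* n)) (add₃-identityʳ (res (m ℤ.- n))))))

    average-sum-unique : ∀ {q s t} → Converges (λ l → ŵ (χ′ l) * theta q l) s →
      Converges (λ l → ŵ (χ l) * theta (q ^ 3) l) t → s ≈ t
    average-sum-unique {q} {s} {t} cs ct = begin
      s                                             ≈⟨ third-triple s ⟨
      -- The averaging has proved 3 s = 3 t, and `recip 2` is one third.
      ℚ→ℂ (recip 2) * ((s + s) + s)                 ≈⟨ *-congˡ (converges-unique _≟ℤ²_ (average-sum cs) (converges-*ˡ 3ℂ (√-3-sum ct))) ⟩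
      ℚ→ℂ (recip 2) * (3ℂ * t)        ≈⟨ *-congˡ (≈-id.triple t) ⟨
      ℚ→ℂ (recip 2) * ((t + t) + t)                 ≈⟨ third-triple t ⟩
      t                                             ∎
      where
      open SetoidReasoning setoid
      nat-3 : natℂ 3 ≈ (1ℂ + 1ℂ) + 1ℂ
      nat-3 = ≈-trans (natℂ-+ 2 1) (+-cong (≈-trans (natℂ-+ 1 1) (+-cong nat-1 nat-1)) nat-1)
        where
        nat-1 : natℂ 1 ≈ 1ℂ
        nat-1 = ≡⇒≈ (cong ℚ→ℂ (trans (Q.nat-suc 0) (trans (cong (λ p → 1ℚ Q.+ p) Q.nat-0) (Q.+-identityʳ 1ℚ))))
      third-triple : ∀ z → ℚ→ℂ (recip 2) * ((z + z) + z) ≈ z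
      third-triple z = begin
        ℚ→ℂ (recip 2) * ((z + z) + z)               ≈⟨ *-congˡ (≈-id.triple z) ⟩
        ℚ→ℂ (recip 2) * (3ℂ * z)      ≈⟨ *-assoc _ _ z ⟨
        (ℚ→ℂ (recip 2) * 3ℂ) * z      ≈⟨ *-congʳ (≈-trans (*-congˡ (≈-sym nat-3)) (natℂ-inverse 2)) ⟩
        1ℂ * z                                      ≈⟨ *-identityˡ z ⟩
        z                                           ∎

  -- Integers inside ℚ

  opaque
    unfolding Q._+_

    fromℤ : ℤ → ℚ
    fromℤ i = i ℚ./ 1

    fromℤ≡ : ∀ i → fromℤ i ≡ mkℚ i 0 (Coprimality.sym (1-coprimeTo ℤ.∣ i ∣))
    fromℤ≡ i = ℚ.↥p/↧p≡p (mkℚ i 0 (Coprimality.sym (1-coprimeTo ℤ.∣ i ∣)))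

    ↥-fromℤ : ∀ i → ℚ.numerator (fromℤ i) ≡ i
    ↥-fromℤ i = cong ℚ.numerator (fromℤ≡ i)

    fromℤ-+ : ∀ i j → fromℤ (i ℤ.+ j) ≡ fromℤ i Q.+ fromℤ j
    fromℤ-+ i j = sym (trans (cong₂ ℚ._+_ (fromℤ≡ i) (fromℤ≡ j))
      (cong (ℚ._/ 1) (cong₂ ℤ._+_ (ℤ.*-identityʳ i) (ℤ.*-identityʳ j))))

    fromℤ-* : ∀ i j → fromℤ (i ℤ.* j) ≡ fromℤ i Q.* fromℤ j
    fromℤ-* i j = sym (cong₂ ℚ._*_ (fromℤ≡ i) (fromℤ≡ j))

    fromℤ-def : ∀ i → i ℚ./ 1 ≡ fromℤ i
    fromℤ-def i = refl

    fromℤ-1 : fromℤ (+ 1) ≡ 1ℚ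
    fromℤ-1 = refl

    fromℤ-3*⅓ : fromℤ (+ 3) Q.* ⅓ ≡ 1ℚ
    fromℤ-3*⅓ = refl

    3/1≡3 : + 3 ℚ./ 1 ≡ (1ℚ Q.+ 1ℚ) Q.+ 1ℚ
    3/1≡3 = refl

  fromℤ-norm : ∀ m n → fromℤ (norm (m , n)) ≡
    (fromℤ m Q.* fromℤ m Q.+ fromℤ m Q.* fromℤ n) Q.+ fromℤ n Q.* fromℤ n
  fromℤ-norm m n = trans (fromℤ-+ _ _) (cong₂ Q._+_ (trans (fromℤ-+ _ _) (cong₂ Q._+_ (fromℤ-* m m) (fromℤ-* m n))) (fromℤ-* n n))

  3x : ∀ m → fromℤ (+ 3) Q.* (fromℤ m Q.+ ⅓) ≡ fromℤ (+ 1 ℤ.+ + 3 ℤ.* m)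
  3x m = trans (Q.*-distribˡ-+ (fromℤ (+ 3)) (fromℤ m) ⅓)
    (trans (cong (λ p → fromℤ (+ 3) Q.* fromℤ m Q.+ p) (trans fromℤ-3*⅓ (sym fromℤ-1)))
      (trans (Q.+-comm (fromℤ (+ 3) Q.* fromℤ m) (fromℤ (+ 1)))
        (sym (trans (fromℤ-+ (+ 1) (+ 3 ℤ.* m)) (cong (λ p → fromℤ (+ 1) Q.+ p) (fromℤ-* (+ 3) m))))))

  norm-form shear-form : (_⊕_ _⊛_ : ℚ → ℚ → ℚ) → ℚ → ℚ → ℚ → ℚ
  norm-form  _⊕_ _⊛_ k x y = k ⊛ (k ⊛ (((x ⊛ x) ⊕ (x ⊛ y)) ⊕ (y ⊛ y)))
  shear-form _⊕_ _⊛_ k x y = k ⊛ (k ⊛ (((k ⊛ (x ⊛ x)) ⊕ (k ⊛ (x ⊛ y))) ⊕ (y ⊛ y)))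

  norm-form-defs : ∀ {_⊕_ _⊛_} → ℚ._+_ ≡ _⊕_ → ℚ._*_ ≡ _⊛_ → ∀ k x y →
    k ℚ.* (k ℚ.* (x ℚ.* x ℚ.+ x ℚ.* y ℚ.+ y ℚ.* y)) ≡ norm-form _⊕_ _⊛_ k x y
  norm-form-defs refl refl k x y = refl

  shear-form-defs : ∀ {_⊕_ _⊛_} → ℚ._+_ ≡ _⊕_ → ℚ._*_ ≡ _⊛_ → ∀ k x y →
    k ℚ.* (k ℚ.* (k ℚ.* (x ℚ.* x) ℚ.+ k ℚ.* (x ℚ.* y) ℚ.+ y ℚ.* y)) ≡ shear-form _⊕_ _⊛_ k x y
  shear-form-defs refl refl k x y = refl

  +ℚ-cong-defs : ∀ {_⊕_ : ℚ → ℚ → ℚ} {a a′} → ℚ._+_ ≡ _⊕_ → a ≡ a′ → ∀ b → a ℚ.+ b ≡ a′ ⊕ b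
  +ℚ-cong-defs refl refl b = refl

  form-cong : (f : ℚ → ℚ → ℚ → ℚ) → ∀ {k k′ x x′ y y′} → k ≡ k′ → x ≡ x′ → y ≡ y′ → f k x y ≡ f k′ x′ y′
  form-cong f refl refl refl = refl

  -- The exponent is 3 N(m + 1/3 , n), and three times it is 9 N(m + 1/3 , n) = N(3 m + 1 , 3 n).
  norm-form≡ : ∀ m n → norm-form Q._+_ Q._*_ (fromℤ (+ 3)) (fromℤ m Q.+ ⅓) (fromℤ n) ≡ fromℤ (norm (1+3· (m , n)))
  norm-form≡ m n = trans (ℚ-id.scale-norm (fromℤ (+ 3)) (fromℤ m Q.+ ⅓) (fromℤ n))
    (trans (cong₂ (λ X Y → (X Q.* X Q.+ X Q.* Y) Q.+ Y Q.* Y) (3x m) (sym (fromℤ-* (+ 3) n)))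
      (sym (fromℤ-norm (+ 1 ℤ.+ + 3 ℤ.* m) (+ 3 ℤ.* n))))

  -- With X = 3 m + 1, three times the exponent is 3 (X² + 3 X n + 3 n²) = 3 N(X + n , n). The
  -- exponent itself is thus an integral norm, at a point with residue 1 modulo √-3.
  shear-form≡ : ∀ m n → shear-form Q._+_ Q._*_ (fromℤ (+ 3)) (fromℤ m Q.+ ⅓) (fromℤ n) ≡ fromℤ (+ 3 ℤ.* norm (shear (m , n)))
  shear-form≡ m n = trans (ℚ-id.scale-shear (fromℤ (+ 3)) (fromℤ m Q.+ ⅓) (fromℤ n))
    (trans (cong (λ X → fromℤ (+ 3) Q.* ((X Q.* X Q.+ fromℤ (+ 3) Q.* (X Q.* fromℤ n)) Q.+ fromℤ (+ 3) Q.* (fromℤ n Q.* fromℤ n))) (3x m))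
      (trans (sym expand) (cong fromℤ (cong (λ i → + 3 ℤ.* i) (ℤ-id.norm-shear m n)))))
    where
    X : ℤ
    X = + 1 ℤ.+ + 3 ℤ.* m
    expand : fromℤ (+ 3 ℤ.* (X ℤ.* X ℤ.+ + 3 ℤ.* (X ℤ.* n) ℤ.+ + 3 ℤ.* (n ℤ.* n))) ≡
      fromℤ (+ 3) Q.* ((fromℤ X Q.* fromℤ X Q.+ fromℤ (+ 3) Q.* (fromℤ X Q.* fromℤ n)) Q.+ fromℤ (+ 3) Q.* (fromℤ n Q.* fromℤ n))
    expand = trans (fromℤ-* (+ 3) _) (cong (λ p → fromℤ (+ 3) Q.* p) (trans (fromℤ-+ _ _) (cong₂ Q._+_
      (trans (fromℤ-+ _ _) (cong₂ Q._+_ (fromℤ-* X X) (trans (fromℤ-* (+ 3) (X ℤ.* n)) (cong (λ p → fromℤ (+ 3) Q.* p) (fromℤ-* X n)))))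
      (trans (fromℤ-* (+ 3) (n ℤ.* n)) (cong (λ p → fromℤ (+ 3) Q.* p) (fromℤ-* n n))))))

  -- The left-hand sides of these two are three times the exponents of the theorem.
  norm-exponent : ∀ m n → _
  norm-exponent m n = trans
    (norm-form-defs +ℚ-defs *ℚ-defs (+ 3 ℚ./ 1) (m ℚ./ 1 ℚ.+ + 1 ℚ./ 3) (n ℚ./ 1))
    (trans (form-cong (norm-form Q._+_ Q._*_) (fromℤ-def (+ 3)) (+ℚ-cong-defs +ℚ-defs (fromℤ-def m) (+ 1 ℚ./ 3)) (fromℤ-def n))
      (norm-form≡ m n))

  shear-exponent : ∀ m n → _
  shear-exponent m n = trans
    (shear-form-defs +ℚ-defs *ℚ-defs (+ 3 ℚ./ 1) (m ℚ./ 1 ℚ.+ + 1 ℚ./ 3) (n ℚ./ 1))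
    (trans (form-cong (shear-form Q._+_ Q._*_) (fromℤ-def (+ 3)) (+ℚ-cong-defs +ℚ-defs (fromℤ-def m) (+ 1 ℚ./ 3)) (fromℤ-def n))
      (shear-form≡ m n))

  ^[3×]-defs : ∀ r e k → (+ 3 ℚ./ 1) ℚ.* e ≡ fromℤ k → r ^[3× e ] ≡ r ^ ℤ.∣ k ∣
  ^[3×]-defs r e k eq = trans (cong (λ (p : ℚ) → r D.^ ℤ.∣ ℚ.numerator p ∣) eq)
    (trans (cong (λ (i : ℤ) → r D.^ ℤ.∣ i ∣) (↥-fromℤ k)) (^-defs r ℤ.∣ k ∣))

  -- Integral powers of ω

  module UnitPowers (ω : ℂˣ) (root : (1ℂ + val ω) + val ω * val ω ≈ 0ℂ) (cube : (val ω * val ω) * val ω ≈ 1ℂ) where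
    open CubeRoot (val ω) root cube

    w : ℂ
    w = val ω

    ŵ-add : ∀ a b → ŵ a * ŵ b ≈ ŵ (add₃ a b)
    ŵ-add = λ
      { zero             b                → *-identityˡ (ŵ b)
      ; (suc zero)       zero             → *-identityʳ w
      ; (suc zero)       (suc zero)       → ≈-refl
      ; (suc zero)       (suc (suc zero)) → ≈-trans (≈-sym (*-assoc w w w)) cube
      ; (suc (suc zero)) zero             → *-identityʳ (w * w)
      ; (suc (suc zero)) (suc zero)       → cube
      ; (suc (suc zero)) (suc (suc zero)) → ≈-trans (≈-sym (*-assoc (w * w) w w)) (≈-trans (*-congʳ cube) (*-identityˡ w)) }

    res-0 : res (+ 0) ≡ 0₃
    res-0 = res-unique 0₃ (+ 0) refl

    positive-power : ∀ n → w ^ n ≈ ŵ (res (+ n))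
    positive-power zero    = ≡⇒≈ (cong ŵ (sym res-0))
    positive-power (suc n) = ≈-trans (*-congˡ (positive-power n)) (≈-trans (ŵ-add 1₃ (res (+ n)))
      (≡⇒≈ (cong ŵ (sym (trans (res-+ (+ 1) (+ n)) (cong (λ r → add₃ r (res (+ n))) res-1))))))

    inverse≈ : w * inv ω ≈ 1ℂ → inv ω ≈ w * w
    inverse≈ wv≈1 = begin
      inv ω                      ≈⟨ *-identityˡ (inv ω) ⟨
      1ℂ * inv ω                 ≈⟨ *-congʳ cube ⟨
      ((w * w) * w) * inv ω      ≈⟨ *-assoc (w * w) w (inv ω) ⟩
      (w * w) * (w * inv ω)      ≈⟨ *-congˡ wv≈1 ⟩
      (w * w) * 1ℂ               ≈⟨ *-identityʳ (w * w) ⟩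
      w * w                      ∎
      where open SetoidReasoning setoid

    negative-power : inv ω ≈ w * w → ∀ n → inv ω ^ n ≈ ŵ (res (ℤ.- (+ n)))
    negative-power v≈ zero    = ≡⇒≈ (cong ŵ (sym res-0))
    negative-power v≈ (suc n) = ≈-trans (*-cong v≈ (negative-power v≈ n)) (≈-trans (ŵ-add 2₃ (res (ℤ.- (+ n))))
      (≡⇒≈ (cong ŵ (sym (trans (cong res (ℤ.neg-distrib-+ (+ 1) (+ n)))
        (trans (res-+ (ℤ.- (+ 1)) (ℤ.- (+ n))) (cong (λ r → add₃ r (res (ℤ.- (+ n)))) (trans (res-neg (+ 1)) (cong neg₃ res-1)))))))))

    -- Negative exponents are reduced by inv ω = ω², a consequence of ω³ = 1; then all powers depend
    -- on the exponent modulo 3.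
    integral-power : w * inv ω ≈ 1ℂ → ∀ k → ω ^ℤ k ≈ ŵ (res k)
    integral-power wv≈1 (+ n)    = ≈-trans (≡⇒≈ (^-defs w n)) (positive-power n)
    integral-power wv≈1 -[1+ n ] = ≈-trans (≡⇒≈ (^-defs (inv ω) (suc n))) (negative-power (inverse≈ wv≈1) (suc n))

  -- The two identities

  -- A function of its own for the power of Defs, which is a copy made by a module
  -- application and is unfolded by instantiation but not in type signatures; comparing
  -- both forms inside a product would unfold the product.
  pw : ℂ → ℕ → ℂ
  pw z n = z D.^ n

  pw-defs : ∀ z n → pw z n ≡ z ^ n
  pw-defs = ^-defs

  operator-defs : {A : Set} (_⊛_ _⊛′_ : A → A → A) (x y y′ : A) → _⊛_ ≡ _⊛′_ → y ≡ y′ → x ⊛ y ≡ x ⊛′ y′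
  operator-defs _⊛_ .(_⊛_) x y .y refl refl = refl

  *-^-defs : ∀ x q n → x D.* pw q n ≡ x * q ^ n
  *-^-defs x q n = operator-defs D._*_ C._*_ x (pw q n) (q ^ n) *-defs (pw-defs q n)

  sum-cubes : {A : Set} (_⊕_ _⊕′_ : A → A → A) (f g : A → A) (x y : A) → _⊕_ ≡ _⊕′_ → (∀ z → f z ≡ g z) → f x ⊕ f y ≡ g x ⊕′ g y
  sum-cubes _⊕_ .(_⊕_) f g x y refl f≡g = cong₂ _⊕_ (f≡g x) (f≡g y)

  cube-defs : ∀ z → pw z 3 ≡ z ^ 3
  cube-defs z = pw-defs z 3

  sum-cubes-defs : ∀ x y → _
  sum-cubes-defs x y = sum-cubes D._+_ C._+_ (λ z → pw z 3) (λ z → z ^ 3) x y +-defs cube-defs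

  3*-defs : ∀ z → _
  3*-defs z = apply-defs D.ℚ→ℂ C.ℚ→ℂ D._*_ C._*_ (+ 3 ℚ./ 1) (+ 3 ℚ./ 1) z z ℚ→ℂ-defs *-defs refl refl

  equation-defs : ∀ X X′ Y Y′ → X ≡ X′ → Y ≡ Y′ → X′ ≈ Y′ → X ≃ Y
  equation-defs X .X Y .Y refl refl p = ≈⇒≃ p

  three≈ : C.ℚ→ℂ (+ 3 ℚ./ 1) ≈ (1ℂ + 1ℂ) + 1ℂ
  three≈ = ≈-trans (≡⇒≈ (cong C.ℚ→ℂ 3/1≡3))
    (≈-trans (≐⇒≈ (ℚ→ℂ-+ (1ℚ Q.+ 1ℚ) 1ℚ)) (+-congʳ (≐⇒≈ (ℚ→ℂ-+ 1ℚ 1ℚ))))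

  cubic-equation : ∀ {A B C} → A ^ 3 + (3ℂ * B) ^ 3 ≈ C ^ 3 →
    pw A 3 D.+ pw (D.ℚ→ℂ (+ 3 ℚ./ 1) D.* B) 3 ≃ pw C 3
  cubic-equation {A} {B} {C} eq = equation-defs
    (pw A 3 D.+ pw (D.ℚ→ℂ (+ 3 ℚ./ 1) D.* B) 3) (A ^ 3 + (D.ℚ→ℂ (+ 3 ℚ./ 1) D.* B) ^ 3) (pw C 3) (C ^ 3)
    (sum-cubes-defs A (D.ℚ→ℂ (+ 3 ℚ./ 1) D.* B)) (cube-defs C)
    (≈-trans (+-congˡ (^-congˡ 3 (≈-trans (≡⇒≈ (3*-defs B)) (*-congʳ three≈)))) eq)

  cubic-equation′ : ∀ {A B C} → A ^ 3 + B ^ 3 ≈ C ^ 3 → pw A 3 D.+ pw B 3 ≃ pw C 3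
  cubic-equation′ {A} {B} {C} eq = equation-defs
    (pw A 3 D.+ pw B 3) (A ^ 3 + B ^ 3) (pw C 3) (C ^ 3) (sum-cubes-defs A B) (cube-defs C) eq

  -- The substitution behind 3 m² + 3 m n + n² = N(m , m + n), by which the sums of the second
  -- identity become sums over norms.
  converges-unshear : {g : L → ℂ} {s : ℂ} → Converges g s → Converges (λ (m , n) → g (m , m ℤ.+ n)) s
  converges-unshear {g} cg = converges-reindex (λ (m , k) → m , k ℤ.- m) (λ (m , n) → m , m ℤ.+ n)
    (λ (m , k) → cong (m ,_) (ℤ-id.+-difference′ m k)) (λ (m , n) → cong (m ,_) (ℤ-id.+-difference″ m n))
    (λ (m , n) → g (m , m ℤ.+ n))
    (converges-cong (λ (m , k) → ≡⇒≈ (cong (λ i → g (m , i)) (sym (ℤ-id.+-difference′ m k)))) ≈-refl cg)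

  cube-root≈ : ∀ {r q} → pw r 3 ≃ q → r ^ 3 ≈ q
  cube-root≈ {r} r³≃q = ≈-trans (≡⇒≈ (sym (cube-defs r))) (≃⇒≈ r³≃q)

  unit≈ : ∀ ω → val ω * inv ω ≈ 1ℂ
  unit≈ ω = ≈-trans (≡⇒≈ (sym (operator-defs D._*_ C._*_ (val ω) (inv ω) (inv ω) *-defs refl)))
    (≈-trans (≃⇒≈ (val*inv ω)) (≡⇒≈ 1-defs))

  module Families {q r : ℂ} (small-q : Small q) (r³≈q : r ^ 3 ≈ q) (ω : ℂˣ)
    (root : (1ℂ + val ω) + val ω * val ω ≈ 0ℂ) (cube : (val ω * val ω) * val ω ≈ 1ℂ) where
    open CubeRoot (val ω) root cube
    open UnitPowers ω root cube using (integral-power)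

    ω-power : ∀ k → ω ^ℤ k ≈ ŵ (res k)
    ω-power = integral-power (unit≈ ω)

    small-r : Small r
    small-r = small-root r³≈q small-q

    -- b(q), c(q) / 3 and a(q) in the notation of the Borweins

    b-sum : ∃[ s ] Converges (λ l → ŵ (χ l) * theta q l) s
    b-sum = _ , Theta.weighted-sum q small-q ŵ

    c-sum : ∃[ s ] Converges (λ l → theta r (1+3· l)) s
    c-sum = dominated⇒converges _≟ℤ²_ (Theta.coset-dominated q small-q r³≈q small-r)

    a-sum : ∃[ s ] Converges (theta q) s
    a-sum = _ , Theta.theta-sum q small-q

    b c a : ℂ
    b = proj₁ b-sum
    c = proj₁ c-sum
    a = proj₁ a-sum

    cubic : b ^ 3 + (3ℂ * c) ^ 3 ≈ a ^ 3
    cubic = cubic-theta small-q r³≈q (proj₂ b-sum) (proj₂ c-sum) (proj₂ a-sum)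

    b-term : ∀ m n → ω ^ℤ (m ℤ.- n) D.* pw q ℤ.∣ m ℤ.* m ℤ.+ m ℤ.* n ℤ.+ n ℤ.* n ∣ ≈ ŵ (χ (m , n)) * theta q (m , n)
    b-term m n =
      let eq = *-^-defs (ω ^ℤ (m ℤ.- n)) q ℤ.∣ m ℤ.* m ℤ.+ m ℤ.* n ℤ.+ n ℤ.* n ∣
      in ≈-trans (≡⇒≈ eq) (*-congʳ (ω-power (m ℤ.- n)))

    a-term : ∀ m n → pw q ℤ.∣ m ℤ.* m ℤ.+ m ℤ.* n ℤ.+ n ℤ.* n ∣ ≈ theta q (m , n)
    a-term m n = ≡⇒≈ (pw-defs q ℤ.∣ m ℤ.* m ℤ.+ m ℤ.* n ℤ.+ n ℤ.* n ∣)

    first : ∃[ A ] ∃[ B ] ∃[ C ]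
      HasSum {ℤ × ℤ} (λ (m , n) → ω ^ℤ (m ℤ.- n) D.* pw q ℤ.∣ m ℤ.* m ℤ.+ m ℤ.* n ℤ.+ n ℤ.* n ∣) A ×
      HasSum {ℤ × ℤ} (λ (m , n) →
        let x = m ℚ./ 1 ℚ.+ + 1 ℚ./ 3
            y = n ℚ./ 1
        in r ^[3× (+ 3 ℚ./ 1) ℚ.* (x ℚ.* x ℚ.+ x ℚ.* y ℚ.+ y ℚ.* y) ]) B ×
      HasSum {ℤ × ℤ} (λ (m , n) → pw q ℤ.∣ m ℤ.* m ℤ.+ m ℤ.* n ℤ.+ n ℤ.* n ∣) C ×
      pw A 3 D.+ pw (D.ℚ→ℂ (+ 3 ℚ./ 1) D.* B) 3 ≃ pw C 3
    first = b , c , a ,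
      converges⇒hasSum {f = λ (m , n) → ω ^ℤ (m ℤ.- n) D.* pw q ℤ.∣ m ℤ.* m ℤ.+ m ℤ.* n ℤ.+ n ℤ.* n ∣} {s = b}
        (converges-cong (λ (m , n) → ≈-sym (b-term m n)) ≈-refl (proj₂ b-sum)) ,
      converges⇒hasSum {f = λ (m , n) →
          let x = m ℚ./ 1 ℚ.+ + 1 ℚ./ 3
              y = n ℚ./ 1
          in r ^[3× (+ 3 ℚ./ 1) ℚ.* (x ℚ.* x ℚ.+ x ℚ.* y ℚ.+ y ℚ.* y) ]} {s = c}
        (converges-cong (λ (m , n) →
          let x = m ℚ./ 1 ℚ.+ + 1 ℚ./ 3
              y = n ℚ./ 1
          in ≈-sym (≡⇒≈ (^[3×]-defs r ((+ 3 ℚ./ 1) ℚ.* (x ℚ.* x ℚ.+ x ℚ.* y ℚ.+ y ℚ.* y)) (norm (1+3· (m , n))) (norm-exponent m n)))) ≈-refl (proj₂ c-sum)) ,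
      converges⇒hasSum {f = λ (m , n) → pw q ℤ.∣ m ℤ.* m ℤ.+ m ℤ.* n ℤ.+ n ℤ.* n ∣} {s = a}
        (converges-cong (λ (m , n) → ≈-sym (a-term m n)) ≈-refl (proj₂ a-sum)) ,
      cubic-equation {b} {c} {a} cubic

  module SecondFamilies {q r : ℂ} (small-q : Small q) (r³≈q : r ^ 3 ≈ q) (ω : ℂˣ)
    (root : (1ℂ + val ω) + val ω * val ω ≈ 0ℂ) (cube : (val ω * val ω) * val ω ≈ 1ℂ) where
    open CubeRoot (val ω) root cube
    open Families small-q r³≈q ω root cube using (ω-power)

    -- The three sums of the second identity are b, c and a at q³.
    module Cubed = Families {q ^ 3} {q} (small-^3 small-q) ≈-refl ω root cube
    open Cubed using (b; c; a; b-sum; c-sum; a-sum; cubic)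

    b′-sum : ∃[ s ] Converges (λ l → ŵ (χ′ l) * theta q l) s
    b′-sum = dominated⇒converges _≟ℤ²_
      (dominated-weighted ŵ χ′ (+ 0 , + 0) (Theta.theta-dominated q small-q))

    c′-sum : ∃[ s ] Converges (λ l → theta q (shear l)) s
    c′-sum = dominated⇒converges _≟ℤ²_ (dominated-reindex {f = theta q} (Embedding.to shear-embedding)
      (Embedding.from shear-embedding) (Embedding.from-to shear-embedding) (Theta.theta-dominated q small-q))

    b′ c′ : ℂ
    b′ = proj₁ b′-sum
    c′ = proj₁ c′-sum

    b′≈b : b′ ≈ b
    b′≈b = average-sum-unique (proj₂ b′-sum) (proj₂ b-sum)

    -- Both sides are the theta series at q over the residue class 1 modulo √-3: once parametrised
    -- by `shear`, once split into three rotations of 1 + 3 L.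
    c′≈3c : c′ ≈ 3ℂ * c
    c′≈3c = ≈-trans
      (converges-unique _≟ℤ²_
        (converges-cong (λ l → *-congʳ (≡⇒≈ (cong ι (shear-indicator l)))) ≈-refl
          (Pushforward.converges shear-embedding (theta q) (proj₂ c′-sum)))
        (Theta.γ-converges q small-q 1₃))
      (≈-trans (≈-sym (Theta.coset-sum q small-q (proj₂ c-sum))) (≈-id.triple c))

    cubic′ : b′ ^ 3 + c′ ^ 3 ≈ a ^ 3
    cubic′ = ≈-trans (+-cong (^-congˡ 3 b′≈b) (^-congˡ 3 c′≈3c)) cubic

    triple-power : ∀ {z w i j} → z ^ 3 ≈ w → i ≡ + 3 ℤ.* j → z ^ ℤ.∣ i ∣ ≈ w ^ ℤ.∣ j ∣
    triple-power {z} {w} {i} {j} z³≈w eq = ≈-trans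
      (≡⇒≈ (cong (λ n → z ^ n) (trans (cong ℤ.∣_∣ eq) (ℤ.abs-* (+ 3) j))))
      (≈-trans (≈-sym (^-assocʳ z 3 ℤ.∣ j ∣)) (^-congˡ ℤ.∣ j ∣ z³≈w))

    χ′-unshear : ∀ m n → χ′ (m , m ℤ.+ n) ≡ res (m ℤ.- n)
    χ′-unshear m n = sym (trans (cong res (ℤ-id.mod-3′ m n)) (trans (res-+ (ℤ.- m ℤ.- (m ℤ.+ n)) (+ 3 ℤ.* m))
      (trans (cong (add₃ (χ′ (m , m ℤ.+ n))) (res-3* m)) (add₃-identityʳ (χ′ (m , m ℤ.+ n))))))

    b′-term : ∀ m n → ω ^ℤ (m ℤ.- n) D.* pw q ℤ.∣ + 3 ℤ.* (m ℤ.* m) ℤ.+ + 3 ℤ.* (m ℤ.* n) ℤ.+ n ℤ.* n ∣ ≈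
      ŵ (χ′ (m , m ℤ.+ n)) * theta q (m , m ℤ.+ n)
    b′-term m n =
      let eq = *-^-defs (ω ^ℤ (m ℤ.- n)) q ℤ.∣ + 3 ℤ.* (m ℤ.* m) ℤ.+ + 3 ℤ.* (m ℤ.* n) ℤ.+ n ℤ.* n ∣
      in ≈-trans (≡⇒≈ eq) (*-cong (≈-trans (ω-power (m ℤ.- n)) (≡⇒≈ (cong ŵ (sym (χ′-unshear m n)))))
        (≡⇒≈ (cong (λ i → q ^ ℤ.∣ i ∣) (ℤ-id.norm-unshear m n))))

    c′-term : ∀ m n {e} → (+ 3 ℚ./ 1) ℚ.* e ≡ fromℤ (+ 3 ℤ.* norm (shear (m , n))) → r ^[3× e ] ≈ theta q (shear (m , n))
    c′-term m n {e} eq = ≈-trans (≡⇒≈ (^[3×]-defs r e (+ 3 ℤ.* norm (shear (m , n))) eq))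
      (triple-power {r} {q} {+ 3 ℤ.* norm (shear (m , n))} {norm (shear (m , n))} r³≈q refl)

    a′-term : ∀ m n → pw q ℤ.∣ + 3 ℤ.* (+ 3 ℤ.* (m ℤ.* m) ℤ.+ + 3 ℤ.* (m ℤ.* n) ℤ.+ n ℤ.* n) ∣ ≈ theta (q ^ 3) (m , m ℤ.+ n)
    a′-term m n = ≈-trans
      (≡⇒≈ (pw-defs q ℤ.∣ + 3 ℤ.* (+ 3 ℤ.* (m ℤ.* m) ℤ.+ + 3 ℤ.* (m ℤ.* n) ℤ.+ n ℤ.* n) ∣))
      (triple-power {q} {q ^ 3} {_} {norm (m , m ℤ.+ n)} ≈-refl (cong (λ i → + 3 ℤ.* i) (ℤ-id.norm-unshear m n)))

    second : ∃[ A ] ∃[ B ] ∃[ C ]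
      HasSum {ℤ × ℤ} (λ (m , n) →
        ω ^ℤ (m ℤ.- n) D.* pw q ℤ.∣ + 3 ℤ.* (m ℤ.* m) ℤ.+ + 3 ℤ.* (m ℤ.* n) ℤ.+ n ℤ.* n ∣) A ×
      HasSum {ℤ × ℤ} (λ (m , n) →
        let x = m ℚ./ 1 ℚ.+ + 1 ℚ./ 3
            y = n ℚ./ 1
            3ℚ = + 3 ℚ./ 1
        in r ^[3× 3ℚ ℚ.* (3ℚ ℚ.* (x ℚ.* x) ℚ.+ 3ℚ ℚ.* (x ℚ.* y) ℚ.+ y ℚ.* y) ]) B ×
      HasSum {ℤ × ℤ} (λ (m , n) →
        pw q ℤ.∣ + 3 ℤ.* (+ 3 ℤ.* (m ℤ.* m) ℤ.+ + 3 ℤ.* (m ℤ.* n) ℤ.+ n ℤ.* n) ∣) C ×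
      pw A 3 D.+ pw B 3 ≃ pw C 3
    second = b′ , c′ , a ,
      converges⇒hasSum {f = λ (m , n) →
          ω ^ℤ (m ℤ.- n) D.* pw q ℤ.∣ + 3 ℤ.* (m ℤ.* m) ℤ.+ + 3 ℤ.* (m ℤ.* n) ℤ.+ n ℤ.* n ∣} {s = b′}
        (converges-cong (λ (m , n) → ≈-sym (b′-term m n)) ≈-refl
          (converges-unshear {λ l → ŵ (χ′ l) * theta q l} (proj₂ b′-sum))) ,
      converges⇒hasSum {f = λ (m , n) →
          let x = m ℚ./ 1 ℚ.+ + 1 ℚ./ 3
              y = n ℚ./ 1
              3ℚ = + 3 ℚ./ 1
          in r ^[3× 3ℚ ℚ.* (3ℚ ℚ.* (x ℚ.* x) ℚ.+ 3ℚ ℚ.* (x ℚ.* y) ℚ.+ y ℚ.* y) ]} {s = c′}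
        (converges-cong (λ (m , n) →
          let x = m ℚ./ 1 ℚ.+ + 1 ℚ./ 3
              y = n ℚ./ 1
              3ℚ = + 3 ℚ./ 1
          in ≈-sym (c′-term m n {3ℚ ℚ.* (3ℚ ℚ.* (x ℚ.* x) ℚ.+ 3ℚ ℚ.* (x ℚ.* y) ℚ.+ y ℚ.* y)} (shear-exponent m n))) ≈-refl (proj₂ c′-sum)) ,
      converges⇒hasSum {f = λ (m , n) →
          pw q ℤ.∣ + 3 ℤ.* (+ 3 ℤ.* (m ℤ.* m) ℤ.+ + 3 ℤ.* (m ℤ.* n) ℤ.+ n ℤ.* n) ∣} {s = a}
        (converges-cong (λ (m , n) → ≈-sym (a′-term m n)) ≈-refl
          (converges-unshear {theta (q ^ 3)} (proj₂ a-sum))) ,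
      cubic-equation′ {b′} {c′} {a} cubic′

-- The two identities for ω given as exp(2πi/3)

open Analysis using (Small; modulus⇒small; _≈_; exp-2πi/3-root; exp-2πi/3-cube; seq-scale) renaming (_^_ to _^ᶜ_)
open Identity using (pw; cube-root≈; module Families; module SecondFamilies)

-- The power operation is a parameter, so the identities proved for `pw` pass to the power of the
-- theorem by an equality of functions, with the families and sums left untouched.
Claim : (ℂ → ℕ → ℂ) → Set
Claim _↑_ =
  (q q⅓ : ℂ) → ∣ q ∣< 1ℚ → q⅓ ↑ 3 ≃ q →
  (π : ℝ) → IsPi π →
  (ω : ℂˣ) → IsExp (0ℝ +i ℚ→ℝ (+ 2 ℚ./ 3) *ℝ π) (val ω) →
  (∃[ A ] ∃[ B ] ∃[ C ]
    HasSum {ℤ × ℤ} (λ (m , n) → ω ^ℤ (m ℤ.- n) D.* (q ↑ ℤ.∣ m ℤ.* m ℤ.+ m ℤ.* n ℤ.+ n ℤ.* n ∣)) A ×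
    HasSum {ℤ × ℤ} (λ (m , n) →
      let x = m ℚ./ 1 ℚ.+ + 1 ℚ./ 3
          y = n ℚ./ 1
      in q⅓ ^[3× (+ 3 ℚ./ 1) ℚ.* (x ℚ.* x ℚ.+ x ℚ.* y ℚ.+ y ℚ.* y) ]) B ×
    HasSum {ℤ × ℤ} (λ (m , n) → q ↑ ℤ.∣ m ℤ.* m ℤ.+ m ℤ.* n ℤ.+ n ℤ.* n ∣) C ×
    (A ↑ 3) D.+ ((D.ℚ→ℂ (+ 3 ℚ./ 1) D.* B) ↑ 3) ≃ C ↑ 3)
  ×
  (∃[ A ] ∃[ B ] ∃[ C ]
    HasSum {ℤ × ℤ} (λ (m , n) →
      ω ^ℤ (m ℤ.- n) D.* (q ↑ ℤ.∣ + 3 ℤ.* (m ℤ.* m) ℤ.+ + 3 ℤ.* (m ℤ.* n) ℤ.+ n ℤ.* n ∣)) A ×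
    HasSum {ℤ × ℤ} (λ (m , n) →
      let x = m ℚ./ 1 ℚ.+ + 1 ℚ./ 3
          y = n ℚ./ 1
          3ℚ = + 3 ℚ./ 1
      in q⅓ ^[3× 3ℚ ℚ.* (3ℚ ℚ.* (x ℚ.* x) ℚ.+ 3ℚ ℚ.* (x ℚ.* y) ℚ.+ y ℚ.* y) ]) B ×
    HasSum {ℤ × ℤ} (λ (m , n) →
      q ↑ ℤ.∣ + 3 ℤ.* (+ 3 ℤ.* (m ℤ.* m) ℤ.+ + 3 ℤ.* (m ℤ.* n) ℤ.+ n ℤ.* n) ∣) C ×
    (A ↑ 3) D.+ (B ↑ 3) ≃ C ↑ 3)

claim-pw : Claim pw
claim-pw q q⅓ small cube-root π isPi ω isExp =
    Families.first small-q r³≈q ω root cube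
  , SecondFamilies.second small-q r³≈q ω root cube
  where
  small-q : Small q
  small-q = modulus⇒small small
  r³≈q : q⅓ ^ᶜ 3 ≈ q
  r³≈q = cube-root≈ cube-root
  root : (C.1ℂ C.+ val ω) C.+ val ω C.* val ω ≈ C.0ℂ
  root = exp-2πi/3-root π isPi (ℚ→ℝ (+ 2 ℚ./ 3) *ℝ π) (seq-scale (+ 2 ℚ./ 3) π) {val ω} isExp
  cube : (val ω C.* val ω) C.* val ω ≈ C.1ℂ
  cube = exp-2πi/3-cube π isPi (ℚ→ℝ (+ 2 ℚ./ 3) *ℝ π) (seq-scale (+ 2 ℚ./ 3) π) {val ω} isExp

claim-^ : ∀ f → f ≡ (λ z n → z D.^ n) → Claim f → Claim (λ z n → z D.^ n)
claim-^ _ refl claim = claim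

open import Defs using (_+_; _*_; _^_; ℚ→ℂ)

theorem6p1 :
  (q q⅓ : ℂ) → ∣ q ∣< 1ℚ → q⅓ ^ 3 ≃ q →
  (π : ℝ) → IsPi π →
  (ω : ℂˣ) → IsExp (0ℝ +i ℚ→ℝ (+ 2 ℚ./ 3) *ℝ π) (val ω) →
  (∃[ A ] ∃[ B ] ∃[ C ]
    HasSum {ℤ × ℤ} (λ (m , n) →
      ω ^ℤ (m ℤ.- n) * q ^ ℤ.∣ m ℤ.* m ℤ.+ m ℤ.* n ℤ.+ n ℤ.* n ∣) A ×
    HasSum {ℤ × ℤ} (λ (m , n) →
      let x = m ℚ./ 1 ℚ.+ + 1 ℚ./ 3
          y = n ℚ./ 1
      in q⅓ ^[3× (+ 3 ℚ./ 1) ℚ.* (x ℚ.* x ℚ.+ x ℚ.* y ℚ.+ y ℚ.* y) ]) B ×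
    HasSum {ℤ × ℤ} (λ (m , n) →
      q ^ ℤ.∣ m ℤ.* m ℤ.+ m ℤ.* n ℤ.+ n ℤ.* n ∣) C ×
    A ^ 3 + (ℚ→ℂ (+ 3 ℚ./ 1) * B) ^ 3 ≃ C ^ 3)
  ×
  (∃[ A ] ∃[ B ] ∃[ C ]
    HasSum {ℤ × ℤ} (λ (m , n) →
      ω ^ℤ (m ℤ.- n) *
      q ^ ℤ.∣ + 3 ℤ.* (m ℤ.* m) ℤ.+ + 3 ℤ.* (m ℤ.* n) ℤ.+ n ℤ.* n ∣) A ×
    HasSum {ℤ × ℤ} (λ (m , n) →
      let x = m ℚ./ 1 ℚ.+ + 1 ℚ./ 3
          y = n ℚ./ 1
          3ℚ = + 3 ℚ./ 1
      in q⅓ ^[3× 3ℚ ℚ.* (3ℚ ℚ.* (x ℚ.* x) ℚ.+ 3ℚ ℚ.* (x ℚ.* y) ℚ.+ y ℚ.* y) ]) B ×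
    HasSum {ℤ × ℤ} (λ (m , n) →
      q ^ ℤ.∣ + 3 ℤ.* (+ 3 ℤ.* (m ℤ.* m) ℤ.+ + 3 ℤ.* (m ℤ.* n) ℤ.+ n ℤ.* n) ∣) C ×
    A ^ 3 + B ^ 3 ≃ C ^ 3)
theorem6p1 = claim-^ pw refl claim-pw
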